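{- If $A\subseteq\mathfrak S_n$ is Schur-positive and invariant under horizontal rotation (that is, $A=Ac_n$), then $A$ is cyclic Schur-positive.
   Context: Permutations are multiplied as functions: $(\sigma\tau)(i)=\sigma(\tau(i))$. $c_n\in\mathfrak S_n$ is the $n$-cycle $(1,2,\dots,n)$, i.e. $c_n=23\cdots n1$ in one-line notation, so $(\pi c_n)(i)=\pi(i+1)$ (indices mod $n$). For $\pi\in\mathfrak{S}_n$: $\operatorname{Des}(\pi)=\{i\in[n-1]:\pi(i)>\pi(i+1)\}$, $\operatorname{cDes}(\pi)=\{i\in[n]:\pi(i)>\pi(i+1)\}$ with $\pi(n+1):=\pi(1)$; $\mathbf{x}^J=\prod_{i\in J}x_i$. $A$ is Schur-positive if $\sum_{\pi\in A}\mathcal F_{n,\operatorname{Des}(\pi)}$ is symmetric and Schur-positive, where $\mathcal F_{n,D}=\sum x_{i_1}\cdots x_{i_n}$ over $i_1\le\cdots\le i_n$ with $i_j<i_{j+1}$ for $j\in D$. For a skew shape $\lambda/\mu$ with $n$ cells, $\operatorname{SYT}(\lambda/\mu)$ is its set of standard Young tableaux, $\operatorname{Des}(T)=\{i\in[n-1]: i+1$ is in a lower row than $i\}$. A cyclic descent extension on $\operatorname{SYT}(\lambda/\mu)$ is a pair $(\operatorname{cDes},\psi)$, $\operatorname{cDes}:\operatorname{SYT}(\lambda/\mu)\to 2^{[n]}$, $\psi$ a bijection, with $\operatorname{cDes}(T)\cap[n-1]=\operatorname{Des}(T)$, $\operatorname{cDes}(\psi T)=1+\operatorname{cDes}(T)$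 (mod $n$) and $\emptyset\subsetneq\operatorname{cDes}(T)\subsetneq[n]$; it exists iff $\lambda/\mu$ is not a connected ribbon (connected skew shape with no $2\times2$ square), and then $\sum_T\mathbf x^{\operatorname{cDes}(T)}$ is independent of the choice. $A$ is cyclic Schur-positive if there are nonnegative integers $m_{\lambda/\mu}$, indexed by skew shapes with $n$ cells that are not connected ribbons, with $\sum_{\pi\in A}\mathbf x^{\operatorname{cDes}(\pi)}=\sum_{\lambda/\mu}m_{\lambda/\mu}\sum_{T\in\operatorname{SYT}(\lambda/\mu)}\mathbf x^{\operatorname{cDes}(T)}$.
   Formalization: The formal theorem assumes n ≥ 2; for n = 1 the claim fails, since A = {id} is Schur-positive and invariant under horizontal rotation, but every skew shape with one cell is a connected ribbon. -}

module Defs where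

open import Data.Nat using (ℕ; zero; suc; _+_; _≤_; _<_; NonZero)
import Data.Nat as ℕ
open import Data.Nat.DivMod using (_%_; m%n<n)
open import Data.Fin using (Fin; toℕ; fromℕ<)
import Data.Fin as F
open import Data.Fin.Subset using (Subset)
open import Data.Vec using (Vec; lookup; tabulate; toList)
open import Data.List using (List; []; _∷_; length; concat; map)
open import Data.Nat.ListAction using (sum)
open import Data.Maybe using (Maybe; just; nothing)
open import Data.Bool using (Bool; true; false; _∧_)
open import Data.Product using (Σ; ∃; _×_; _,_; proj₁; proj₂)
open import Data.Sum using (_⊎_)
open import Data.Refinement using (Refinement; value)
open import Relation.Nullary using (¬_)
open import Relation.Nullary.Decidable using (⌊_⌋)
open import Relation.Binary.PropositionalEquality using (_≡_)
open import Relation.Binary.Construct.Closure.ReflexiveTransitive using (Star)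
open import Data.List.Relation.Binary.Permutation.Propositional using (_↭_)
open import Function.Bundles using (_↔_; Inverse)

-- Conventions.
-- [n] = {1,…,n} is represented by Fin n, the element i+1 ∈ [n] being the
-- index i : Fin n.  A subset of [n] is a 'Subset n' (= Vec Bool n).
-- A permutation π ∈ 𝔖_n is given in one-line notation as a vector
-- π : Vec (Fin n) n (π(i+1) = lookup π i, values shifted down by one),
-- which must be injective.

next : ∀ {n} → Fin n → Fin n
next {suc n} i = fromℕ< (m%n<n (suc (toℕ i)) (suc n))

IsPerm : ∀ {n} → Vec (Fin n) n → Set
IsPerm {n} π = ∀ (i j : Fin n) → lookup π i ≡ lookup π j → i ≡ j

rot : ∀ {n} → Vec (Fin n) n → Vec (Fin n) n
rot π = tabulate (λ i → lookup π (next i))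

Des : ∀ {n} → Vec (Fin n) n → Subset n
Des {n} π = tabulate (λ i → ⌊ suc (toℕ i) ℕ.<? n ⌋ ∧ ⌊ lookup π (next i) F.<? lookup π i ⌋)

cDes : ∀ {n} → Vec (Fin n) n → Subset n
cDes {n} π = tabulate (λ i → ⌊ lookup π (next i) F.<? lookup π i ⌋)

-- A subset A ⊆ 𝔖_n is given by a characteristic function on one-line
-- vectors (only its values on permutations matter); its elements:
Elems : ∀ n → (Vec (Fin n) n → Bool) → (Vec (Fin n) n → Set) → Set
Elems n A P = Refinement (Vec (Fin n) n) (λ π → IsPerm π × A π ≡ true × P π)

RotationInvariant : ∀ n → (Vec (Fin n) n → Bool) → Set
RotationInvariant n A = ∀ (π : Vec (Fin n) n) → IsPerm π → A π ≡ A (rot π)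

-- Monomials and quasisymmetric / Schur functions (coefficientwise).
-- A monomial x_{i_1}⋯x_{i_n} of degree n (variables indexed by ℕ) is
-- identified with its unique weakly increasing index sequence w.

WeaklyIncreasing : ∀ {n} → Vec ℕ n → Set
WeaklyIncreasing {n} w = ∀ (i j : Fin n) → i F.≤ j → lookup w i ≤ lookup w j

-- the monomial w occurs (with coefficient 1) in F_{n,D} iff
-- w_j < w_{j+1} for all j ∈ D (D ⊆ [n-1])
OccursInF : ∀ {n} → Subset n → Vec ℕ n → Set
OccursInF {n} D w = ∀ (i : Fin n) → lookup D i ≡ true → lookup w i < lookup w (next i)

part : List ℕ → ℕ → ℕ
part [] r = 0
part (x ∷ l) zero = x
part (x ∷ l) (suc r) = part l r

IsPartitionShape : List ℕ → Set
IsPartitionShape la = (∀ r → part la (suc r) ≤ part la r)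
                    × (∀ r → r < length la → 0 < part la r)

Partition : ℕ → Set
Partition n = Refinement (List ℕ) (λ la → IsPartitionShape la × sum la ≡ n)

-- fillings by rows (English notation, row 0 on top)
entry : List (List ℕ) → ℕ → ℕ → Maybe ℕ
entry [] r c = nothing
entry (row ∷ rows) zero c = nth row c
  where
  nth : List ℕ → ℕ → Maybe ℕ
  nth [] k = nothing
  nth (x ∷ xs) zero = just x
  nth (x ∷ xs) (suc k) = nth xs k
entry (row ∷ rows) (suc r) c = entry rows r c

IsSSYT : List ℕ → ∀ {n} → Vec ℕ n → List (List ℕ) → Set
IsSSYT la w T =
    map length T ≡ la
  × (∀ r c a b → entry T r c ≡ just a → entry T r (suc c) ≡ just b → a ≤ b)
  × (∀ r c a b → entry T r c ≡ just a → entry T (suc r) c ≡ just b → a < b)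
  × (concat T ↭ toList w)

SSYT : List ℕ → ∀ {n} → Vec ℕ n → Set
SSYT la w = Refinement (List (List ℕ)) (IsSSYT la w)

-- A is Schur-positive: Σ_{π∈A} F_{n,Des π} = Σ_λ c_λ s_λ with c_λ ∈ ℕ
-- (the multiset of partitions L encodes the c_λ); equality of the two
-- formal power series is checked monomialwise, equality of coefficients
-- being expressed by a bijection between the sets they count.
SchurPositive : ∀ n → (Vec (Fin n) n → Bool) → Set
SchurPositive n A =
  ∃ λ (L : List (Partition n)) →
    ∀ (w : Vec ℕ n) → WeaklyIncreasing w →
      Elems n A (λ π → OccursInF (Des π) w)
        ↔ Σ (Fin (length L)) (λ k → SSYT (value (Data.List.lookup L k)) w)
  where import Data.List

-- Skew shapes la/mu (cells (r , c), row r, column c, 0-indexed)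

InSkew : List ℕ → List ℕ → ℕ × ℕ → Set
InSkew la mu (r , c) = part mu r ≤ c × c < part la r

Neighbour : ℕ × ℕ → ℕ × ℕ → Set
Neighbour (r , c) (r' , c') =
    (r ≡ r' × (suc c ≡ c' ⊎ c ≡ suc c'))
  ⊎ (c ≡ c' × (suc r ≡ r' ⊎ r ≡ suc r'))

Adjacent : List ℕ → List ℕ → ℕ × ℕ → ℕ × ℕ → Set
Adjacent la mu a b = InSkew la mu a × InSkew la mu b × Neighbour a b

Connected : List ℕ → List ℕ → Set
Connected la mu = ∀ a b → InSkew la mu a → InSkew la mu b → Star (Adjacent la mu) a b

Has2x2Square : List ℕ → List ℕ → Set
Has2x2Square la mu = ∃ λ r → ∃ λ c →
    InSkew la mu (r , c) × InSkew la mu (r , suc c)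
  × InSkew la mu (suc r , c) × InSkew la mu (suc r , suc c)

ConnectedRibbon : List ℕ → List ℕ → Set
ConnectedRibbon la mu = Connected la mu × ¬ Has2x2Square la mu

IsSkewShape : ℕ → List ℕ → List ℕ → Set
IsSkewShape n la mu =
    IsPartitionShape la × IsPartitionShape mu
  × (∀ r → part mu r ≤ part la r)
  × sum la ≡ sum mu + n

NonRibbonSkewShape : ℕ → Set
NonRibbonSkewShape n =
  Refinement (List ℕ × List ℕ)
    (λ s → IsSkewShape n (proj₁ s) (proj₂ s) × ¬ ConnectedRibbon (proj₁ s) (proj₂ s))

-- standard Young tableaux of shape la/mu: T lists, for each entry
-- i+1 ∈ [n] (index i : Fin n), the cell containing it
IsSYT : ∀ n → List ℕ → List ℕ → Vec (ℕ × ℕ) n → Set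
IsSYT n la mu T =
    (∀ i → InSkew la mu (lookup T i))
  × (∀ i j → lookup T i ≡ lookup T j → i ≡ j)
  × (∀ a → InSkew la mu a → ∃ λ i → lookup T i ≡ a)
  × (∀ i j → proj₁ (lookup T i) ≡ proj₁ (lookup T j)
           → proj₂ (lookup T i) < proj₂ (lookup T j) → i F.< j)
  × (∀ i j → proj₂ (lookup T i) ≡ proj₂ (lookup T j)
           → proj₁ (lookup T i) < proj₁ (lookup T j) → i F.< j)

SYT : ℕ → List ℕ → List ℕ → Set
SYT n la mu = Refinement (Vec (ℕ × ℕ) n) (IsSYT n la mu)

DesT : ∀ n la mu → SYT n la mu → Subset n
DesT n la mu T = tabulate (λ i → ⌊ suc (toℕ i) ℕ.<? n ⌋
                          ∧ ⌊ proj₁ (lookup (value T) i) ℕ.<? proj₁ (lookup (value T) (next i)) ⌋)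

record CyclicDescentExtension (n : ℕ) (la mu : List ℕ) : Set where
  field
    cDesT   : SYT n la mu → Subset n
    ψ       : SYT n la mu ↔ SYT n la mu
    extends : ∀ T (i : Fin n) → suc (toℕ i) < n → lookup (cDesT T) i ≡ lookup (DesT n la mu T) i
    shifts  : ∀ T (i : Fin n) → lookup (cDesT (Inverse.to ψ T)) (next i) ≡ lookup (cDesT T) i
    nonEmpty : ∀ T → ∃ λ i → lookup (cDesT T) i ≡ true
    nonFull  : ∀ T → ∃ λ i → lookup (cDesT T) i ≡ false

open CyclicDescentExtension public

ShapeWithExtension : ℕ → Set
ShapeWithExtension n =
  Σ (NonRibbonSkewShape n) (λ s → CyclicDescentExtension n (proj₁ (value s)) (proj₂ (value s)))

-- A is cyclic Schur-positive: Σ_{π∈A} x^{cDes π} = Σ m_{λ/μ} Σ_T x^{cDes T}.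
-- The multiset of shapes L encodes the m_{λ/μ}; each listed shape comes
-- with a cyclic descent extension (the inner sum is independent of it).
-- Equality of coefficients of x^J is expressed by a bijection.
CyclicSchurPositive : ∀ n → (Vec (Fin n) n → Bool) → Set
CyclicSchurPositive n A =
  ∃ λ (L : List (ShapeWithExtension n)) →
    ∀ (J : Subset n) →
      Elems n A (λ π → cDes π ≡ J)
        ↔ Σ (Fin (length L)) (λ k →
             let s = Data.List.lookup L k
                 la = proj₁ (value (proj₁ s))
                 mu = proj₂ (value (proj₁ s))
             in Refinement (SYT n la mu) (λ T → cDesT (proj₂ s) T ≡ J))
  where import Data.List

{-# OPTIONS --safe #-}
module Submission where

-- If A is invariant under rotation, cDes restricted to A is rotation invariant, so it is
-- determined by the distribution of Des on A, that is, by the shapes λ in Σ c_λ s_λ.  For a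
-- non-hook λ a cyclic descent extension is obtained explicitly.  Choose a corner d of λ outside
-- the first row and column and put ν = λ - d.  A tableau V of shape ν, cut after its entry a into
-- V = A|B, is rotated to B•A with an extra cell •, a descent after B and an ascent before A; this
-- cyclic string is given to λ when the row insertion path started at the cut ends at d.
--  * Tableau switching A|B → B'|A' turns this row insertion path along B into a column insertion
--    path along A', so the pairs (V , a) are counted by the tableaux of shape λ with the same
--    linear descents.
--  * When the cut moves past one entry, the strings gained and lost by d correspond to the corners
--    of ν next to d on either side, and both are counted by the tableaux of shape ν: hence
--    the resulting distribution of cyclic descent sets on λ is rotation invariant.
-- The hooks are left over.  What remains of the cDes distribution depends only on the number
-- of cyclic descents, and is a sum of shapes "column plus disjoint row".

open import Defs
open import Data.Nat using (ℕ; zero; suc; pred; _+_; _*_; _∸_; _≤_; _<_; z≤n; s≤s; _<ᵇ_; _≟_; _≤?_; _<?_)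
open import Data.Nat.Properties hiding (_≟_; _≤?_; _<?_)
open import Data.Nat.DivMod using (_%_; m<n⇒m%n≡m; n%n≡0)
open import Data.Nat.ListAction using (sum)
open import Data.Bool using (Bool; true; false; _∧_; if_then_else_)
import Data.Bool as Bool
open import Data.Empty using (⊥; ⊥-elim)
open import Data.Unit using (⊤; tt)
open import Data.Fin using (Fin; zero; suc; toℕ; fromℕ; inject₁)
import Data.Fin as F
open import Data.Fin.Induction using (<-weakInduction)
open import Data.Fin.Permutation using (↔⇒≡)
open import Data.Fin.Properties using (+↔⊎; toℕ-injective; toℕ-fromℕ<; toℕ-fromℕ; toℕ-inject₁; toℕ<n)
import Data.Fin.Properties as F
open import Data.Fin.Relation.Unary.Top using (view; ‵fromℕ; ‵inject₁)
open import Data.Irrelevant using ([_])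
open import Data.List using (List; []; _∷_; length; _++_; _∷ʳ_; map; concat; filter; replicate; upTo; allFin; cartesianProduct; cartesianProductWith)
import Data.List as List
open import Data.List.Membership.Propositional using (_∈_; lose)
open import Data.List.Membership.Propositional.Properties
open import Data.List.Properties using (∷-injective; ∷-injectiveˡ; ∷-injectiveʳ; ∷ʳ-injective; ++-assoc; ++-identityʳ; ≡-dec; length-++; length-replicate; filter-++)
open import Data.List.Relation.Binary.Permutation.Propositional using (_↭_; ↭-refl; ↭-sym; ↭-trans; prep)
import Data.List.Relation.Binary.Permutation.Propositional.Properties as Perm
open import Data.List.Relation.Binary.Pointwise using (Pointwise; []; _∷_)
import Data.List.Relation.Binary.Pointwise as Pointwise
open import Data.List.Relation.Unary.All using (All; []; _∷_)
import Data.List.Relation.Unary.All as All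
open import Data.List.Relation.Unary.AllPairs using (AllPairs; []; _∷_)
open import Data.List.Relation.Unary.Any using (Any; here; there; any?; index)
open import Data.List.Relation.Unary.Any.Properties using (lookup-index)
open import Data.List.Relation.Unary.Unique.Propositional using (Unique)
import Data.List.Relation.Unary.Unique.Propositional.Properties as Unique
open import Data.Maybe using (Maybe; just; nothing)
open import Data.Maybe.Properties using (just-injective)
open import Data.Product using (Σ; ∃; _×_; _,_; proj₁; proj₂)
open import Data.Product.Properties using () renaming (≡-dec to ×-≡-dec)
open import Data.Refinement using (Refinement; value; _,_)
open import Data.Sum using (_⊎_; inj₁; inj₂; [_,_]′)
import Data.Sum as Sum
open import Data.Sum.Properties using (inj₁-injective; inj₂-injective)
open import Data.Vec using (Vec; []; _∷_; lookup; tabulate; toList)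
import Data.Vec as Vec
open import Data.Vec.Properties using (lookup∘tabulate; tabulate∘lookup; tabulate-cong) renaming (≡-dec to Vec-≡-dec; ∷-injective to Vec-∷-injective)
open import Function.Bundles using (_↔_; Inverse; mk↔ₛ′)
open import Function.Construct.Composition using (_↔-∘_)
open import Function.Construct.Symmetry using (↔-sym)
open import Relation.Binary.Construct.Closure.ReflexiveTransitive using (Star; ε; _◅_)
open import Relation.Binary.Definitions using (tri<; tri≈; tri>)
open import Relation.Binary.PropositionalEquality hiding (J; [_])
open import Relation.Nullary using (¬_; Dec; yes; no; contradiction; recompute)
open import Relation.Nullary.Decidable using (⌊_⌋; isYes≗does; dec-true; dec-false; map′; _×-dec_; _→-dec_)

-- Shapes, lattice words and tableau switching

-- The hooks are the straight shapes that are connected ribbons, so they cannot be listed in the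
-- answer and their share has to be regrouped. The delicate point is that the remainder, a
-- difference of two distributions, is nonnegative. It is therefore evaluated at the string of `a`
-- falses followed by `k` trues: a tableau whose linear descents have this form is a hook, so the
-- non-hook share vanishes there, and the multiplicity of each "column plus row" is the number of
-- `π` in `A` with that very cyclic descent set.
--
-- The corner d avoids the first row and column because of the extreme cuts. With `B` empty the row
-- path stays in row 0, and with `A` empty it ends in the first empty row; hence neither extreme cut
-- is given to λ, and moving the cut past an entry leaves no boundary terms.
--
-- Rotation invariance is an equality of cardinalities only: the crossings lost and gained are
-- compared through a third set, the tableaux of shape ν with prescribed linear descents. No
-- explicit rotation of tableaux results, and the bijection `ψ` is assembled from fibres of equal
-- size.

bump : List ℕ → ℕ → List ℕ
bump [] zero = 1 ∷ []
bump [] (suc r) = 0 ∷ bump [] r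
bump (x ∷ γ) zero = suc x ∷ γ
bump (x ∷ γ) (suc r) = x ∷ bump γ r

part-bump-≡ : ∀ γ r → part (bump γ r) r ≡ suc (part γ r)
part-bump-≡ [] zero = refl
part-bump-≡ [] (suc r) = part-bump-≡ [] r
part-bump-≡ (x ∷ γ) zero = refl
part-bump-≡ (x ∷ γ) (suc r) = part-bump-≡ γ r

part-bump-≢ : ∀ γ {r s} → r ≢ s → part (bump γ r) s ≡ part γ s
part-bump-≢ [] {zero} {zero} r≢s = contradiction refl r≢s
part-bump-≢ [] {zero} {suc s} r≢s = refl
part-bump-≢ [] {suc r} {zero} r≢s = refl
part-bump-≢ [] {suc r} {suc s} r≢s = part-bump-≢ [] (λ e → r≢s (cong suc e))
part-bump-≢ (x ∷ γ) {zero} {zero} r≢s = contradiction refl r≢s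
part-bump-≢ (x ∷ γ) {zero} {suc s} r≢s = refl
part-bump-≢ (x ∷ γ) {suc r} {zero} r≢s = refl
part-bump-≢ (x ∷ γ) {suc r} {suc s} r≢s = part-bump-≢ γ (λ e → r≢s (cong suc e))

part≤part-bump : ∀ γ r s → part γ s ≤ part (bump γ r) s
part≤part-bump γ r s with r ≟ s
... | yes refl = subst (part γ s ≤_) (sym (part-bump-≡ γ s)) (n≤1+n _)
... | no r≢s = ≤-reflexive (sym (part-bump-≢ γ r≢s))

bump-comm : ∀ γ a b → bump (bump γ a) b ≡ bump (bump γ b) a
bump-comm [] zero zero = refl
bump-comm [] zero (suc b) = refl
bump-comm [] (suc a) zero = refl
bump-comm [] (suc a) (suc b) = cong (0 ∷_) (bump-comm [] a b)
bump-comm (x ∷ γ) zero zero = refl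
bump-comm (x ∷ γ) zero (suc b) = refl
bump-comm (x ∷ γ) (suc a) zero = refl
bump-comm (x ∷ γ) (suc a) (suc b) = cong (x ∷_) (bump-comm γ a b)

-- A record rather than a function type, so that `γ` can be inferred from a proof.
record Decreasing (γ : List ℕ) : Set where
  constructor decreasing
  field descent : ∀ r → part γ (suc r) ≤ part γ r
open Decreasing public

data Addable (γ : List ℕ) : ℕ → Set where
  zero : Addable γ zero
  suc : ∀ {r} → part γ (suc r) < part γ r → Addable γ (suc r)

addable-suc : ∀ {γ r} → Addable γ (suc r) → part γ (suc r) < part γ r
addable-suc (suc p) = p

addable? : ∀ γ r → Dec (Addable γ r)
addable? γ zero = yes zero
addable? γ (suc r) with part γ (suc r) <? part γ r
... | yes p = yes (suc p)
... | no ¬p = no λ { (suc p) → ¬p p }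

bump-decreasing : ∀ {γ r} → Decreasing γ → Addable γ r → Decreasing (bump γ r)
descent (bump-decreasing {γ} {r} dγ ar) s with r ≟ suc s
... | yes refl = subst (_≤ part (bump γ r) s) (sym (part-bump-≡ γ r))
                   (≤-trans (addable-suc ar) (part≤part-bump γ r s))
... | no r≢ = subst (_≤ part (bump γ r) s) (sym (part-bump-≢ γ r≢))
                (≤-trans (descent dγ s) (part≤part-bump γ r s))

Addable-bump : ∀ γ {a b} → a ≢ b → Addable γ b → Addable (bump γ a) b
Addable-bump γ a≢b zero = zero
Addable-bump γ {a} {suc b} a≢b (suc ab) =
  suc (subst (_< part (bump γ a) b) (sym (part-bump-≢ γ a≢b)) (≤-trans ab (part≤part-bump γ a b)))

Addable-bump-self : ∀ γ {x} → Decreasing γ → Addable (bump γ x) (suc x)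
Addable-bump-self γ {x} dγ =
  suc (subst₂ _<_ (sym (part-bump-≢ γ (m≢1+m x))) (sym (part-bump-≡ γ x)) (s≤s (descent dγ x)))
  where
  m≢1+m : ∀ m → m ≢ suc m
  m≢1+m m ()

part-mono : ∀ {γ} → Decreasing γ → ∀ {r s} → r ≤ s → part γ s ≤ part γ r
part-mono dγ {r} {s} r≤s with m≤n⇒m<n∨m≡n r≤s
... | inj₂ refl = ≤-refl
part-mono dγ {r} {suc s} r≤s | inj₁ (s≤s r≤s') = ≤-trans (descent dγ s) (part-mono dγ r≤s')

-- Lattice words relative to `γ`: each letter is the row of the next cell, so a path from `γ` to `δ`
-- is a standard tableau of shape `δ/γ`. Cutting a tableau after an entry is then splitting a list,
-- without renumbering.
data Path : List ℕ → List ℕ → Set where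
  [] : ∀ {γ} → Path γ []
  _∷_ : ∀ {γ r w} → Addable γ r → Path (bump γ r) w → Path γ (r ∷ w)

ends : List ℕ → List ℕ → List ℕ
ends γ [] = γ
ends γ (r ∷ w) = ends (bump γ r) w

ends-++ : ∀ γ u w → ends γ (u ++ w) ≡ ends (ends γ u) w
ends-++ γ [] w = refl
ends-++ γ (r ∷ u) w = ends-++ (bump γ r) u w

path-++⁺ : ∀ {γ u w} → Path γ u → Path (ends γ u) w → Path γ (u ++ w)
path-++⁺ [] q = q
path-++⁺ (a ∷ p) q = a ∷ path-++⁺ p q

path-++⁻ : ∀ {γ} u {w} → Path γ (u ++ w) → Path γ u × Path (ends γ u) w
path-++⁻ [] p = [] , p
path-++⁻ (r ∷ u) (a ∷ p) = let (q₁ , q₂) = path-++⁻ u p in a ∷ q₁ , q₂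

ends-decreasing : ∀ {γ w} → Decreasing γ → Path γ w → Decreasing (ends γ w)
ends-decreasing dγ [] = dγ
ends-decreasing {γ} dγ (_∷_ {r = r} a p) = ends-decreasing (bump-decreasing {γ} {r} dγ a) p

path? : ∀ γ w → Dec (Path γ w)
path? γ [] = yes []
path? γ (r ∷ w) with addable? γ r | path? (bump γ r) w
... | yes a | yes p = yes (a ∷ p)
... | no ¬a | _ = no λ { (a ∷ p) → ¬a a }
... | _ | no ¬p = no λ { (a ∷ p) → ¬p p }

des : List ℕ → List Bool
des [] = []
des (x ∷ []) = []
des (x ∷ y ∷ w) = (x <ᵇ y) ∷ des (y ∷ w)

<ᵇ-cong : ∀ {a b c d} → (a < b → c < d) → (c < d → a < b) → (a <ᵇ b) ≡ (c <ᵇ d)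
<ᵇ-cong {a} {b} {c} {d} f g with a <ᵇ b in p | c <ᵇ d in q
... | true | true = refl
... | false | false = refl
... | true | false = ⊥-elim (subst Bool.T q (<⇒<ᵇ (f (<ᵇ⇒< a b (subst Bool.T (sym p) tt)))))
... | false | true = ⊥-elim (subst Bool.T p (<⇒<ᵇ (g (<ᵇ⇒< c d (subst Bool.T (sym q) tt)))))

-- Among rows of equal length only the uppermost can grow, so for decreasing `γ` this is the row of
-- the addable cell in column `part γ x`.
top : List ℕ → ℕ → ℕ
top γ zero = zero
top γ (suc x) with part γ (suc x) ≟ part γ x
... | yes _ = top γ x
... | no _ = suc x

IsTop : List ℕ → ℕ → ℕ → Set
IsTop γ x t = t ≤ x × part γ t ≡ part γ x × Addable γ t

top-isTop : ∀ {γ} → Decreasing γ → ∀ x → IsTop γ x (top γ x)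
top-isTop dγ zero = z≤n , refl , zero
top-isTop {γ} dγ (suc x) with part γ (suc x) ≟ part γ x
... | yes e = let (p , q , r) = top-isTop dγ x in m≤n⇒m≤1+n p , trans q (sym e) , r
... | no ¬e = ≤-refl , refl , suc (≤∧≢⇒< (descent dγ x) ¬e)

isTop-≤ : ∀ {γ} → Decreasing γ → ∀ {x t u} → IsTop γ x t → IsTop γ x u → t ≤ u
isTop-≤ dγ {x} {zero} p q = z≤n
isTop-≤ {γ} dγ {x} {suc t} {u} (t≤x , pt , at) (u≤x , pu , au) with suc t ≤? u
... | yes p = p
... | no ¬p = contradiction (≤-trans (addable-suc at) (≤-trans (part-mono dγ (≤-pred (≰⇒> ¬p))) (≤-reflexive (trans pu (sym pt))))) (<-irrefl refl)

isTop-unique : ∀ {γ} → Decreasing γ → ∀ {x t u} → IsTop γ x t → IsTop γ x u → t ≡ u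
isTop-unique dγ p q = ≤-antisym (isTop-≤ dγ p q) (isTop-≤ dγ q p)

top-unique : ∀ {γ} → Decreasing γ → ∀ {x t} → IsTop γ x t → top γ x ≡ t
top-unique dγ {x} p = isTop-unique dγ (top-isTop dγ x) p

between-top : ∀ {γ} → Decreasing γ → ∀ {x t s} → IsTop γ x t → t ≤ s → s ≤ x → part γ s ≡ part γ x
between-top dγ (_ , pt , _) t≤s s≤x =
  ≤-antisym (≤-trans (part-mono dγ t≤s) (≤-reflexive pt)) (part-mono dγ s≤x)

-- Bender–Knuth toggles: from the shape γ, the letters a b are exchanged
-- whenever both orders are legal.
data Tog (γ : List ℕ) : ℕ → ℕ → ℕ → ℕ → Set where
  swap : ∀ {a b} → a ≢ b → Addable γ a → Addable γ b → Tog γ a b b a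
  same : ∀ {a} → Tog γ a a a a
  tight : ∀ {a} → part γ a ≡ part γ (suc a) → Tog γ a (suc a) a (suc a)

-- A letter `b ≢ a` that becomes legal only after `a` has its cell directly under that of `a`, which
-- is the `tight` case.
tog-total : ∀ {γ a b} → Addable γ a → Addable (bump γ a) b → ∃ λ c → ∃ λ d → Tog γ a b c d
tog-total {γ} {a} {b} aa ab with a ≟ b | addable? γ b
... | yes refl | _ = _ , _ , same
... | no a≢b | yes ab' = _ , _ , swap a≢b aa ab'
... | no a≢b | no ¬ab with b
... | zero = contradiction zero ¬ab
... | suc b' with a ≟ b'
... | no a≢b' = contradiction (suc (subst₂ _<_ (part-bump-≢ γ a≢b) (part-bump-≢ γ a≢b') (addable-suc ab))) ¬ab
... | yes refl = _ , _ , tight (≤-antisym (≮⇒≥ (λ p → ¬ab (suc p))) (≤-pred (subst₂ _<_ (part-bump-≢ γ a≢b) (part-bump-≡ γ a) (addable-suc ab))))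

tog-sym : ∀ {γ a b c d} → Tog γ a b c d → Tog γ c d a b
tog-sym (swap n p q) = swap (≢-sym n) q p
tog-sym same = same
tog-sym (tight e) = tight e

tog-path : ∀ {γ a b c d} → Addable γ a → Addable (bump γ a) b → Tog γ a b c d →
           Addable γ c × Addable (bump γ c) d
tog-path {γ} p q (swap n _ r) = r , Addable-bump γ (≢-sym n) p
tog-path p q same = p , q
tog-path p q (tight e) = p , q

tog-bump : ∀ {γ a b c d} → Tog γ a b c d → bump (bump γ a) b ≡ bump (bump γ c) d
tog-bump {γ} {a} {b} (swap _ _ _) = bump-comm γ a b
tog-bump same = refl
tog-bump (tight _) = refl

tog-det : ∀ {γ a b c d c' d'} → Tog γ a b c d → Tog γ a b c' d' → c ≡ c' × d ≡ d'
tog-det (swap _ _ _) (swap _ _ _) = refl , refl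
tog-det (swap n _ _) same = contradiction refl n
tog-det (swap _ _ r) (tight e) = contradiction (addable-suc r) (<-irrefl (sym e))
tog-det same (swap n _ _) = contradiction refl n
tog-det same same = refl , refl
tog-det (tight e) (swap _ _ r) = contradiction (addable-suc r) (<-irrefl (sym e))
tog-det (tight _) (tight _) = refl , refl

-- The local form of the invariance of descents under jeu de taquin. The letter `b` changes only in
-- a `tight` toggle, where it moves up by one row; this could affect only comparisons of equal or
-- neighbouring rows, and those are excluded by the side conditions of the other toggle or by the
-- shape.
tog-des : ∀ {γ z b c z₁ b' c' z₂} → Decreasing γ → Addable (bump (bump γ z) b) b' →
          Tog γ z b c z₁ → Tog (bump γ c) z₁ b' c' z₂ → (b <ᵇ b') ≡ (c <ᵇ c')
tog-des dγ q (swap _ _ _) (swap _ _ _) = refl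
tog-des dγ q (swap _ _ _) same = refl
tog-des dγ q (swap n _ _) (tight _) = <ᵇ-cong (λ { (s≤s p) → ≤∧≢⇒< p (≢-sym n) }) m<n⇒m<1+n
tog-des dγ q same (swap _ _ _) = refl
tog-des dγ q same same = refl
tog-des {γ} {z} dγ q same (tight e) =
  contradiction (subst₂ _≡_ (part-bump-≡ γ z) (part-bump-≢ γ (λ ())) e)
                (λ e' → <-irrefl (sym e') (s≤s (descent dγ z)))
tog-des dγ q (tight _) (swap n _ _) = <ᵇ-cong (λ p → <⇒≤ p) (λ p → ≤∧≢⇒< p n)
tog-des {γ} {z} dγ q (tight e) same =
  contradiction (subst₂ _<_ (trans (part-bump-≡ (bump γ z) (suc z)) (cong suc (part-bump-≢ γ (λ ()))))
                            (trans (part-bump-≢ (bump γ z) (λ ())) (part-bump-≡ γ z)) (addable-suc q))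
                (<-irrefl (cong suc (sym e)))
tog-des {z = z} dγ q (tight _) (tight _) = <ᵇ-cong {suc z} {suc (suc z)} {z} {suc z} (λ _ → ≤-refl) (λ _ → ≤-refl)

-- A jeu de taquin slide in the form of a growth diagram: `a` is the inner cell into which the
-- tableau `B` slides, `a'` the outer cell that it vacates.
data Slide : List ℕ → ℕ → List ℕ → List ℕ → ℕ → Set where
  [] : ∀ {γ a} → Slide γ a [] [] a
  _∷_ : ∀ {γ a b b₁ a₁ B B' a'} → Tog γ a b b₁ a₁ → Slide (bump γ b₁) a₁ B B' a' →
        Slide γ a (b ∷ B) (b₁ ∷ B') a'

slide-path : ∀ {γ a B B' a'} → Path γ (a ∷ B) → Slide γ a B B' a' → Path γ (B' ++ a' ∷ [])
slide-path p [] = p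
slide-path {γ} (p ∷ (q ∷ ps)) (t ∷ s) =
  let (p' , q') = tog-path p q t in
  p' ∷ slide-path (q' ∷ subst (λ δ → Path δ _) (tog-bump t) ps) s

slide-path⁻ : ∀ {γ a B B' a'} → Path γ (B' ++ a' ∷ []) → Slide γ a B B' a' → Path γ (a ∷ B)
slide-path⁻ p [] = p
slide-path⁻ (p ∷ ps) (t ∷ s) with slide-path⁻ ps s
... | q ∷ qs = let (p' , q') = tog-path p q (tog-sym t) in
               p' ∷ (q' ∷ subst (λ δ → Path δ _) (tog-bump (tog-sym t)) qs)

slide-ends : ∀ {γ a B B' a'} → Slide γ a B B' a' → ends (bump γ a) B ≡ bump (ends γ B') a'
slide-ends [] = refl
slide-ends {B = b ∷ B} (t ∷ s) = trans (cong (λ δ → ends δ B) (tog-bump t)) (slide-ends s)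

slide-total : ∀ {γ a} B → Path γ (a ∷ B) → ∃ λ B' → ∃ λ a' → Slide γ a B B' a'
slide-total [] p = _ , _ , []
slide-total (b ∷ B) (p ∷ (q ∷ ps)) =
  let (_ , _ , t) = tog-total p q
      (_ , q') = tog-path p q t
      (_ , _ , s) = slide-total B (q' ∷ subst (λ δ → Path δ _) (tog-bump t) ps)
  in _ , _ , t ∷ s

slide-total⁻ : ∀ {γ} B' {a'} → Path γ (B' ++ a' ∷ []) → ∃ λ a → ∃ λ B → Slide γ a B B' a'
slide-total⁻ [] p = _ , _ , []
slide-total⁻ (b ∷ B') (p ∷ ps) =
  let (_ , _ , s) = slide-total⁻ B' ps in go p (slide-path⁻ ps s) s
  where
  go : ∀ {γ b a₁ B B' a'} → Addable γ b → Path (bump γ b) (a₁ ∷ B) → Slide (bump γ b) a₁ B B' a' →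
       ∃ λ a → ∃ λ C → Slide γ a C (b ∷ B') a'
  go p (q ∷ _) s = let (_ , _ , t) = tog-total p q in _ , _ , tog-sym t ∷ s

slide-det : ∀ {γ a B B' a' B'' a''} → Slide γ a B B' a' → Slide γ a B B'' a'' → B' ≡ B'' × a' ≡ a''
slide-det [] [] = refl , refl
slide-det (t ∷ s) (t' ∷ s') with tog-det t t'
... | refl , refl with slide-det s s'
... | refl , refl = refl , refl

slide-det⁻ : ∀ {γ a B B' a' C c} → Slide γ a B B' a' → Slide γ c C B' a' → a ≡ c × B ≡ C
slide-det⁻ [] [] = refl , refl
slide-det⁻ (t ∷ s) (t' ∷ s') with slide-det⁻ s s'
... | refl , refl with tog-det (tog-sym t) (tog-sym t')
... | refl , refl = refl , refl

slide-length : ∀ {γ a B B' a'} → Slide γ a B B' a' → length B ≡ length B'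
slide-length [] = refl
slide-length (t ∷ s) = cong suc (slide-length s)

slide-des : ∀ {γ a B B' a'} → Decreasing γ → Path γ (a ∷ B) → Slide γ a B B' a' → des B ≡ des B'
slide-des dγ p [] = refl
slide-des dγ p (t ∷ []) = refl
slide-des {γ} dγ (p ∷ (q ∷ (r ∷ ps))) (_∷_ {b₁ = b₁} t (t' ∷ s)) =
  let (p' , q') = tog-path p q t in
  cong₂ _∷_ (tog-des dγ r t t')
    (slide-des (bump-decreasing {γ} {b₁} dγ p')
      (q' ∷ subst (λ δ → Path δ _) (tog-bump t) (r ∷ ps)) (t' ∷ s))

-- Read backwards, the toggles move each letter of `B` to the right past two consecutive letters, so
-- `tog-des` applies to the reversed toggles.
slide-slide-des : ∀ {γ a₁ a₂ B B' B'' a₁' a₂'} → Decreasing γ → Path γ (a₁ ∷ a₂ ∷ B) →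
                  Slide (bump γ a₁) a₂ B B' a₂' → Slide γ a₁ B' B'' a₁' → (a₁ <ᵇ a₂) ≡ (a₁' <ᵇ a₂')
slide-slide-des dγ p [] [] = refl
slide-slide-des {γ} dγ (p ∷ (q ∷ (r ∷ ps))) (t ∷ s) (_∷_ {b₁ = b₂} t' s') =
  let (q₁ , r₁) = tog-path q r t
      (p₂ , q₂) = tog-path p q₁ t'
      eq = tog-bump t
      eq' = tog-bump t'
      r₂ = subst (λ δ → Addable δ _) eq' r₁
      ps' = subst (λ δ → Path δ _) (trans eq (cong (λ δ → bump δ _) eq')) ps
      s₂ = subst (λ δ → Slide δ _ _ _ _) eq' s
  in trans (sym (tog-des dγ r₂ (tog-sym t') (tog-sym t)))
           (slide-slide-des (bump-decreasing {γ} {b₂} dγ p₂) (q₂ ∷ (r₂ ∷ ps')) s₂ s')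

-- The last letter of `A` slides through `B` first, as in the usual definition of tableau switching:
-- the entries of `A` are vacated from the largest to the smallest.
data Switch : List ℕ → List ℕ → List ℕ → List ℕ → List ℕ → Set where
  [] : ∀ {γ B} → Switch γ [] B B []
  _∷_ : ∀ {γ a A B B' A' B'' a'} → Slide γ a B' B'' a' → Switch (bump γ a) A B B' A' →
        Switch γ (a ∷ A) B B'' (a' ∷ A')

switch-path : ∀ {γ} A {B B' A'} → Path γ (A ++ B) → Switch γ A B B' A' → Path γ (B' ++ A')
switch-path [] p [] = subst (Path _) (sym (++-identityʳ _)) p
switch-path (a ∷ A) (p ∷ ps) (_∷_ {B' = B'} {B'' = B''} {a' = a'} s sw) with path-++⁻ B' (switch-path A ps sw)
... | p₁ , p₂ with path-++⁻ B'' (slide-path (p ∷ p₁) s)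
... | q₁ , (q₂ ∷ []) = path-++⁺ q₁ (q₂ ∷ subst (λ δ → Path δ _) (slide-ends s) p₂)

switch-path⁻ : ∀ {γ} A {B B' A'} → Path γ (B' ++ A') → Switch γ A B B' A' → Path γ (A ++ B)
switch-path⁻ [] p [] = proj₁ (path-++⁻ _ p)
switch-path⁻ (a ∷ A) p (_∷_ {B' = B'} {B'' = B''} s sw) with path-++⁻ B'' p
... | p₁ , (p₂ ∷ p₃) with slide-path⁻ (path-++⁺ p₁ (p₂ ∷ [])) s
... | q ∷ qs = q ∷ switch-path⁻ A (path-++⁺ qs (subst (λ δ → Path δ _) (sym (slide-ends s)) p₃)) sw

switch-ends : ∀ {γ} A {B B' A'} → Switch γ A B B' A' → ends γ (A ++ B) ≡ ends γ (B' ++ A')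
switch-ends {γ} [] {B} [] = sym (ends-++ γ B [])
switch-ends {γ} (a ∷ A) (_∷_ {B' = B'} {A' = A'} {B'' = B''} {a' = a'} s sw) =
  trans (switch-ends A sw) (trans (ends-++ (bump γ a) B' A')
    (trans (cong (λ δ → ends δ A') (slide-ends s)) (sym (ends-++ γ B'' (a' ∷ A')))))

switch-total : ∀ {γ} A {B} → Path γ (A ++ B) → ∃ λ B' → ∃ λ A' → Switch γ A B B' A'
switch-total [] p = _ , _ , []
switch-total (a ∷ A) (p ∷ ps) =
  let (B' , A' , sw) = switch-total A ps
      (p₁ , p₂) = path-++⁻ B' (switch-path A ps sw)
      (_ , _ , s) = slide-total B' (p ∷ p₁)
  in _ , _ , s ∷ sw

switch-total⁻ : ∀ {γ} B' A' → Path γ (B' ++ A') → ∃ λ A → ∃ λ B → Switch γ A B B' A'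
switch-total⁻ B' [] p = _ , _ , []
switch-total⁻ B' (a' ∷ A') p with path-++⁻ B' p
... | p₁ , (p₂ ∷ p₃) with slide-total⁻ B' (path-++⁺ p₁ (p₂ ∷ []))
... | a , B₁ , s with slide-path⁻ (path-++⁺ p₁ (p₂ ∷ [])) s
... | q ∷ qs with switch-total⁻ B₁ A' (path-++⁺ qs (subst (λ δ → Path δ _) (sym (slide-ends s)) p₃))
... | A , B , sw = _ , _ , s ∷ sw

switch-det : ∀ {γ A B B' A' C' D'} → Switch γ A B B' A' → Switch γ A B C' D' → B' ≡ C' × A' ≡ D'
switch-det [] [] = refl , refl
switch-det (s ∷ sw) (s' ∷ sw') with switch-det sw sw'
... | refl , refl with slide-det s s'
... | refl , refl = refl , refl

switch-det⁻ : ∀ {γ A B B' A' C D} → Switch γ A B B' A' → Switch γ C D B' A' → A ≡ C × B ≡ D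
switch-det⁻ [] [] = refl , refl
switch-det⁻ (s ∷ sw) (s' ∷ sw') with slide-det⁻ s s'
... | refl , refl with switch-det⁻ sw sw'
... | refl , refl = refl , refl

switch-lengthˡ : ∀ {γ A B B' A'} → Switch γ A B B' A' → length A ≡ length A'
switch-lengthˡ [] = refl
switch-lengthˡ (s ∷ sw) = cong suc (switch-lengthˡ sw)

switch-lengthʳ : ∀ {γ A B B' A'} → Switch γ A B B' A' → length B ≡ length B'
switch-lengthʳ [] = refl
switch-lengthʳ (s ∷ sw) = trans (switch-lengthʳ sw) (slide-length s)

switch-desʳ : ∀ {γ A B B' A'} → Decreasing γ → Path γ (A ++ B) → Switch γ A B B' A' → des B ≡ des B'
switch-desʳ dγ p [] = refl
switch-desʳ {γ} dγ (p ∷ ps) (_∷_ {a = a} {A = A} {B' = B'} s sw) =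
  trans (switch-desʳ (bump-decreasing {γ} {a} dγ p) ps sw)
        (slide-des dγ (p ∷ proj₁ (path-++⁻ B' (switch-path A ps sw))) s)

switch-desˡ : ∀ {γ A B B' A'} → Decreasing γ → Path γ (A ++ B) → Switch γ A B B' A' → des A ≡ des A'
switch-desˡ dγ p [] = refl
switch-desˡ dγ p (s ∷ []) = refl
switch-desˡ {γ} dγ (p ∷ (q ∷ ps)) (_∷_ {a = a} s (_∷_ {a = a₂} {A = A} {B' = B'} s' sw)) =
  cong₂ _∷_ (slide-slide-des dγ (p ∷ (q ∷ proj₁ (path-++⁻ B' (switch-path A ps sw)))) s' s)
            (switch-desˡ (bump-decreasing {γ} {a} dγ p) (q ∷ ps) (s' ∷ sw))

-- Insertion paths as pointers, and their behaviour under switching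

rstep : ℕ → ℕ → ℕ
rstep x c with c ≟ x
... | yes _ = suc x
... | no _ = x

-- A bumped entry moves on to the addable cell one column to the right. Its row depends on the
-- current shape, whereas row insertion simply passes to the next row.
cstep : List ℕ → ℕ → ℕ → ℕ
cstep γ x c with c ≟ x
... | yes _ = top (bump γ x) x
... | no _ = x

rptr : ℕ → List ℕ → ℕ
rptr x [] = x
rptr x (c ∷ B) = rptr (rstep x c) B

cptr : List ℕ → ℕ → List ℕ → ℕ
cptr γ x [] = x
cptr γ x (c ∷ B) = cptr (bump γ c) (cstep γ x c) B

rstep-hit : ∀ x → rstep x x ≡ suc x
rstep-hit x with x ≟ x
... | yes _ = refl
... | no n = contradiction refl n

rstep-miss : ∀ {x c} → c ≢ x → rstep x c ≡ x
rstep-miss {x} {c} n with c ≟ x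
... | yes e = contradiction e n
... | no _ = refl

cstep-hit : ∀ γ x → cstep γ x x ≡ top (bump γ x) x
cstep-hit γ x with x ≟ x
... | yes _ = refl
... | no n = contradiction refl n

cstep-miss : ∀ γ {x c} → c ≢ x → cstep γ x c ≡ x
cstep-miss γ {x} {c} n with c ≟ x
... | yes e = contradiction e n
... | no _ = refl

rstep-addable : ∀ {γ x c} → Decreasing γ → Addable γ x → Addable (bump γ c) (rstep x c)
rstep-addable {γ} {x} {c} dγ ax with c ≟ x
... | yes refl = Addable-bump-self γ dγ
... | no n = Addable-bump γ n ax

-- Commutation of row and column bumping at the level of one toggle: letters of the left tableau act
-- by column steps, letters of the right one by row steps, and exchanging the two letters does not
-- change where the pointer arrives.
tog-ptr : ∀ {γ a b b₁ a₁ x} → Decreasing γ → Addable γ x → Addable γ a → Addable (bump γ a) b →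
          Tog γ a b b₁ a₁ → rstep (cstep γ x a) b ≡ cstep (bump γ b₁) (rstep x b₁) a₁
tog-ptr {γ} {a} {b} {x = x} dγ ax aa ab (swap n _ ab') with a ≟ x
... | yes refl with b ≟ top (bump γ a) a
... | yes refl = sym (begin
    cstep (bump γ t) (rstep a t) a ≡⟨ cong (λ z → cstep (bump γ t) z a) (rstep-miss (≢-sym n)) ⟩
    cstep (bump γ t) a a ≡⟨ cstep-hit (bump γ t) a ⟩
    top (bump (bump γ t) a) a ≡⟨ cong (λ δ → top δ a) (bump-comm γ t a) ⟩
    -- Here `b` has already occupied row `t`, so the addable cell of the same column lies one row
    -- lower, which is where the row step from `t` leads.
    top (bump δ₀ t) a ≡⟨ top-unique (bump-decreasing {δ₀} {t} dδ (proj₂ (proj₂ isT)))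
        (t<a , trans (part-bump-≢ δ₀ (<⇒≢ ≤-refl)) (trans (between-top dδ isT (n≤1+n t) t<a) (sym (part-bump-≢ δ₀ (≢-sym n))))
             , Addable-bump-self δ₀ dδ) ⟩
    suc t ∎)
  where
  open ≡-Reasoning
  δ₀ = bump γ a
  dδ = bump-decreasing {γ} {a} dγ aa
  t = top δ₀ a
  isT = top-isTop dδ a
  t<a = ≤∧≢⇒< (proj₁ isT) (≢-sym n)
... | no b≢t = sym (begin
    cstep (bump γ b) (rstep a b) a ≡⟨ cong (λ z → cstep (bump γ b) z a) (rstep-miss (≢-sym n)) ⟩
    cstep (bump γ b) a a ≡⟨ cstep-hit (bump γ b) a ⟩
    top (bump (bump γ b) a) a ≡⟨ cong (λ δ → top δ a) (bump-comm γ b a) ⟩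
    top (bump δ₀ b) a ≡⟨ top-unique (bump-decreasing {δ₀} {b} dδ ab)
        (proj₁ isT , trans (part-bump-≢ δ₀ b≢t) (trans (proj₁ (proj₂ isT)) (sym (part-bump-≢ δ₀ (≢-sym n))))
             , Addable-bump δ₀ b≢t (proj₂ (proj₂ isT))) ⟩
    top δ₀ a ∎)
  where
  open ≡-Reasoning
  δ₀ = bump γ a
  dδ = bump-decreasing {γ} {a} dγ aa
  isT = top-isTop dδ a
tog-ptr {γ} {a} {b} {x = x} dγ ax aa ab (swap n _ ab') | no a≢x with b ≟ x
... | no b≢x = sym (cstep-miss (bump γ b) a≢x)
... | yes refl with a ≟ suc b
... | no a≢ = refl
... | yes refl = sym (top-unique
    (bump-decreasing {bump γ b} {suc b} (bump-decreasing {γ} {b} dγ ab') (Addable-bump γ (λ ()) aa))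
    (≤-refl , refl , suc (subst₂ _<_ (sym (trans (part-bump-≡ (bump γ b) (suc b)) (cong suc (part-bump-≢ γ (λ ())))))
                                     (sym (trans (part-bump-≢ (bump γ b) (λ ())) (part-bump-≡ γ b))) (s≤s (addable-suc aa)))))
tog-ptr {γ} {a} {x = x} dγ ax aa ab same with a ≟ x
... | yes refl = begin
    rstep (top (bump γ a) a) a ≡⟨ cong (λ z → rstep z a) (top-unique (bump-decreasing {γ} {a} dγ aa) (≤-refl , refl , ab)) ⟩
    rstep a a ≡⟨ rstep-hit a ⟩
    suc a ≡⟨ sym (cstep-miss (bump γ a) {suc a} {a} (λ ())) ⟩
    cstep (bump γ a) (suc a) a ∎
  where open ≡-Reasoning
... | no a≢x = trans (rstep-miss a≢x) (sym (cstep-miss (bump γ a) a≢x))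
tog-ptr {γ} {a} {x = x} dγ ax aa ab (tight e) with a ≟ x
... | yes refl = begin
    rstep t (suc a) ≡⟨ rstep-miss (λ e' → <-irrefl (sym e') (s≤s (proj₁ isT))) ⟩
    t ≡⟨ sym (top-unique (bump-decreasing {δ₀} {suc a} dδ ab)
           (m≤n⇒m≤1+n (proj₁ isT) ,
            trans (part-bump-≢ δ₀ st≢) (trans (proj₁ (proj₂ isT)) (trans (part-bump-≡ γ a)
              (trans (cong suc (trans e (sym (part-bump-≢ γ (λ ()))))) (sym (part-bump-≡ δ₀ (suc a)))))) ,
            Addable-bump δ₀ st≢ (proj₂ (proj₂ isT)))) ⟩
    top (bump δ₀ (suc a)) (suc a) ≡⟨ sym (cstep-hit δ₀ (suc a)) ⟩
    cstep δ₀ (suc a) (suc a) ∎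
  where
  open ≡-Reasoning
  δ₀ = bump γ a
  dδ = bump-decreasing {γ} {a} dγ aa
  t = top δ₀ a
  isT = top-isTop dδ a
  st≢ : suc a ≢ t
  st≢ e' = <-irrefl (sym e') (s≤s (proj₁ isT))
... | no a≢x = trans (rstep-miss sa≢x) (sym (cstep-miss (bump γ a) sa≢x))
  where
  sa≢x : suc a ≢ x
  sa≢x refl = <-irrefl (sym e) (addable-suc ax)

slide-ptr : ∀ {γ a B B' a' x} → Decreasing γ → Addable γ x → Path γ (a ∷ B) → Slide γ a B B' a' →
            rptr (cstep γ x a) B ≡ cstep (ends γ B') (rptr x B') a'
slide-ptr dγ ax p [] = refl
slide-ptr {γ} {x = x} dγ ax (p ∷ (q ∷ ps)) (_∷_ {b₁ = b₁} {B = B} t s) =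
  let (p' , q') = tog-path p q t in
  trans (cong (λ z → rptr z B) (tog-ptr dγ ax p q t))
        (slide-ptr (bump-decreasing {γ} {b₁} dγ p') (rstep-addable {γ} {x} {b₁} dγ ax)
          (q' ∷ subst (λ δ → Path δ _) (tog-bump t) ps) s)

cstep-addable : ∀ {γ x c} → Decreasing γ → Addable γ x → Addable γ c → Addable (bump γ c) (cstep γ x c)
cstep-addable {γ} {x} {c} dγ ax ac with c ≟ x
... | yes refl = proj₂ (proj₂ (top-isTop (bump-decreasing {γ} {c} dγ ac) c))
... | no n = Addable-bump γ n ax

switch-ptr : ∀ {γ A B B' A' x} → Decreasing γ → Addable γ x → Path γ (A ++ B) → Switch γ A B B' A' →
             rptr (cptr γ x A) B ≡ cptr (ends γ B') (rptr x B') A'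
switch-ptr dγ ax p [] = refl
switch-ptr {γ} {x = x} dγ ax (p ∷ ps) (_∷_ {a = a} {A = A} {B' = B'} {A' = A'} {B'' = B''} {a' = a'} s sw) =
  trans (switch-ptr {x = cstep γ x a} (bump-decreasing {γ} {a} dγ p) (cstep-addable {γ} {x} {a} dγ ax p) ps sw)
    (cong₂ (λ δ z → cptr δ z A') (slide-ends s)
      (slide-ptr dγ ax (p ∷ proj₁ (path-++⁻ B' (switch-path A ps sw))) s))

-- Row and column insertion

record IsShape (γ : List ℕ) : Set where
  constructor isShape
  field
    shape-decreasing : Decreasing γ
    shape-positive : ∀ r → r < length γ → 0 < part γ r
open IsShape public

part-beyond : ∀ γ {r} → length γ ≤ r → part γ r ≡ 0
part-beyond [] p = refl
part-beyond (x ∷ γ) {suc r} (s≤s p) = part-beyond γ p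

part-positive⇒< : ∀ γ {r} → 0 < part γ r → r < length γ
part-positive⇒< (x ∷ γ) {zero} p = s≤s z≤n
part-positive⇒< (x ∷ γ) {suc r} p = s≤s (part-positive⇒< γ p)

addable⇒≤ : ∀ {γ x} → Addable γ x → x ≤ length γ
addable⇒≤ zero = z≤n
addable⇒≤ {γ} (suc p) = part-positive⇒< γ (≤-trans (s≤s z≤n) p)

length-addable : ∀ {γ} → IsShape γ → Addable γ (length γ)
length-addable {[]} sh = zero
length-addable {x ∷ γ} sh = suc (subst (_< part (x ∷ γ) (length γ)) (sym (part-beyond γ ≤-refl))
                                  (shape-positive sh (length γ) ≤-refl))

length-bump : ∀ γ x s → x ≢ s → x ≤ length γ → s < length (bump γ x) → s < length γ
length-bump [] zero zero n p q = contradiction refl n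
length-bump [] zero (suc s) n p (s≤s ())
length-bump (y ∷ γ) zero s n p q = q
length-bump (y ∷ γ) (suc x) zero n p q = s≤s z≤n
length-bump (y ∷ γ) (suc x) (suc s) n (s≤s p) (s≤s q) = s≤s (length-bump γ x s (λ e → n (cong suc e)) p q)

bump-shape : ∀ {γ x} → IsShape γ → Addable γ x → IsShape (bump γ x)
bump-shape {γ} {x} sh ax = isShape (bump-decreasing (shape-decreasing sh) ax) pos
  where
  pos : ∀ r → r < length (bump γ x) → 0 < part (bump γ x) r
  pos r r< with x ≟ r
  ... | yes refl = subst (0 <_) (sym (part-bump-≡ γ x)) (s≤s z≤n)
  ... | no n = subst (0 <_) (sym (part-bump-≢ γ n)) (shape-positive sh r (length-bump γ x r n (addable⇒≤ ax) r<))

[]-shape : IsShape []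
[]-shape = isShape (decreasing (λ r → z≤n)) (λ r ())

ends-shape : ∀ {γ w} → IsShape γ → Path γ w → IsShape (ends γ w)
ends-shape sh [] = sh
ends-shape sh (a ∷ p) = ends-shape (bump-shape sh a) p

positive-ext : ∀ γ δ → (∀ r → r < length γ → 0 < part γ r) → (∀ r → r < length δ → 0 < part δ r) →
               (∀ r → part γ r ≡ part δ r) → γ ≡ δ
positive-ext [] [] p q e = refl
positive-ext [] (y ∷ δ) p q e = contradiction (q 0 (s≤s z≤n)) (<-irrefl (e 0))
positive-ext (x ∷ γ) [] p q e = contradiction (p 0 (s≤s z≤n)) (<-irrefl (sym (e 0)))
positive-ext (x ∷ γ) (y ∷ δ) p q e =
  cong₂ _∷_ (e 0) (positive-ext γ δ (λ r r< → p (suc r) (s≤s r<)) (λ r r< → q (suc r) (s≤s r<)) (λ r → e (suc r)))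

shape-ext : ∀ {γ δ} → IsShape γ → IsShape δ → (∀ r → part γ r ≡ part δ r) → γ ≡ δ
shape-ext {γ} {δ} sγ sδ e = positive-ext γ δ (shape-positive sγ) (shape-positive sδ) e

-- Positivity of the parts rules out trailing zeros: `[]` and `0 ∷ []` both become `1 ∷ []`.
bump-injective : ∀ {γ δ x} → IsShape γ → IsShape δ → bump γ x ≡ bump δ x → γ ≡ δ
bump-injective {γ} {δ} {x} sγ sδ e = shape-ext sγ sδ same-part
  where
  same-part : ∀ r → part γ r ≡ part δ r
  same-part r with x ≟ r
  ... | yes refl = suc-injective (trans (sym (part-bump-≡ γ x)) (trans (cong (λ z → part z x) e) (part-bump-≡ δ x)))
  ... | no n = trans (sym (part-bump-≢ γ n)) (trans (cong (λ z → part z r) e) (part-bump-≢ δ n))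

-- Dropping the last row when it becomes empty keeps the parts positive.
unbump-last : ℕ → List ℕ
unbump-last (suc (suc y)) = suc y ∷ []
unbump-last _ = []

unbump : List ℕ → ℕ → List ℕ
unbump [] x = []
unbump (y ∷ γ) (suc x) = y ∷ unbump γ x
unbump (y ∷ []) zero = unbump-last y
unbump (y ∷ z ∷ γ) zero = pred y ∷ z ∷ γ

bump-unbump : ∀ γ x → 0 < part γ x → bump (unbump γ x) x ≡ γ
bump-unbump (suc zero ∷ []) zero p = refl
bump-unbump (suc (suc y) ∷ []) zero p = refl
bump-unbump (suc y ∷ z ∷ γ) zero p = refl
bump-unbump (y ∷ γ) (suc x) p = cong (y ∷_) (bump-unbump γ x p)

Corner : List ℕ → ℕ → Set
Corner γ x = part γ (suc x) < part γ x

unbump-positive : ∀ γ x → Corner γ x → (∀ r → r < length γ → 0 < part γ r) →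
                  ∀ r → r < length (unbump γ x) → 0 < part (unbump γ x) r
unbump-positive (suc zero ∷ []) zero c p r ()
unbump-positive (suc (suc y) ∷ []) zero c p zero q = s≤s z≤n
unbump-positive (suc (suc y) ∷ []) zero c p (suc r) (s≤s ())
unbump-positive (suc y ∷ z ∷ γ) zero c p zero q = ≤-trans (p 1 (s≤s (s≤s z≤n))) (≤-pred c)
unbump-positive (suc y ∷ z ∷ γ) zero c p (suc r) q = p (suc r) q
unbump-positive (y ∷ γ) (suc x) c p zero q = p 0 (s≤s z≤n)
unbump-positive (y ∷ γ) (suc x) c p (suc r) (s≤s q) = unbump-positive γ x c (λ s s< → p (suc s) (s≤s s<)) r q

module _ {γ x} (sh : IsShape γ) (c : Corner γ x) where
  private
    0<x : 0 < part γ x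
    0<x = ≤-trans (s≤s z≤n) c

    eq-at : ∀ r → part (bump (unbump γ x) x) r ≡ part γ r
    eq-at r = cong (λ z → part z r) (bump-unbump γ x 0<x)

  bump-unbump′ : bump (unbump γ x) x ≡ γ
  bump-unbump′ = bump-unbump γ x 0<x

  part-unbump-≡ : suc (part (unbump γ x) x) ≡ part γ x
  part-unbump-≡ = trans (sym (part-bump-≡ (unbump γ x) x)) (eq-at x)

  part-unbump-≢ : ∀ {r} → x ≢ r → part (unbump γ x) r ≡ part γ r
  part-unbump-≢ {r} n = trans (sym (part-bump-≢ (unbump γ x) n)) (eq-at r)

  unbump-shape : IsShape (unbump γ x)
  unbump-shape = isShape (decreasing dec) (unbump-positive γ x c (shape-positive sh))
    where
    dec : ∀ r → part (unbump γ x) (suc r) ≤ part (unbump γ x) r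
    dec r with x ≟ r | x ≟ suc r
    ... | yes refl | _ = subst (_≤ part (unbump γ x) x) (sym (part-unbump-≢ (<⇒≢ ≤-refl)))
                           (≤-pred (subst (part γ (suc x) <_) (sym part-unbump-≡) c))
    ... | no n | yes refl = subst (part (unbump γ x) x ≤_) (sym (part-unbump-≢ n))
                              (≤-trans (n≤1+n _) (≤-trans (≤-reflexive part-unbump-≡) (descent (shape-decreasing sh) r)))
    ... | no n | no m = subst₂ _≤_ (sym (part-unbump-≢ m)) (sym (part-unbump-≢ n)) (descent (shape-decreasing sh) r)

  unbump-addable : Addable (unbump γ x) x
  unbump-addable = go x refl
    where
    go : ∀ z → z ≡ x → Addable (unbump γ x) z
    go zero e = zero
    go (suc z) refl = suc (subst (part (unbump γ x) x <_) (sym (part-unbump-≢ (≢-sym (<⇒≢ ≤-refl))))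
                             (≤-trans (≤-reflexive part-unbump-≡) (descent (shape-decreasing sh) z)))

corner-bump : ∀ {γ} x → Decreasing γ → Corner (bump γ x) x
corner-bump x dγ = addable-suc (Addable-bump-self _ {x} dγ)

bottom : ∀ {γ} c → Decreasing γ → 0 < part γ c → ∃ λ x → c ≤ x × part γ x ≡ part γ c × Corner γ x
bottom {γ} c dγ 0<c = go (length γ) c 0<c (m≤n+m _ c)
  where
  go : ∀ k c → 0 < part γ c → length γ ≤ c + k → ∃ λ x → c ≤ x × part γ x ≡ part γ c × Corner γ x
  go zero c 0<c b = contradiction 0<c (<-irrefl (sym (part-beyond γ (subst (length γ ≤_) (+-identityʳ c) b))))
  go (suc k) c 0<c b with part γ (suc c) ≟ part γ c
  ... | no n = c , ≤-refl , refl , ≤∧≢⇒< (descent dγ c) n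
  ... | yes e = let (x , p , q , r) = go k (suc c) (subst (0 <_) (sym e) 0<c) (subst (length γ ≤_) (+-suc c k) b)
                in x , <⇒≤ p , trans q e , r

-- Insertion of a new cell into a tableau word.  A pointer x travels through the
-- letters; when it is hit it moves on to nxt γ x, and this letter is emitted.
-- Row and column insertion are the two instances.
record InsertionRule : Set₁ where
  field
    nxt : List ℕ → ℕ → ℕ
    Start : List ℕ → ℕ → Set
    nxt-addable : ∀ {γ x} → Decreasing γ → Addable γ x → Addable (bump γ x) (nxt γ x)
    nxt-unique : ∀ {γ γ' x x'} → IsShape γ → IsShape γ' → Addable γ x → Addable γ' x' →
                 bump γ x ≡ bump γ' x' → nxt γ x ≡ nxt γ' x' → x ≡ x'
    nxt-start : ∀ {γ x} → IsShape γ → Addable γ x → ¬ Start (bump γ x) (nxt γ x)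
    -- Together with `nxt-unique` and `nxt-start` this makes bumping reversible: an addable cell is
    -- either a starting cell or is reached from exactly one corner, never both.
    start-or-nxt : ∀ {δ c} → IsShape δ → Addable δ c →
                   Start δ c ⊎ ∃ λ x → Corner δ x × (∀ γ → bump γ x ≡ δ → nxt γ x ≡ c)
    start-addable : ∀ {γ c} → IsShape γ → Start γ c → Addable γ c
    -- A missed letter is kept and a hit letter `x` becomes `nxt γ x`; the last three fields say
    -- that the comparison of neighbouring letters survives whenever at least one of them is hit.
    miss-hit : ∀ {γ x c} → Decreasing γ → Addable γ x → Addable γ c → c ≢ x →
               (c <ᵇ x) ≡ (c <ᵇ nxt (bump γ c) x)
    hit-miss : ∀ {γ x c} → Decreasing γ → Addable γ x → Addable (bump γ x) c → c ≢ nxt γ x →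
               (x <ᵇ c) ≡ (nxt γ x <ᵇ c)
    hit-hit : ∀ {γ x} → Decreasing γ → Addable γ x →
              (x <ᵇ nxt γ x) ≡ (nxt γ x <ᵇ nxt (bump γ x) (nxt γ x))

module Insertion (rule : InsertionRule) where
  open InsertionRule rule

  -- `B` lists the entries larger than the new one, as a tableau on `γ`; `E` lists the same entries
  -- on `bump γ x`, after the new entry has taken the cell in row `x`. The two final shapes differ
  -- by a cell in row `y`.
  data Ins : List ℕ → ℕ → List ℕ → ℕ → List ℕ → Set where
    nil : ∀ {γ x} → Ins γ x [] x []
    miss : ∀ {γ x c B y E} → c ≢ x → Ins (bump γ c) x B y E → Ins γ x (c ∷ B) y (c ∷ E)
    hit : ∀ {γ x B y E x'} → nxt γ x ≡ x' → Ins (bump γ x) x' B y E → Ins γ x (x ∷ B) y (x' ∷ E)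

  ins-total : ∀ γ x B → ∃ λ y → ∃ λ E → Ins γ x B y E
  ins-total γ x [] = _ , _ , nil
  ins-total γ x (c ∷ B) with c ≟ x
  ... | yes refl = let (_ , _ , i) = ins-total (bump γ x) (nxt γ x) B in _ , _ , hit refl i
  ... | no n = let (_ , _ , i) = ins-total (bump γ c) x B in _ , _ , miss n i

  ins-det : ∀ {γ x B y E y' E'} → Ins γ x B y E → Ins γ x B y' E' → y ≡ y' × E ≡ E'
  ins-det nil nil = refl , refl
  ins-det (miss n i) (miss n' i') with ins-det i i'
  ... | refl , refl = refl , refl
  ins-det (miss n i) (hit e i') = contradiction refl n
  ins-det (hit e i) (miss n i') = contradiction refl n
  ins-det (hit refl i) (hit refl i') with ins-det i i'
  ... | refl , refl = refl , refl

  ins-path : ∀ {γ x B y E} → Decreasing γ → Addable γ x → Path γ B → Ins γ x B y E → Path (bump γ x) E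
  ins-path dγ ax p nil = []
  ins-path {γ} {x} dγ ax (ac ∷ p) (miss {c = c} n i) =
    Addable-bump γ (≢-sym n) ac ∷
    subst (λ δ → Path δ _) (bump-comm γ c x) (ins-path (bump-decreasing dγ ac) (Addable-bump γ n ax) p i)
  ins-path {γ} {x} dγ ax (_ ∷ p) (hit refl i) =
    nxt-addable dγ ax ∷ ins-path (bump-decreasing dγ ax) (nxt-addable dγ ax) p i

  ins-ends : ∀ {γ x B y E} → Ins γ x B y E → bump (ends γ B) y ≡ ends (bump γ x) E
  ins-ends nil = refl
  ins-ends {γ} {x} (miss {c = c} {E = E} n i) = trans (ins-ends i) (cong (λ δ → ends δ E) (bump-comm γ c x))
  ins-ends (hit refl i) = ins-ends i

  ins-addable : ∀ {γ x B y E} → Decreasing γ → Addable γ x → Path γ B → Ins γ x B y E → Addable (ends γ B) y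
  ins-addable dγ ax p nil = ax
  ins-addable {γ} dγ ax (ac ∷ p) (miss n i) = ins-addable (bump-decreasing dγ ac) (Addable-bump γ n ax) p i
  ins-addable dγ ax (_ ∷ p) (hit refl i) = ins-addable (bump-decreasing dγ ax) (nxt-addable dγ ax) p i

  ins-des : ∀ {γ x B y E} → Decreasing γ → Addable γ x → Path γ B → Ins γ x B y E → des B ≡ des E
  ins-des dγ ax p nil = refl
  ins-des dγ ax p (miss n nil) = refl
  ins-des {γ} dγ ax (p ∷ ps) (miss n (miss n' i)) =
    cong₂ _∷_ refl (ins-des (bump-decreasing dγ p) (Addable-bump γ n ax) ps (miss n' i))
  ins-des {γ} dγ ax (p ∷ ps) (miss n (hit refl i)) =
    cong₂ _∷_ (miss-hit dγ ax p n) (ins-des (bump-decreasing dγ p) (Addable-bump γ n ax) ps (hit refl i))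
  ins-des dγ ax p (hit e nil) = refl
  ins-des dγ ax (_ ∷ (p ∷ ps)) (hit refl (miss n i)) =
    cong₂ _∷_ (hit-miss dγ ax p n) (ins-des (bump-decreasing dγ ax) (nxt-addable dγ ax) (p ∷ ps) (miss n i))
  ins-des dγ ax (_ ∷ ps) (hit refl (hit refl i)) =
    cong₂ _∷_ (hit-hit dγ ax) (ins-des (bump-decreasing dγ ax) (nxt-addable dγ ax) ps (hit refl i))

  ins-det⁻ : ∀ {γ γ' x x' B B' y E} → IsShape γ → IsShape γ' → Addable γ x → Addable γ' x' →
             Path γ B → Path γ' B' → bump γ x ≡ bump γ' x' → Ins γ x B y E → Ins γ' x' B' y E →
             x ≡ x' × B ≡ B'
  ins-det⁻ sh sh' ax ax' p p' e nil nil = refl , refl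
  ins-det⁻ {γ} {γ'} {x} {x'} sh sh' ax ax' (a ∷ p) (a' ∷ p') e (miss {c = c} n i) (miss n' i')
    with ins-det⁻ (bump-shape sh a) (bump-shape sh' a') (Addable-bump γ n ax) (Addable-bump γ' n' ax') p p'
           (trans (bump-comm γ c x) (trans (cong (λ δ → bump δ c) e) (bump-comm γ' x' c))) i i'
  ... | refl , refl = refl , refl
  ins-det⁻ {γ} {γ'} {x} {x'} sh sh' ax ax' (a ∷ p) (_ ∷ p') e (miss {c = c} n i) (hit refl i')
    with ins-det⁻ (bump-shape sh a) (bump-shape sh' ax') (Addable-bump γ n ax)
           (nxt-addable (shape-decreasing sh') ax') p p' (trans (bump-comm γ c x) (cong (λ δ → bump δ c) e)) i i'
  ... | refl , _ = contradiction refl n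
  ins-det⁻ {γ} {γ'} {x} {x'} sh sh' ax ax' (_ ∷ p) (a' ∷ p') e (hit refl i) (miss {c = c} n' i')
    with ins-det⁻ (bump-shape sh ax) (bump-shape sh' a') (nxt-addable (shape-decreasing sh) ax)
           (Addable-bump γ' n' ax') p p' (trans (cong (λ δ → bump δ c) e) (bump-comm γ' x' c)) i i'
  ... | refl , _ = contradiction refl n'
  ins-det⁻ sh sh' ax ax' (_ ∷ p) (_ ∷ p') e (hit {x' = c} q i) (hit q' i')
    with nxt-unique sh sh' ax ax' e (trans q (sym q'))
  ... | refl with ins-det⁻ (bump-shape sh ax) (bump-shape sh' ax') (subst (Addable _) q (nxt-addable (shape-decreasing sh) ax))
                    (subst (Addable _) q' (nxt-addable (shape-decreasing sh') ax')) p p' (cong (λ δ → bump δ c) e) i i'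
  ... | _ , refl = refl , refl

  -- Reverse bumping from the outer cell `y` has passed through all of `E` without finding the
  -- inserted entry; the pointer is then at a corner `x₀` of `δ`.
  record Reverse (δ : List ℕ) (ν : List ℕ) (y : ℕ) (E : List ℕ) : Set where
    constructor mkReverse
    field
      {γ₀} : List ℕ
      {x₀} : ℕ
      {B₀} : List ℕ
      rev-shape : IsShape γ₀
      rev-addable : Addable γ₀ x₀
      rev-bump : bump γ₀ x₀ ≡ δ
      rev-path : Path γ₀ B₀
      rev-ends : ends γ₀ B₀ ≡ ν
      rev-ins : Ins γ₀ x₀ B₀ y E

  -- Reverse bumping has reached a starting cell: `c₀` is the letter of the inserted entry, `D`
  -- holds the smaller entries, and `A` the larger ones before the insertion.
  record Insertable (δ : List ℕ) (ν : List ℕ) (y : ℕ) (T : List ℕ) : Set where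
    constructor mkInsertable
    field
      {D} : List ℕ
      {c₀} : ℕ
      {A} : List ℕ
      {E₀} : List ℕ
      ins-split : T ≡ D ++ c₀ ∷ E₀
      ins-start : Start (ends δ D) c₀
      ins-pathˡ : Path δ D
      ins-pathʳ : Path (ends δ D) A
      ins-ends-eq : ends (ends δ D) A ≡ ν
      ins-ins : Ins (ends δ D) c₀ A y E₀

  reverse-or-insertable : ∀ {δ ν y} E → IsShape δ → IsShape ν → Addable ν y → Path δ E → ends δ E ≡ bump ν y →
                          Reverse δ ν y E ⊎ Insertable δ ν y E
  reverse-or-insertable [] sδ sν ay p e = inj₁ (mkReverse sν ay (sym e) [] refl nil)
  reverse-or-insertable {δ} {ν} {y} (c ∷ E) sδ sν ay (a ∷ p) e
    with reverse-or-insertable E (bump-shape sδ a) sν ay p e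
  ... | inj₂ (mkInsertable refl st p₁ p₂ e' i) = inj₂ (mkInsertable refl st (a ∷ p₁) p₂ e' i)
  ... | inj₁ (mkReverse {γ'} {x'} {B'} sγ' ax' eb pB eB i) with c ≟ x'
  -- The pointer sits in the cell of `c` itself, so this entry is either the inserted one or was
  -- bumped out of a corner of `δ`.
  ... | yes refl with bump-injective sγ' sδ eb
  ... | refl with start-or-nxt sδ a
  ... | inj₁ st = inj₂ (mkInsertable {D = []} refl st [] pB eB i)
  ... | inj₂ (x , cor , f) =
    inj₁ (mkReverse (unbump-shape sδ cor) (unbump-addable sδ cor) (bump-unbump′ sδ cor)
            (unbump-addable sδ cor ∷ subst (λ z → Path z B') (sym (bump-unbump′ sδ cor)) pB)
            (trans (cong (λ z → ends z B') (bump-unbump′ sδ cor)) eB)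
            (hit (f _ (bump-unbump′ sδ cor)) (subst (λ z → Ins z c B' y E) (sym (bump-unbump′ sδ cor)) i)))
  reverse-or-insertable {δ} {ν} {y} (c ∷ E) sδ sν ay (a ∷ p) e
    | inj₁ (mkReverse {γ'} {x'} {B'} sγ' ax' eb pB eB i) | no n =
    -- The entry `c` is missed, so the cells of `c` and `x'` were added independently: taking `x'`
    -- off `δ` gives the earlier shape, and adding `c` to that gives `γ'`.
    inj₁ (mkReverse sh' ax'' bγ (ac ∷ subst (λ z → Path z B') (sym eγ) pB)
            (trans (cong (λ z → ends z B') eγ) eB) (miss n (subst (λ z → Ins z x' B' y E) (sym eγ) i)))
    where
    at : ∀ r → part (bump γ' x') r ≡ part (bump δ c) r
    at r = cong (λ z → part z r) eb
    px : part δ x' ≡ suc (part γ' x')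
    px = trans (sym (part-bump-≢ δ n)) (trans (sym (at x')) (part-bump-≡ γ' x'))
    cor : Corner δ x'
    cor = subst (part δ (suc x') <_) (sym px)
            (s≤s (≤-trans (part≤part-bump δ c (suc x'))
              (≤-trans (≤-reflexive (trans (sym (at (suc x'))) (part-bump-≢ γ' (<⇒≢ ≤-refl))))
                (descent (shape-decreasing sγ') x'))))
    γ = unbump δ x'
    sh' = unbump-shape sδ cor
    ax'' = unbump-addable sδ cor
    bγ : bump γ x' ≡ δ
    bγ = bump-unbump′ sδ cor
    ac : Addable γ c
    ac = go c n a at
      where
      go : ∀ c → c ≢ x' → Addable δ c → (∀ r → part (bump γ' x') r ≡ part (bump δ c) r) → Addable γ c
      go zero n a at = zero
      go (suc c) n a at with x' ≟ c
      ... | no m = suc (subst₂ _<_ (sym (part-unbump-≢ sδ cor (≢-sym n))) (sym (part-unbump-≢ sδ cor m)) (addable-suc a))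
      ... | yes refl = suc (≤-pred (subst₂ _<_ (cong suc (sym (part-unbump-≢ sδ cor (≢-sym n)))) (sym (part-unbump-≡ sδ cor))
                (subst (suc (part δ (suc x')) <_) (sym px)
                  (s≤s (≤-trans (≤-reflexive (trans (sym (part-bump-≡ δ (suc x'))) (trans (sym (at (suc x'))) (part-bump-≢ γ' (<⇒≢ ≤-refl)))))
                         (descent (shape-decreasing sγ') x'))))))
    eγ : bump γ c ≡ γ'
    eγ = bump-injective (bump-shape sh' ac) sγ'
           (trans (bump-comm γ c x') (trans (cong (λ z → bump z c) bγ) (sym eb)))

  insertable : ∀ {ν y T} → IsShape ν → Addable ν y → Path [] T → ends [] T ≡ bump ν y → Insertable [] ν y T
  insertable {T = T} sν ay p e with reverse-or-insertable T []-shape sν ay p e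
  ... | inj₂ i = i
  -- The empty shape has no corner at which the pointer could still be waiting.
  ... | inj₁ r = contradiction (Reverse.rev-bump r) (bump≢[] _ _)
    where
    bump≢[] : ∀ γ x → bump γ x ≢ []
    bump≢[] [] zero ()
    bump≢[] [] (suc x) ()
    bump≢[] (y ∷ γ) zero ()
    bump≢[] (y ∷ γ) (suc x) ()

  -- Both paths end at `y` on the same letters, so by `ins-det⁻` their pointers agree right after
  -- `c`. But then the pointer of the first path either would be at a letter it missed or would have
  -- been bumped into a starting cell.
  no-later-start : ∀ {γ x B y E} D {c A E'} → IsShape γ → Addable γ x → Path γ B → Ins γ x B y E →
                   E ≡ D ++ c ∷ E' → Path (bump γ x) D → Start (ends (bump γ x) D) c →
                   Path (ends (bump γ x) D) A → Ins (ends (bump γ x) D) c A y E' → ⊥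
  no-later-start {γ} {x} [] sh ax (a ∷ p) (miss {c = c} n i) refl pD st pA i'
    with ins-det⁻ (bump-shape sh a) (bump-shape sh ax) (Addable-bump γ n ax) (start-addable (bump-shape sh ax) st) p pA
           (bump-comm γ c x) i i'
  ... | refl , _ = n refl
  no-later-start [] sh ax (_ ∷ p) (hit refl i) refl pD st pA i' = nxt-start sh ax st
  no-later-start {γ} {x} (d ∷ D) sh ax (a ∷ p) (miss n i) refl (_ ∷ pD) st pA i' =
    no-later-start D (bump-shape sh a) (Addable-bump γ n ax) p i refl
      (subst (λ z → Path z D) (bump-comm γ x d) pD)
      (subst (λ z → Start (ends z D) _) (bump-comm γ x d) st)
      (subst (λ z → Path (ends z D) _) (bump-comm γ x d) pA)
      (subst (λ z → Ins (ends z D) _ _ _ _) (bump-comm γ x d) i')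
  no-later-start (d ∷ D) sh ax (_ ∷ p) (hit refl i) refl (_ ∷ pD) st pA i' =
    no-later-start D (bump-shape sh ax) (nxt-addable (shape-decreasing sh) ax) p i refl pD st pA i'

  insertable-unique : ∀ {δ y} D {D' c c' A A' E E'} → IsShape δ → D ++ c ∷ E ≡ D' ++ c' ∷ E' →
                      Path δ D → Path δ D' → Start (ends δ D) c → Start (ends δ D') c' →
                      Path (ends δ D) A → Path (ends δ D') A' →
                      Ins (ends δ D) c A y E → Ins (ends δ D') c' A' y E' → D ≡ D' × A ≡ A'
  insertable-unique [] {[]} sh refl p p' st st' pA pA' i i' =
    refl , proj₂ (ins-det⁻ sh sh (start-addable sh st) (start-addable sh st) pA pA' refl i i')
  insertable-unique [] {d ∷ D'} sh refl p (_ ∷ p') st st' pA pA' i i' =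
    ⊥-elim (no-later-start D' sh (start-addable sh st) pA i refl p' st' pA' i')
  insertable-unique (d ∷ D) {[]} sh refl (_ ∷ p) p' st st' pA pA' i i' =
    ⊥-elim (no-later-start D sh (start-addable sh st') pA' i' refl p st pA i)
  insertable-unique (d ∷ D) {d' ∷ D'} sh e (a ∷ p) (_ ∷ p') st st' pA pA' i i' with ∷-injective e
  ... | refl , e' with insertable-unique D (bump-shape sh a) e' p p' st st' pA pA' i i'
  ... | refl , refl = refl , refl

rowRule : InsertionRule
rowRule = record
  { nxt = λ γ x → suc x
  ; Start = λ γ c → c ≡ 0
  ; nxt-addable = λ dγ ax → Addable-bump-self _ dγ
  ; nxt-unique = λ _ _ _ _ _ e → suc-injective e
  ; nxt-start = λ _ _ ()
  ; start-or-nxt = λ { sh zero → inj₁ refl ; sh (suc p) → inj₂ (_ , p , λ _ _ → refl) }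
  ; start-addable = λ { sh refl → zero }
  ; miss-hit = λ { dγ ax ac n → <ᵇ-cong m<n⇒m<1+n (λ { (s≤s p) → ≤∧≢⇒< p n }) }
  ; hit-miss = λ { dγ ax ac n → <ᵇ-cong (λ p → ≤∧≢⇒< p (≢-sym n)) <⇒≤ }
  ; hit-hit = λ {γ} {x} _ _ → <ᵇ-cong {x} {suc x} {suc x} {suc (suc x)} (λ _ → ≤-refl) (λ _ → ≤-refl)
  }

columnRule : InsertionRule
columnRule = record
  { nxt = λ γ x → top (bump γ x) x
  -- Column insertion begins at the foot of the first column, that is, in the first empty row.
  ; Start = λ γ c → c ≡ length γ
  ; nxt-addable = λ {γ} {x} dγ ax → proj₂ (proj₂ (top-isTop (bump-decreasing dγ ax) x))
  ; nxt-unique = λ {γ} {γ'} {x} {x'} → unique {γ} {γ'} {x} {x'}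
  -- A bumped entry goes to a row as long as row `x` after the bump, hence nonempty, while a
  -- starting row is empty.
  ; nxt-start = λ {γ} {x} sh ax e →
      0≢1+n (trans (sym (part-beyond (bump γ x) ≤-refl)) (trans (cong (part (bump γ x)) (sym e))
        (trans (proj₁ (proj₂ (top-isTop (bump-decreasing (shape-decreasing sh) ax) x))) (part-bump-≡ γ x))))
  ; start-or-nxt = start-or
  ; start-addable = λ { sh refl → length-addable sh }
  ; miss-hit = λ {γ} {x} {c} dγ ax ac n →
      let isT = top-isTop (bump-decreasing (bump-decreasing dγ ac) (Addable-bump γ n ax)) x in
      <ᵇ-cong (mh dγ ax ac n isT) (λ p → ≤-trans p (proj₁ isT))
  ; hit-miss = λ {γ} {x} {c} dγ ax ac n →
      let isT = top-isTop (bump-decreasing dγ ax) x in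
      <ᵇ-cong (λ p → ≤-trans (s≤s (proj₁ isT)) p) (hm dγ ax ac isT)
  ; hit-hit = λ {γ} {x} dγ ax →
      let isT = top-isTop (bump-decreasing dγ ax) x
          isT' = top-isTop (bump-decreasing (bump-decreasing dγ ax) (proj₂ (proj₂ isT))) (top (bump γ x) x)
      in <ᵇ-cong {x} {top (bump γ x) x} {top (bump γ x) x} (λ p → contradiction p (≤⇒≯ (proj₁ isT))) (λ p → contradiction p (≤⇒≯ (proj₁ isT')))
  }
  where
  corner-top-≤ : ∀ {δ x x' t} → Decreasing δ → Corner δ x' → part δ x ≡ part δ t → part δ x' ≡ part δ t → x ≤ x'
  corner-top-≤ {δ} {x} {x'} dδ c e e' with x ≤? x'
  ... | yes p = p
  ... | no ¬p = contradiction (≤-trans (≤-reflexive (trans e' (sym e))) (part-mono dδ (≰⇒> ¬p))) (<⇒≱ c)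
  unique : ∀ {γ γ' x x'} → IsShape γ → IsShape γ' → Addable γ x → Addable γ' x' →
           bump γ x ≡ bump γ' x' → top (bump γ x) x ≡ top (bump γ' x') x' → x ≡ x'
  unique {γ} {γ'} {x} {x'} sh sh' ax ax' e t =
    ≤-antisym (corner-top-≤ dδ c' p p') (corner-top-≤ dδ (corner-bump x (shape-decreasing sh)) p' p)
    where
    δ = bump γ x
    dδ = bump-decreasing (shape-decreasing sh) ax
    c' : Corner δ x'
    c' = subst (λ z → Corner z x') (sym e) (corner-bump x' (shape-decreasing sh'))
    p : part δ x ≡ part δ (top δ x)
    p = sym (proj₁ (proj₂ (top-isTop dδ x)))
    p' : part δ x' ≡ part δ (top δ x)
    p' = subst (λ z → part z x' ≡ part z (top δ x)) (sym e)
           (trans (sym (proj₁ (proj₂ (top-isTop (bump-decreasing (shape-decreasing sh') ax') x')))) (cong (part (bump γ' x')) (sym t)))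
  start-or : ∀ {δ c} → IsShape δ → Addable δ c →
             c ≡ length δ ⊎ ∃ λ x → Corner δ x × (∀ γ → bump γ x ≡ δ → top (bump γ x) x ≡ c)
  start-or {δ} {c} sh ac with c ≟ length δ
  ... | yes e = inj₁ e
  ... | no n with bottom c (shape-decreasing sh) (shape-positive sh c (≤∧≢⇒< (addable⇒≤ ac) n))
  ... | x , c≤x , e , cor = inj₂ (x , cor , λ { γ refl → top-unique (shape-decreasing sh) (c≤x , sym e , ac) })
  mh : ∀ {γ x c} → Decreasing γ → Addable γ x → Addable γ c → c ≢ x →
       IsTop (bump (bump γ c) x) x (top (bump (bump γ c) x) x) → c < x → c < top (bump (bump γ c) x) x
  mh {γ} {suc x} {c} dγ (suc ax) ac n isT c<x with top (bump (bump γ c) (suc x)) (suc x) ≤? c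
  ... | no ¬p = ≰⇒> ¬p
  ... | yes p = contradiction (≤-trans (part-mono dγ (≤-pred c<x)) (≤-reflexive (suc-injective eq))) (<⇒≱ ax)
    where
    eq : suc (part γ c) ≡ suc (part γ (suc x))
    eq = trans (sym (part-bump-≡ γ c)) (trans (sym (part-bump-≢ (bump γ c) (≢-sym n)))
           (trans (between-top (bump-decreasing (bump-decreasing dγ ac) (Addable-bump γ n (suc ax))) isT p (<⇒≤ c<x))
             (trans (part-bump-≡ (bump γ c) (suc x)) (cong suc (part-bump-≢ γ n)))))
  hm : ∀ {γ x c} → Decreasing γ → Addable γ x → Addable (bump γ x) c →
       IsTop (bump γ x) x (top (bump γ x) x) → top (bump γ x) x < c → x < c
  hm {γ} {x} {suc c} dγ ax (suc ac) isT (s≤s p) with suc c ≤? x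
  ... | no ¬q = ≰⇒> ¬q
  ... | yes q = contradiction (trans (between-top dδ isT (m≤n⇒m≤1+n p) q) (sym (between-top dδ isT p (<⇒≤ q)))) (<⇒≢ ac)
    where dδ = bump-decreasing dγ ax

-- Counting

-- Only elements of `A` are listed, never proofs of `P`, so that counting depends on equality in `A`
-- alone.
record FinPred {A : Set} (P : A → Set) : Set where
  constructor finPred
  field
    decide : ∀ x → Dec (P x)
    universe : List A
    universe-unique : Unique universe
    universe-complete : ∀ x → P x → x ∈ universe

  elements : List A
  elements = filter decide universe

  elements-unique : Unique elements
  elements-unique = Unique.filter⁺ decide universe-unique

  ∈-elements⁺ : ∀ {x} → P x → x ∈ elements
  ∈-elements⁺ p = ∈-filter⁺ decide (universe-complete _ p) p

  ∈-elements⁻ : ∀ {x} → x ∈ elements → P x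
  ∈-elements⁻ x∈ = proj₂ (∈-filter⁻ decide {xs = universe} x∈)

  card : ℕ
  card = length elements

open FinPred public

∈-++-remove : ∀ {A : Set} (gs : List A) {hs y y'} → y' ∈ gs ++ y ∷ hs → y' ≢ y → y' ∈ gs ++ hs
∈-++-remove gs {hs} m n with ∈-++⁻ gs m
... | inj₁ m' = ∈-++⁺ˡ m'
... | inj₂ (here e) = contradiction e n
... | inj₂ (there m') = ∈-++⁺ʳ gs m'

length-injection : ∀ {A B : Set} (R : A → B → Set) (fs : List A) (gs : List B) → Unique fs →
                   (∀ {x} → x ∈ fs → ∃ λ y → y ∈ gs × R x y) →
                   (∀ {x x' y} → x ∈ fs → x' ∈ fs → R x y → R x' y → x ≡ x') → length fs ≤ length gs
length-injection R [] gs u f inj = z≤n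
length-injection R (x ∷ fs) gs (x∉ ∷ u) f inj with f (here refl)
... | y , y∈ , r with ∈-∃++ y∈
... | g₁ , g₂ , refl =
  subst (suc (length fs) ≤_) (sym (trans (length-++ g₁) (trans (+-suc (length g₁) (length g₂)) (cong suc (sym (length-++ g₁))))))
    (s≤s (length-injection R fs (g₁ ++ g₂) u
      (λ m → let (y' , y'∈ , r') = f (there m) in
             y' , ∈-++-remove g₁ y'∈ (λ e → All.lookup x∉ m (inj (here refl) (there m) r (subst (R _) e r'))) , r')
      (λ m m' → inj (there m) (there m'))))

card-≤ : ∀ {A B : Set} {P : A → Set} {Q : B → Set} (p : FinPred P) (q : FinPred Q) (R : A → B → Set) →
         (∀ a → P a → ∃ λ b → Q b × R a b) →
         (∀ {a a' b} → P a → P a' → R a b → R a' b → a ≡ a') → card p ≤ card q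
card-≤ p q R f inj = length-injection R (elements p) (elements q) (elements-unique p)
  (λ m → let (b , Qb , r) = f _ (∈-elements⁻ p m) in b , ∈-elements⁺ q Qb , r)
  (λ m m' → inj (∈-elements⁻ p m) (∈-elements⁻ p m'))

-- The bijection is a relation, total and injective in both directions. This fits switching and
-- insertion, which are relations with a totality and a determinacy lemma each way.
card-rel : ∀ {A B : Set} {P : A → Set} {Q : B → Set} (p : FinPred P) (q : FinPred Q) (R : A → B → Set) →
           (∀ a → P a → ∃ λ b → Q b × R a b) →
           (∀ b → Q b → ∃ λ a → P a × R a b) →
           (∀ {a a' b} → P a → P a' → R a b → R a' b → a ≡ a') →
           (∀ {a b b'} → Q b → Q b' → R a b → R a b' → b ≡ b') → card p ≡ card q
card-rel p q R f g inj inj' =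
  ≤-antisym (card-≤ p q R f inj) (card-≤ q p (λ b a → R a b) g inj')

card-cong : ∀ {A : Set} {P Q : A → Set} (p : FinPred P) (q : FinPred Q) →
            (∀ a → P a → Q a) → (∀ a → Q a → P a) → card p ≡ card q
card-cong p q f g = card-rel p q _≡_ (λ a Pa → a , f a Pa , refl) (λ a Qa → a , g a Qa , refl)
                      (λ { _ _ refl refl → refl }) (λ { _ _ refl refl → refl })

card-empty : ∀ {A : Set} {P : A → Set} (p : FinPred P) → (∀ a → ¬ P a) → card p ≡ 0
card-empty p n with elements p | ∈-elements⁻ p
... | [] | f = refl
... | x ∷ xs | f = contradiction (f (here refl)) (n x)

SumPred : ∀ {A B : Set} → (A → Set) → (B → Set) → A ⊎ B → Set
SumPred P Q = [ P , Q ]′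

length-filter-map : ∀ {A C : Set} (f : A → C) {S : C → Set} (s : ∀ c → Dec (S c)) (t : ∀ a → Dec (S (f a))) xs →
                    length (filter s (map f xs)) ≡ length (filter t xs)
length-filter-map f s t [] = refl
length-filter-map f s t (x ∷ xs) with s (f x) | t x
... | yes _ | yes _ = cong suc (length-filter-map f s t xs)
... | no _ | no _ = length-filter-map f s t xs
... | yes p | no n = contradiction p n
... | no n | yes p = contradiction p n

sumPred : ∀ {A B : Set} {P : A → Set} {Q : B → Set} → FinPred P → FinPred Q → FinPred (SumPred P Q)
sumPred {A} {B} {P} {Q} p q = finPred dec (map inj₁ (universe p) ++ map inj₂ (universe q))
  (Unique.++⁺ (Unique.map⁺ inj₁-injective (universe-unique p)) (Unique.map⁺ inj₂-injective (universe-unique q)) disj)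
  compl
  where
  dec : ∀ x → Dec (SumPred P Q x)
  dec (inj₁ a) = decide p a
  dec (inj₂ b) = decide q b
  disj : ∀ {x} → ¬ (x ∈ map inj₁ (universe p) × x ∈ map inj₂ (universe q))
  disj (m , m') with ∈-map⁻ inj₁ m | ∈-map⁻ inj₂ m'
  ... | _ , _ , refl | _ , _ , ()
  compl : ∀ x → SumPred P Q x → x ∈ map inj₁ (universe p) ++ map inj₂ (universe q)
  compl (inj₁ a) Pa = ∈-++⁺ˡ (∈-map⁺ inj₁ (universe-complete p a Pa))
  compl (inj₂ b) Qb = ∈-++⁺ʳ _ (∈-map⁺ inj₂ (universe-complete q b Qb))

card-sum : ∀ {A B : Set} {P : A → Set} {Q : B → Set} (p : FinPred P) (q : FinPred Q) →
           card (sumPred p q) ≡ card p + card q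
card-sum {A} {B} {P} {Q} p q =
  trans (cong length (filter-++ (decide (sumPred p q)) (map inj₁ (universe p)) (map inj₂ (universe q))))
  (trans (length-++ (filter (decide (sumPred p q)) (map inj₁ (universe p))))
    (cong₂ _+_ (length-filter-map inj₁ (decide (sumPred p q)) (decide p) (universe p))
               (length-filter-map inj₂ (decide (sumPred p q)) (decide q) (universe q))))

card-⊎ : ∀ {A : Set} {P Q U : A → Set} (u : FinPred U) (p : FinPred P) (q : FinPred Q) →
         (∀ a → U a → P a ⊎ Q a) → (∀ a → P a → U a) → (∀ a → Q a → U a) → (∀ a → P a → Q a → ⊥) →
         card u ≡ card p + card q
card-⊎ {A} {P} {Q} {U} u p q f g h d =
  trans (card-rel u (sumPred p q) R to from (λ { _ _ refl refl → refl }) inj) (card-sum p q)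
  where
  untag : A ⊎ A → A
  untag = [ (λ a → a) , (λ a → a) ]′
  R : A → A ⊎ A → Set
  R a x = a ≡ untag x
  to : ∀ a → U a → ∃ λ x → SumPred P Q x × R a x
  to a Ua with f a Ua
  ... | inj₁ Pa = inj₁ a , Pa , refl
  ... | inj₂ Qa = inj₂ a , Qa , refl
  from : ∀ x → SumPred P Q x → ∃ λ a → U a × R a x
  from (inj₁ a) Pa = a , g a Pa , refl
  from (inj₂ a) Qa = a , h a Qa , refl
  inj : ∀ {a x x'} → SumPred P Q x → SumPred P Q x' → R a x → R a x' → x ≡ x'
  inj {x = inj₁ _} {inj₁ _} _ _ refl refl = refl
  inj {x = inj₂ _} {inj₂ _} _ _ refl refl = refl
  inj {x = inj₁ _} {inj₂ _} Pa Qa refl refl = ⊥-elim (d _ Pa Qa)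
  inj {x = inj₂ _} {inj₁ _} Qa Pa refl refl = ⊥-elim (d _ Pa Qa)

words : ℕ → ℕ → List (List ℕ)
words m zero = [] ∷ []
words m (suc n) = [] ∷ cartesianProductWith _∷_ (upTo m) (words m n)

words-unique : ∀ m n → Unique (words m n)
words-unique m zero = [] ∷ []
words-unique m (suc n) =
  All.tabulate (λ x∈ e → []≢ (∈-cartesianProductWith⁻ _∷_ (upTo m) (words m n) x∈) e)
  ∷ Unique.cartesianProductWith⁺ _∷_ ∷-injective (Unique.upTo⁺ m) (words-unique m n)
  where
  []≢ : ∀ {x : List ℕ} → (∃ λ a → ∃ λ b → a ∈ upTo m × b ∈ words m n × x ≡ a ∷ b) → [] ≢ x
  []≢ (_ , _ , _ , _ , refl) ()

words-complete : ∀ {m n w} → All (_< m) w → length w ≤ n → w ∈ words m n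
words-complete {n = zero} {[]} a l = here refl
words-complete {n = suc n} {[]} a l = here refl
words-complete {m} {suc n} {c ∷ w} (c< ∷ a) (s≤s l) =
  there (∈-cartesianProductWith⁺ _∷_ (∈-upTo⁺ c<) (words-complete a l))

wordPred : ∀ {P : List ℕ → Set} (m n : ℕ) → (∀ w → Dec (P w)) → (∀ w → P w → All (_< m) w × length w ≤ n) → FinPred P
wordPred m n d b = finPred d (words m n) (words-unique m n)
  (λ w Pw → let (x , y) = b w Pw in words-complete x y)

pairPred : ∀ {P : List ℕ × List ℕ → Set} (m n : ℕ) → (∀ w → Dec (P w)) →
           (∀ A B → P (A , B) → All (_< m) (A ++ B) × length (A ++ B) ≤ n) → FinPred P
pairPred m n d b = finPred d (cartesianProduct (words m n) (words m n))
  (Unique.cartesianProduct⁺ (words-unique m n) (words-unique m n))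
  (λ { (A , B) Pw → let (x , y) = b A B Pw
                        l = subst (_≤ n) (length-++ A) y
                    in ∈-cartesianProduct⁺ (words-complete (all-++ˡ A x) (≤-trans (m≤m+n _ _) l))
                                           (words-complete (all-++ʳ A x) (≤-trans (m≤n+m _ _) l)) })
  where
  all-++ˡ : ∀ A {B} → All (_< m) (A ++ B) → All (_< m) A
  all-++ˡ [] a = []
  all-++ˡ (x ∷ A) (p ∷ a) = p ∷ all-++ˡ A a
  all-++ʳ : ∀ A {B} → All (_< m) (A ++ B) → All (_< m) B
  all-++ʳ [] a = a
  all-++ʳ (x ∷ A) (p ∷ a) = all-++ʳ A a

-- The number of tableaux with a given cyclic descent set

module Row = Insertion rowRule
module Col = Insertion columnRule

-- Tableau words of shape ν: the rows of the entries 1, 2, …, |ν|.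
Tab : List ℕ → List ℕ → Set
Tab ν w = Path [] w × ends [] w ≡ ν

_≟ᴺ_ : (u v : List ℕ) → Dec (u ≡ v)
_≟ᴺ_ = ≡-dec _≟_

_≟ᴮ_ : (u v : List Bool) → Dec (u ≡ v)
_≟ᴮ_ = ≡-dec Bool._≟_

tab? : ∀ ν w → Dec (Tab ν w)
tab? ν w = path? [] w ×-dec (ends [] w ≟ᴺ ν)

length-≤-bump : ∀ γ r → length γ ≤ length (bump γ r)
length-≤-bump [] r = z≤n
length-≤-bump (x ∷ γ) zero = ≤-refl
length-≤-bump (x ∷ γ) (suc r) = s≤s (length-≤-bump γ r)

<-length-bump : ∀ γ r → r < length (bump γ r)
<-length-bump [] zero = s≤s z≤n
<-length-bump [] (suc r) = s≤s (<-length-bump [] r)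
<-length-bump (x ∷ γ) zero = s≤s z≤n
<-length-bump (x ∷ γ) (suc r) = s≤s (<-length-bump γ r)

length-≤-ends : ∀ γ w → length γ ≤ length (ends γ w)
length-≤-ends γ [] = ≤-refl
length-≤-ends γ (r ∷ w) = ≤-trans (length-≤-bump γ r) (length-≤-ends (bump γ r) w)

letters<length : ∀ γ w → All (_< length (ends γ w)) w
letters<length γ [] = []
letters<length γ (r ∷ w) = ≤-trans (<-length-bump γ r) (length-≤-ends (bump γ r) w) ∷ letters<length (bump γ r) w

sum-bump : ∀ γ r → sum (bump γ r) ≡ suc (sum γ)
sum-bump [] zero = refl
sum-bump [] (suc r) = sum-bump [] r
sum-bump (x ∷ γ) zero = refl
sum-bump (x ∷ γ) (suc r) = trans (cong (x +_) (sum-bump γ r)) (+-suc x (sum γ))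

sum-ends : ∀ γ w → sum (ends γ w) ≡ sum γ + length w
sum-ends γ [] = sym (+-identityʳ _)
sum-ends γ (r ∷ w) = trans (sum-ends (bump γ r) w) (trans (cong (_+ length w) (sum-bump γ r)) (sym (+-suc (sum γ) (length w))))

tab-length : ∀ {ν w} → Tab ν w → length w ≡ sum ν
tab-length {w = w} (_ , refl) = sym (sum-ends [] w)

tab-bound : ∀ {ν w} → Tab ν w → All (_< length ν) w × length w ≤ sum ν
tab-bound {w = w} t@(p , refl) = letters<length [] w , ≤-reflexive (tab-length t)

pre : List ℕ → Bool → List Bool
pre [] p = []
pre (x ∷ []) p = p ∷ []
pre (x ∷ y ∷ w) p = (x <ᵇ y) ∷ pre (y ∷ w) p

post : Bool → List ℕ → List Bool
post q [] = []
post q (x ∷ w) = q ∷ des (x ∷ w)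

-- The descent string of `D`, a further cell •, and `E`: the bit `p` stands between `D` and •, the
-- bit `q` between • and `E`, each absent when its side is empty.
glue : List ℕ → Bool → Bool → List ℕ → List Bool
glue D p q E = pre D p ++ post q E

pre-cong : ∀ {p} D D' → length D ≡ length D' → des D ≡ des D' → pre D p ≡ pre D' p
pre-cong [] [] l d = refl
pre-cong (x ∷ []) (x' ∷ []) l d = refl
pre-cong (x ∷ y ∷ D) (x' ∷ y' ∷ D') l d =
  cong₂ _∷_ (∷-injectiveˡ d) (pre-cong (y ∷ D) (y' ∷ D') (suc-injective l) (∷-injectiveʳ d))

post-cong : ∀ {q} E E' → length E ≡ length E' → des E ≡ des E' → post q E ≡ post q E'
post-cong [] [] l d = refl
post-cong {q} (x ∷ E) (x' ∷ E') l d = cong (q ∷_) d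

HeadBit : ℕ → Bool → List ℕ → Set
HeadBit c q [] = ⊤
HeadBit c q (e ∷ E) = (c <ᵇ e) ≡ q

des-glue : ∀ {c p q E} D → All (λ d → (d <ᵇ c) ≡ p) D → HeadBit c q E → des (D ++ c ∷ E) ≡ glue D p q E
des-glue {E = []} [] a h = refl
des-glue {E = e ∷ E} [] a h = cong (_∷ des (e ∷ E)) h
des-glue (d ∷ []) (e ∷ a) h = cong₂ _∷_ e (des-glue [] a h)
des-glue (d ∷ d' ∷ D) (e ∷ a) h = cong ((d <ᵇ d') ∷_) (des-glue (d' ∷ D) a h)

<⇒<ᵇ≡true : ∀ {m n} → m < n → (m <ᵇ n) ≡ true
<⇒<ᵇ≡true {m} {n} p with m <ᵇ n in e
... | true = refl
... | false = ⊥-elim (subst Bool.T e (<⇒<ᵇ p))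

≥⇒<ᵇ≡false : ∀ {m n} → n ≤ m → (m <ᵇ n) ≡ false
≥⇒<ᵇ≡false {m} {n} p with m <ᵇ n in e
... | false = refl
... | true = contradiction (<ᵇ⇒< m n (subst Bool.T (sym e) tt)) (≤⇒≯ p)

-- The bit at the wrap. When `A` is empty the wrap leads from • to `B`, an ascent; when only `B` is
-- empty it leads from `A` to •, a descent.
junction : List ℕ → List ℕ → Bool
junction [] B = false
junction (a ∷ []) [] = true
junction (a ∷ []) (b ∷ B) = a <ᵇ b
junction (a ∷ a' ∷ A) B = junction (a' ∷ A) B

-- The descent set, read cyclically from the cut between A and B, of the tableau
-- A ++ B followed by one more cell placed below everything.
cyc : List ℕ → List ℕ → List Bool
cyc A B = glue B true false A ∷ʳ junction A B

junction-∷ʳ : ∀ A a B → junction (A ∷ʳ a) B ≡ junction (a ∷ []) B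
junction-∷ʳ [] a B = refl
junction-∷ʳ (x ∷ []) a B = refl
junction-∷ʳ (x ∷ y ∷ A) a B = junction-∷ʳ (y ∷ A) a B

des-∷ʳ : ∀ x A a B → des ((x ∷ A) ∷ʳ a) ≡ des (x ∷ A) ∷ʳ junction (x ∷ A) (a ∷ B)
des-∷ʳ x [] a B = refl
des-∷ʳ x (y ∷ A) a B = cong ((x <ᵇ y) ∷_) (des-∷ʳ y A a B)

cyc-rotate : ∀ A a B → junction (A ∷ʳ a) B ∷ glue B true false (A ∷ʳ a) ≡ cyc A (a ∷ B)
cyc-rotate A a B = trans (cong₂ (λ u v → u ∷ pre B true ++ v) (junction-∷ʳ A a B) (post-∷ʳ A))
                     (trans (cong (_++ (post false A ∷ʳ junction A (a ∷ B))) (pre-∷ B)) (sym (++-assoc (pre (a ∷ B) true) (post false A) _)))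
  where
  post-∷ʳ : ∀ A → post false (A ∷ʳ a) ≡ post false A ∷ʳ junction A (a ∷ B)
  post-∷ʳ [] = refl
  post-∷ʳ (x ∷ A) = cong (false ∷_) (des-∷ʳ x A a B)
  pre-∷ : ∀ B → junction (a ∷ []) B ∷ pre B true ≡ pre (a ∷ B) true
  pre-∷ [] = refl
  pre-∷ (b ∷ B) = refl

rstep-mono : ∀ {x x'} c → x ≤ x' → rstep x c ≤ rstep x' c
rstep-mono {x} {x'} c p with c ≟ x | c ≟ x'
... | yes refl | yes refl = ≤-refl
... | yes refl | no n = ≤∧≢⇒< p n
... | no n | yes refl = m≤n⇒m≤1+n p
... | no _ | no _ = p

rptr-mono : ∀ {x x'} B → x ≤ x' → rptr x B ≤ rptr x' B
rptr-mono [] p = p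
rptr-mono (c ∷ B) p = rptr-mono B (rstep-mono c p)

rptr-++ : ∀ x A B → rptr x (A ++ B) ≡ rptr (rptr x A) B
rptr-++ x [] B = refl
rptr-++ x (a ∷ A) B = rptr-++ (rstep x a) A B

-- A path started earlier has already reached some row at least 0 when it arrives at the later cut,
-- and `rstep` preserves order. Hence the end of the path only moves down as the cut moves left.
rptr-suffix : ∀ A B → rptr 0 B ≤ rptr 0 (A ++ B)
rptr-suffix A B = subst (rptr 0 B ≤_) (sym (rptr-++ 0 A B)) (rptr-mono B z≤n)

rptr-addable : ∀ {γ x B} → Decreasing γ → Addable γ x → Path γ B → Addable (ends γ B) (rptr x B)
rptr-addable dγ ax [] = ax
rptr-addable dγ ax (a ∷ p) = rptr-addable (bump-decreasing dγ a) (rstep-addable dγ ax) p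

-- Started in the first empty row, the pointer is hit exactly when a new row is opened.
rptr-length : ∀ {γ B} → IsShape γ → Path γ B → rptr (length γ) B ≡ length (ends γ B)
rptr-length sh [] = refl
rptr-length {γ} {c ∷ B} sh (a ∷ p) = trans (cong (λ z → rptr z B) (step c (addable⇒≤ a))) (rptr-length (bump-shape sh a) p)
  where
  step : ∀ c → c ≤ length γ → rstep (length γ) c ≡ length (bump γ c)
  step c c≤ with c ≟ length γ
  ... | yes refl = sym (length-bump-new γ)
    where
    length-bump-new : ∀ γ → length (bump γ (length γ)) ≡ suc (length γ)
    length-bump-new [] = refl
    length-bump-new (x ∷ γ) = cong suc (length-bump-new γ)
  ... | no n = sym (length-bump-old γ (≤∧≢⇒< c≤ n))
    where
    length-bump-old : ∀ γ {c} → c < length γ → length (bump γ c) ≡ length γ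
    length-bump-old (x ∷ γ) {zero} p = refl
    length-bump-old (x ∷ γ) {suc c} (s≤s p) = cong suc (length-bump-old γ p)

cptr-zero : ∀ γ A → cptr γ 0 A ≡ 0
cptr-zero γ [] = refl
cptr-zero γ (c ∷ A) with c ≟ 0
... | yes refl = cptr-zero (bump γ 0) A
... | no _ = cptr-zero (bump γ c) A

row-ins-ptr : ∀ {γ x B y E} → Row.Ins γ x B y E → rptr x B ≡ y
row-ins-ptr Row.nil = refl
row-ins-ptr (Row.miss {B = B} n i) = trans (cong (λ z → rptr z B) (rstep-miss n)) (row-ins-ptr i)
row-ins-ptr (Row.hit {x = x} {B = B} refl i) = trans (cong (λ z → rptr z B) (rstep-hit x)) (row-ins-ptr i)

col-ins-ptr : ∀ {γ x B y E} → Col.Ins γ x B y E → cptr γ x B ≡ y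
col-ins-ptr Col.nil = refl
col-ins-ptr {γ} (Col.miss {c = c} {B = B} n i) = trans (cong (λ z → cptr (bump γ c) z B) (cstep-miss γ n)) (col-ins-ptr i)
col-ins-ptr {γ} (Col.hit {x = x} {B = B} refl i) = trans (cong (λ z → cptr (bump γ x) z B) (cstep-hit γ x)) (col-ins-ptr i)

ins-length : ∀ {γ x B y E} → Col.Ins γ x B y E → length B ≡ length E
ins-length Col.nil = refl
ins-length (Col.miss n i) = cong suc (ins-length i)
ins-length (Col.hit e i) = cong suc (ins-length i)

row-ins-length : ∀ {γ x B y E} → Row.Ins γ x B y E → length B ≡ length E
row-ins-length Row.nil = refl
row-ins-length (Row.miss n i) = cong suc (row-ins-length i)
row-ins-length (Row.hit e i) = cong suc (row-ins-length i)

-- `switch-ptr` from row 0 of the empty shape, where both first halves degenerate: the column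
-- pointer never leaves row 0 along `A`, and the row pointer stays in the first empty row along
-- `B'`, which is exactly the start of a column insertion.
switched-ptr : ∀ {A B B' A'} → Path [] (A ++ B) → Switch [] A B B' A' →
               rptr 0 B ≡ cptr (ends [] B') (length (ends [] B')) A'
switched-ptr {A} {B} {B'} {A'} p sw =
  trans (cong (λ z → rptr z B) (sym (cptr-zero [] A)))
  (trans (switch-ptr (shape-decreasing []-shape) zero p sw)
    (cong (λ z → cptr (ends [] B') z A')
      (rptr-length []-shape (proj₁ (path-++⁻ B' (switch-path A p sw))))))

col-head : ∀ {γ x B y E} → IsShape γ → x ≡ length γ → Path γ B → Col.Ins γ x B y E → HeadBit x false E
col-head sh e p Col.nil = tt
col-head sh refl (a ∷ p) (Col.miss n i) = ≥⇒<ᵇ≡false (addable⇒≤ a)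
col-head {γ} {x} sh refl (a ∷ p) (Col.hit refl i) =
  ≥⇒<ᵇ≡false (proj₁ (top-isTop (bump-decreasing (shape-decreasing sh) a) x))

row-head : ∀ {γ B y E} → Row.Ins γ 0 B y E → HeadBit 0 true E
row-head Row.nil = tt
row-head (Row.miss {c = zero} n i) = contradiction refl n
row-head (Row.miss {c = suc c} n i) = refl
row-head (Row.hit refl i) = refl

-- The condition `Φ` is left open because the count is used both for a fixed descent string and, in
-- the crossing argument, for `CrossBits`.
KeyL : List ℕ → ℕ → (List Bool → Set) → List ℕ × List ℕ → Set
KeyL ν y Φ (A , B) = Tab ν (A ++ B) × rptr 0 B ≡ y × Φ (glue B true false A)

KeyR : List ℕ → (List Bool → Set) → List ℕ → Set
KeyR ν Φ T = Tab ν T × Φ (des T)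

keyL : ∀ {Φ} ν y → (∀ s → Dec (Φ s)) → FinPred (KeyL ν y Φ)
keyL ν y Φ? = pairPred (length ν) (sum ν)
  (λ { (A , B) → tab? ν (A ++ B) ×-dec ((rptr 0 B ≟ y) ×-dec Φ? (glue B true false A)) })
  (λ A B k → tab-bound (proj₁ k))

keyR : ∀ {Φ} ν → (∀ s → Dec (Φ s)) → FinPred (KeyR ν Φ)
keyR ν Φ? = wordPred (length ν) (sum ν) (λ T → tab? ν T ×-dec Φ? (des T)) (λ T k → tab-bound (proj₁ k))

module _ {Φ : List Bool → Set} (Φ? : ∀ s → Dec (Φ s)) {ν y} (sν : IsShape ν) (ay : Addable ν y) where

  private
    record Rel (AB : List ℕ × List ℕ) (T : List ℕ) : Set where
      constructor rel
      field
        {B'} {A'} {E} : List ℕ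
        rel-switch : Switch [] (proj₁ AB) (proj₂ AB) B' A'
        rel-path : Path [] (B' ++ A')
        rel-eq : T ≡ B' ++ length (ends [] B') ∷ E
        rel-ins : Col.Ins (ends [] B') (length (ends [] B')) A' y E

    -- The inserted entry opens a new row, so it is a descent after every letter of `B'` and no
    -- descent follows it; switching and insertion preserve the remaining bits.
    glue-eq : ∀ {A B B' A' E} → Path [] (A ++ B) → Switch [] A B B' A' →
              Col.Ins (ends [] B') (length (ends [] B')) A' y E →
              des (B' ++ length (ends [] B') ∷ E) ≡ glue B true false A
    glue-eq {A} {B} {B'} {A'} {E} p sw i =
      let (p₁ , p₂) = path-++⁻ B' (switch-path A p sw)
          sh = ends-shape []-shape p₁
          d = shape-decreasing []-shape
      in trans (des-glue B' (All.map <⇒<ᵇ≡true (letters<length [] B')) (col-head sh refl p₂ i))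
         (cong₂ _++_ (pre-cong B' B (sym (switch-lengthʳ sw)) (sym (switch-desʳ d p sw)))
           (post-cong E A (sym (trans (switch-lengthˡ sw) (ins-length i)))
             (sym (trans (switch-desˡ d p sw) (Col.ins-des (shape-decreasing sh) (length-addable sh) p₂ i)))))

    to : ∀ AB → KeyL ν y Φ AB → ∃ λ T → KeyR (bump ν y) Φ T × Rel AB T
    to (A , B) ((p , e) , ptr , φ) =
      let (B' , A' , sw) = switch-total A p
          q = switch-path A p sw
          (p₁ , p₂) = path-++⁻ B' q
          sh = ends-shape []-shape p₁
          (y' , E , i) = Col.ins-total (ends [] B') (length (ends [] B')) A'
          ey : y' ≡ y
          ey = trans (sym (col-ins-ptr i)) (trans (sym (switched-ptr p sw)) ptr)
          i' = subst (λ z → Col.Ins _ _ A' z E) ey i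
          pT = path-++⁺ p₁ (length-addable sh ∷ Col.ins-path (shape-decreasing sh) (length-addable sh) p₂ i)
          eT = trans (ends-++ [] B' (length (ends [] B') ∷ E))
                 (trans (sym (Col.ins-ends i')) (cong (λ z → bump z y)
                   (trans (sym (ends-++ [] B' A')) (trans (sym (switch-ends A sw)) e))))
      in B' ++ length (ends [] B') ∷ E , ((pT , eT) , subst Φ (sym (glue-eq p sw i')) φ) , rel sw q refl i'

    from : ∀ T → KeyR (bump ν y) Φ T → ∃ λ AB → KeyL ν y Φ AB × Rel AB T
    from T ((p , e) , φ) with Col.insertable sν ay p e
    ... | Col.mkInsertable {B'} {_} {A'} {E} refl refl p₁ p₂ e' i with switch-total⁻ B' A' (path-++⁺ p₁ p₂)
    ... | A , B , sw =
      let q = switch-path⁻ A (path-++⁺ p₁ p₂) sw in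
      (A , B) , ((q , trans (switch-ends A sw) (trans (ends-++ [] B' A') e')) ,
                 trans (switched-ptr q sw) (col-ins-ptr i) ,
                 subst Φ (glue-eq q sw i) φ) , rel sw (path-++⁺ p₁ p₂) refl i

    inj : ∀ {AB AB' T} → KeyL ν y Φ AB → KeyL ν y Φ AB' → Rel AB T → Rel AB' T → AB ≡ AB'
    inj k k' (rel {B'} {A'} sw p refl i) (rel {B''} {A''} sw' p' e i')
      with path-++⁻ B' p | path-++⁻ B'' p'
    ... | p₁ , p₂ | q₁ , q₂
      with Col.insertable-unique B' []-shape e p₁ q₁ refl refl p₂ q₂ i i'
    ... | refl , refl with switch-det⁻ sw sw'
    ... | refl , refl = refl

    inj' : ∀ {AB T T'} → KeyR (bump ν y) Φ T → KeyR (bump ν y) Φ T' → Rel AB T → Rel AB T' → T ≡ T'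
    inj' k k' (rel sw p refl i) (rel sw' p' refl i') with switch-det sw sw'
    ... | refl , refl with Col.ins-det i i'
    ... | _ , refl = refl

  -- The column path obtained by switching is realised as an insertion: a new entry enters between
  -- `B'` and `A'`, and its bumping path ends in the cell `y` that completes `ν`. Conversely,
  -- reverse bumping from `y` finds the place of that entry in any `T`, and with it the cut.
  key : card (keyL ν y Φ?) ≡ card (keyR (bump ν y) Φ?)
  key = card-rel (keyL ν y Φ?) (keyR (bump ν y) Φ?) Rel to from inj inj'

-- Cuts at which the end of the row path passes a given row

Crossing : ℕ → List ℕ → Set
Crossing t [] = ⊥
Crossing t (a ∷ B) = rptr 0 B ≤ t × t < rptr 0 (a ∷ B)

crossing? : ∀ t D → Dec (Crossing t D)
crossing? t [] = no λ ()
crossing? t (a ∷ B) = (rptr 0 B ≤? t) ×-dec (t <? rptr 0 (a ∷ B))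

-- The end of the path is monotone in the cut, so a threshold is passed at most once.
crossing-unique : ∀ {t D D'} A A' → A ++ D ≡ A' ++ D' → Crossing t D → Crossing t D' → A ≡ A' × D ≡ D'
crossing-unique [] [] refl c c' = refl , refl
crossing-unique {D' = d ∷ D'} [] (a ∷ A') refl (c , _) (_ , c') =
  contradiction (≤-trans (rptr-suffix A' (d ∷ D')) c) (<⇒≱ c')
crossing-unique {D = d ∷ D} (a ∷ A) [] refl (_ , c) (c' , _) =
  contradiction (≤-trans (rptr-suffix A (d ∷ D)) c') (<⇒≱ c)
crossing-unique (a ∷ A) (a' ∷ A') e c c' with ∷-injective e
... | refl , e' with crossing-unique A A' e' c c'
... | refl , refl = refl , refl

-- On the output of an insertion, pointers started on either side of the bumping path cannot cross
-- it. With `p = 0` just after the new entry and `q = 1` as moved by it, the cut at that entry is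
-- the crossing of `y`.
row-crossing : ∀ {γ x B y E} → Row.Ins γ x B y E → ∀ {p q} → p ≤ x → x < q → rptr p E ≤ y × y < rptr q E
row-crossing Row.nil p≤x x<q = p≤x , x<q
row-crossing {x = x} (Row.miss {c = c} n i) {p} {q} p≤x x<q = row-crossing i p' q'
  where
  p' : rstep p c ≤ x
  p' with c ≟ p
  ... | yes refl = ≤∧≢⇒< p≤x n
  ... | no _ = p≤x
  q' : x < rstep q c
  q' with c ≟ q
  ... | yes _ = m<n⇒m<1+n x<q
  ... | no _ = x<q
row-crossing {x = x} (Row.hit refl i) {p} {q} p≤x x<q = row-crossing i p' q'
  where
  p' : rstep p (suc x) ≤ suc x
  p' with suc x ≟ p
  ... | yes refl = contradiction p≤x 1+n≰n
  ... | no _ = m≤n⇒m≤1+n p≤x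
  q' : suc x < rstep q (suc x)
  q' with suc x ≟ q
  ... | yes refl = ≤-refl
  ... | no n = ≤∧≢⇒< x<q n

CrossP : List ℕ → ℕ → List Bool → List ℕ × List ℕ → Set
CrossP ν t J (A , D) = Tab ν (A ++ D) × Crossing t D × cyc A D ≡ J

crossP : ∀ ν t J → FinPred (CrossP ν t J)
crossP ν t J = pairPred (length ν) (sum ν)
  (λ { (A , D) → tab? ν (A ++ D) ×-dec (crossing? t D ×-dec (cyc A D ≟ᴮ J)) })
  (λ A D k → tab-bound (proj₁ k))

-- At a crossing of a corner the suffix begins with an inserted entry in row 0: it is followed by a
-- descent, whence the leading true, and nothing descends into it, whence the final false.
CrossBits : List Bool → List Bool → Set
CrossBits J s = true ∷ s ∷ʳ false ≡ J

crossBits? : ∀ J s → Dec (CrossBits J s)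
crossBits? J s = (true ∷ s ∷ʳ false) ≟ᴮ J

module _ {ν y} (sν : IsShape ν) (ay : Addable ν y) (J : List Bool) where

  private
    record Rel (AB AD : List ℕ × List ℕ) : Set where
      constructor rel
      field
        {A} {B} {E} : List ℕ
        relˡ : AB ≡ (A , B)
        relʳ : AD ≡ (A , 0 ∷ E)
        rel-path : Path [] (A ++ B)
        rel-ins : Row.Ins (ends [] A) 0 B y E

    junction-zero : ∀ A E → junction A (0 ∷ E) ≡ false
    junction-zero [] E = refl
    junction-zero (a ∷ []) E = ≥⇒<ᵇ≡false {a} z≤n
    junction-zero (a ∷ a' ∷ A) E = junction-zero (a' ∷ A) E

    pre-zero : ∀ {γ B} E → Row.Ins γ 0 B y E → pre (0 ∷ E) true ≡ true ∷ pre E true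
    pre-zero [] i = refl
    pre-zero (e ∷ E) i = cong (_∷ pre (e ∷ E) true) (row-head i)

    cyc-eq : ∀ {A B E} → Path [] (A ++ B) → Row.Ins (ends [] A) 0 B y E →
             cyc A (0 ∷ E) ≡ true ∷ glue B true false A ∷ʳ false
    cyc-eq {A} {B} {E} p i =
      let (p₁ , p₂) = path-++⁻ A p
          d = shape-decreasing (ends-shape []-shape p₁)
      in cong₂ (λ u v → (u ++ post false A) ∷ʳ v)
           (trans (pre-zero E i) (cong (true ∷_) (pre-cong E B (sym (row-ins-length i)) (sym (Row.ins-des d zero p₂ i)))))
           (junction-zero A E)

    to : ∀ AB → KeyL ν y (CrossBits J) AB → ∃ λ AD → CrossP (bump ν y) y J AD × Rel AB AD
    to (A , B) ((p , e) , ptr , φ) =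
      let (p₁ , p₂) = path-++⁻ A p
          d = shape-decreasing (ends-shape []-shape p₁)
          (y' , E , i') = Row.ins-total (ends [] A) 0 B
          i = subst (λ z → Row.Ins _ 0 B z E) (trans (sym (row-ins-ptr i')) ptr) i'
          (c , c') = row-crossing i ≤-refl (s≤s z≤n)
      in (A , 0 ∷ E) ,
         ((path-++⁺ p₁ (zero ∷ Row.ins-path d zero p₂ i) ,
           trans (ends-++ [] A (0 ∷ E)) (trans (sym (Row.ins-ends i)) (cong (λ z → bump z y) (trans (sym (ends-++ [] A B)) e)))) ,
          (c , c') , trans (cyc-eq {A} p i) φ) , rel refl refl p i

    from : ∀ AD → CrossP (bump ν y) y J AD → ∃ λ AB → KeyL ν y (CrossBits J) AB × Rel AB AD
    from (A , D) ((p , e) , cr , ej) with Row.insertable sν ay p e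
    ... | Row.mkInsertable {A₀} {_} {B} {E} eq refl p₁ p₂ e' i
      with crossing-unique A A₀ eq cr (row-crossing i ≤-refl (s≤s z≤n))
    ... | refl , refl =
      (A , B) , ((path-++⁺ p₁ p₂ , trans (ends-++ [] A B) e') , row-ins-ptr i ,
                 trans (sym (cyc-eq {A} (path-++⁺ p₁ p₂) i)) ej) , rel refl refl (path-++⁺ p₁ p₂) i

    inj : ∀ {AB AB' AD} → KeyL ν y (CrossBits J) AB → KeyL ν y (CrossBits J) AB' → Rel AB AD → Rel AB' AD → AB ≡ AB'
    inj k k' (rel {A} refl refl p i) (rel refl refl p' i') =
      let (p₁ , p₂) = path-++⁻ A p
          (_ , q₂) = path-++⁻ A p'
          sh = ends-shape []-shape p₁
      in cong (A ,_) (proj₂ (Row.ins-det⁻ sh sh zero zero p₂ q₂ refl i i'))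

    inj' : ∀ {AB AD AD'} → CrossP (bump ν y) y J AD → CrossP (bump ν y) y J AD' → Rel AB AD → Rel AB AD' → AD ≡ AD'
    inj' k k' (rel {A} refl refl p i) (rel refl refl p' i') = cong (λ z → A , 0 ∷ z) (proj₂ (Row.ins-det i i'))

  -- Row insertion of a new entry at a cut of `ν` whose path ends at `y` produces a crossing of `y`;
  -- reverse row bumping from `y` shows that every crossing of `y` arises so. The cuts of `ν` are
  -- then counted by `key`.
  crossing-count : card (crossP (bump ν y) y J) ≡ card (keyR (bump ν y) (crossBits? J))
  crossing-count = trans (sym (card-rel (keyL ν y (crossBits? J)) (crossP (bump ν y) y J) Rel to from inj inj'))
                         (key (crossBits? J) sν ay)

-- Seen from any corner y of ν, the number of crossings is a descent count of ν itself,
-- so it does not depend on y.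
corner-crossing-count : ∀ {ν y} → IsShape ν → Corner ν y → ∀ J →
                        card (crossP ν y J) ≡ card (keyR ν (crossBits? J))
corner-crossing-count {ν} {y} sh c J =
  subst (λ z → card (crossP z y J) ≡ card (keyR z (crossBits? J))) (bump-unbump′ sh c)
    (crossing-count (unbump-shape sh c) (unbump-addable sh c) J)

-- Rotation invariance of the cyclic counts

NP : List ℕ → ℕ → List Bool → List ℕ × List ℕ → Set
NP ν r J (A , B) = Tab ν (A ++ B) × rptr 0 B ≡ r × cyc A B ≡ J

nP : ∀ ν r J → FinPred (NP ν r J)
nP ν r J = pairPred (length ν) (sum ν)
  (λ { (A , B) → tab? ν (A ++ B) ×-dec ((rptr 0 B ≟ r) ×-dec (cyc A B ≟ᴮ J)) })
  (λ A B k → tab-bound (proj₁ k))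

-- The number of tableaux of shape ν + (a cell in row r) with cyclic descent set J.
cyclicCount : List ℕ → ℕ → List Bool → ℕ
cyclicCount ν r J = card (nP ν r J)

cyclicCount-extends : ∀ {ν r} → IsShape ν → Addable ν r → ∀ s →
  cyclicCount ν r (s ∷ʳ false) + cyclicCount ν r (s ∷ʳ true) ≡ card (keyR (bump ν r) (_≟ᴮ s))
cyclicCount-extends {ν} {r} sh ar s =
  trans (sym (card-⊎ (keyL ν r (_≟ᴮ s)) (nP ν r (s ∷ʳ false)) (nP ν r (s ∷ʳ true)) split
               (λ { (A , B) (t , p , e) → t , p , proj₁ (∷ʳ-injective _ _ e) })
               (λ { (A , B) (t , p , e) → t , p , proj₁ (∷ʳ-injective _ _ e) })
               (λ { (A , B) (_ , _ , e) (_ , _ , e') → contradiction (proj₂ (∷ʳ-injective _ _ (trans (sym e) e'))) λ () })))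
        (key (_≟ᴮ s) sh ar)
  where
  split : ∀ AB → KeyL ν r (_≡ s) AB → NP ν r (s ∷ʳ false) AB ⊎ NP ν r (s ∷ʳ true) AB
  split (A , B) (t , p , refl) with junction A B
  ... | false = inj₁ (t , p , refl)
  ... | true = inj₂ (t , p , refl)

module _ {ν r} (sh : IsShape ν) (ar : Addable ν (suc r)) (0<r : 0 < part ν (suc r)) (s : List Bool) (b : Bool) where

  private
    J : List Bool
    J = b ∷ s

    Tail : List ℕ × List ℕ → Set
    Tail (A , []) = ⊥
    Tail (A , a ∷ B) = Tab ν (A ++ a ∷ B) × rptr 0 B ≡ suc r × cyc A (a ∷ B) ≡ J

    tailP : FinPred Tail
    tailP = pairPred (length ν) (sum ν)
      (λ { (A , []) → no λ () ; (A , a ∷ B) → tab? ν (A ++ a ∷ B) ×-dec ((rptr 0 B ≟ suc r) ×-dec (cyc A (a ∷ B) ≟ᴮ J)) })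
      (λ { A (a ∷ B) k → tab-bound (proj₁ k) })

    data Shifted : List ℕ × List ℕ → List ℕ × List ℕ → Set where
      shifted : ∀ {A a B} → Shifted (A , a ∷ B) (A ∷ʳ a , B)

    snoc-view : ∀ (A : List ℕ) → A ≡ [] ⊎ ∃ λ A' → ∃ λ a → A ≡ A' ∷ʳ a
    snoc-view [] = inj₁ refl
    snoc-view (x ∷ A) with snoc-view A
    ... | inj₁ refl = inj₂ ([] , x , refl)
    ... | inj₂ (A' , a , refl) = inj₂ (x ∷ A' , a , refl)

    -- The path of the uncut tableau ends in the first empty row, whereas row `suc r` is nonempty.
    -- This is where the added cell has to avoid the first column.
    whole-ptr : ∀ {B} → Tab ν B → rptr 0 B ≢ suc r
    whole-ptr {B} (p , refl) e =
      <-irrefl (sym (part-beyond ν ≤-refl)) (subst (λ z → 0 < part ν z) (sym (trans (sym (rptr-length []-shape p)) e)) 0<r)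

    tail-count : card tailP ≡ cyclicCount ν (suc r) (s ∷ʳ b)
    tail-count = card-rel tailP (nP ν (suc r) (s ∷ʳ b)) Shifted to from
      (λ { _ _ shifted z → uniq z }) (λ { _ _ shifted shifted → refl })
      where
      to : ∀ AD → Tail AD → ∃ λ AB → NP ν (suc r) (s ∷ʳ b) AB × Shifted AD AB
      to (A , a ∷ B) (t , p , e) with ∷-injective (trans (cyc-rotate A a B) e)
      ... | e₁ , e₂ = (A ∷ʳ a , B) , (subst (Tab ν) (sym (++-assoc A (a ∷ []) B)) t , p , cong₂ _∷ʳ_ e₂ e₁) , shifted
      from : ∀ AB → NP ν (suc r) (s ∷ʳ b) AB → ∃ λ AD → Tail AD × Shifted AD AB
      from (A , B) (t , p , e) with snoc-view A
      ... | inj₁ refl = contradiction p (whole-ptr t)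
      ... | inj₂ (A' , a , refl) with ∷ʳ-injective _ _ e
      ... | e₂ , e₁ = (A' , a ∷ B) , (subst (Tab ν) (++-assoc A' (a ∷ []) B) t , p , trans (sym (cyc-rotate A' a B)) (cong₂ _∷_ e₁ e₂)) , shifted
      uniq : ∀ {A a B AD} → Shifted AD (A ∷ʳ a , B) → (A , a ∷ B) ≡ AD
      uniq z = go z refl
        where
        go : ∀ {A a B AD X Y} → Shifted AD (X , Y) → (X , Y) ≡ (A ∷ʳ a , B) → (A , a ∷ B) ≡ AD
        go {A} {a} (shifted {A'} {a'}) e with ∷ʳ-injective A' A (cong proj₁ e) | cong proj₂ e
        ... | refl , refl | refl = refl

    -- The corner of `ν` next below the added cell: the last of the rows as long as row `suc r`. The
    -- corner next above is in row `r`, since `suc r` is addable.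
    q : ℕ
    q = proj₁ (bottom (suc r) (shape-decreasing sh) 0<r)
    r≤q = proj₁ (proj₂ (bottom (suc r) (shape-decreasing sh) 0<r))
    part-q = proj₁ (proj₂ (proj₂ (bottom (suc r) (shape-decreasing sh) 0<r)))
    corner-q = proj₂ (proj₂ (proj₂ (bottom (suc r) (shape-decreasing sh) 0<r)))

    addable≤q : ∀ {p} → Addable ν p → p ≤ q → p ≤ suc r
    addable≤q {zero} ap p≤q = z≤n
    addable≤q {suc p} (suc ap) p≤q with suc p ≤? suc r
    ... | yes le = le
    ... | no ¬le = contradiction (trans (pin (≤-pred (≰⇒> ¬le)) (<⇒≤ p≤q)) (sym (pin (<⇒≤ (≰⇒> ¬le)) p≤q))) (≢-sym (<⇒≢ ap))
      where
      pin : ∀ {z} → suc r ≤ z → z ≤ q → part ν z ≡ part ν (suc r)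
      pin a b = ≤-antisym (part-mono (shape-decreasing sh) a) (≤-trans (≤-reflexive (sym part-q)) (part-mono (shape-decreasing sh) b))

    ptr-addable : ∀ A {B} → Tab ν (A ++ B) → Addable ν (rptr 0 B)
    ptr-addable A {B} (p , e) =
      let (p₁ , p₂) = path-++⁻ A p in
      subst (λ z → Addable z (rptr 0 B)) (trans (sym (ends-++ [] A B)) e)
        (rptr-addable (ends-decreasing (shape-decreasing []-shape) p₁) zero p₂)

    -- A row path ends only in addable rows, and none of the rows below `suc r` down to `q` is
    -- addable; so passing `suc r` and passing `q` are the same event.
    cross-q : card (crossP ν (suc r) J) ≡ card (crossP ν q J)
    cross-q = card-cong (crossP ν (suc r) J) (crossP ν q J)
      (λ { (A , a ∷ B) (t , (c , c') , e) → t ,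
             (≤-trans c r≤q , ≰⇒> (λ le → <⇒≱ c' (addable≤q (ptr-addable A {a ∷ B} t) le))) , e })
      (λ { (A , a ∷ B) (t , (c , c') , e) → t ,
             (addable≤q (ptr-addable (A ∷ʳ a) (subst (Tab ν) (sym (++-assoc A (a ∷ []) B)) t)) c , ≤-trans (s≤s r≤q) c') , e })

    -- Moving the cut over `a` makes the path end touch or pass row `suc r`. Splitting off the cuts
    -- that are at `suc r` after the move leaves the crossings of `r`; splitting off those at
    -- `suc r` before it leaves the crossings of `suc r`. Comparing the two splittings gives the
    -- rotation.
    Both : List ℕ × List ℕ → Set
    Both (A , []) = ⊥
    Both (A , a ∷ B) = Tab ν (A ++ a ∷ B) × (rptr 0 B ≤ suc r × suc r ≤ rptr 0 (a ∷ B)) × cyc A (a ∷ B) ≡ J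

    bothP : FinPred Both
    bothP = pairPred (length ν) (sum ν)
      (λ { (A , []) → no λ () ; (A , a ∷ B) → tab? ν (A ++ a ∷ B) ×-dec
             (((rptr 0 B ≤? suc r) ×-dec (suc r ≤? rptr 0 (a ∷ B))) ×-dec (cyc A (a ∷ B) ≟ᴮ J)) })
      (λ { A (a ∷ B) k → tab-bound (proj₁ k) })

    suffix : ∀ a B → rptr 0 B ≤ rptr 0 (a ∷ B)
    suffix a B = rptr-suffix (a ∷ []) B

    both₁ : card bothP ≡ card tailP + card (crossP ν r J)
    both₁ = card-⊎ bothP tailP (crossP ν r J) split
      (λ { (A , a ∷ B) (t , p , e) → t , (≤-reflexive p , ≤-trans (≤-reflexive (sym p)) (suffix a B)) , e })
      (λ { (A , a ∷ B) (t , (c , c') , e) → t , (m≤n⇒m≤1+n c , c') , e })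
      (λ { (A , a ∷ B) (t , p , e) (_ , (c , _) , _) → contradiction c (<⇒≱ (≤-reflexive (sym p))) })
      where
      split : ∀ AD → Both AD → Tail AD ⊎ CrossP ν r J AD
      split (A , a ∷ B) (t , (c , c') , e) with m≤n⇒m<n∨m≡n c
      ... | inj₂ p = inj₁ (t , p , e)
      ... | inj₁ p = inj₂ (t , (≤-pred p , c') , e)

    both₂ : card bothP ≡ cyclicCount ν (suc r) J + card (crossP ν (suc r) J)
    both₂ = card-⊎ bothP (nP ν (suc r) J) (crossP ν (suc r) J) split
      (λ { (A , a ∷ B) (t , p , e) → t , (≤-trans (suffix a B) (≤-reflexive p) , ≤-reflexive (sym p)) , e })
      (λ { (A , a ∷ B) (t , (c , c') , e) → t , (c , <⇒≤ c') , e })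
      (λ { (A , a ∷ B) (t , p , e) (_ , (_ , c) , _) → contradiction (≤-reflexive p) (<⇒≱ c) })
      where
      split : ∀ AD → Both AD → NP ν (suc r) J AD ⊎ CrossP ν (suc r) J AD
      split (A , a ∷ B) (t , (c , c') , e) with m≤n⇒m<n∨m≡n c'
      ... | inj₂ p = inj₁ (t , sym p , e)
      ... | inj₁ p = inj₂ (t , (c , p) , e)

  cyclicCount-rotate : cyclicCount ν (suc r) (s ∷ʳ b) ≡ cyclicCount ν (suc r) (b ∷ s)
  cyclicCount-rotate = +-cancelʳ-≡ (card (keyR ν (crossBits? J))) _ _ (begin
    cyclicCount ν (suc r) (s ∷ʳ b) + K ≡⟨ cong₂ _+_ (sym tail-count) (sym (corner-crossing-count sh (addable-suc ar) J)) ⟩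
    card tailP + card (crossP ν r J) ≡⟨ trans (sym both₁) both₂ ⟩
    cyclicCount ν (suc r) J + card (crossP ν (suc r) J) ≡⟨ cong (cyclicCount ν (suc r) J +_) (trans cross-q (corner-crossing-count sh corner-q J)) ⟩
    cyclicCount ν (suc r) J + K ∎)
    where
    open ≡-Reasoning
    K = card (keyR ν (crossBits? J))

NP-true : ∀ {ν r J} AB → r ≢ 0 → NP ν r J AB → true ∈ J
NP-true (A , []) n (t , p , e) = contradiction (sym p) n
NP-true (A , b ∷ B) n (t , p , refl) = ∈-++⁺ˡ (∈-++⁺ˡ (true∈pre b B))
  where
  true∈pre : ∀ b B → true ∈ pre (b ∷ B) true
  true∈pre b [] = here refl
  true∈pre b (b' ∷ B) = there (true∈pre b' B)

NP-false : ∀ {ν r J} AB → NP ν r J AB → false ∈ J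
NP-false ([] , B) (t , p , refl) = ∈-++⁺ʳ (glue B true false []) (here refl)
NP-false (a ∷ A , B) (t , p , refl) = ∈-++⁺ˡ (∈-++⁺ʳ (pre B true) (here refl))

-- Descents and standard tableaux

snoc : ∀ {A : Set} {n} → Vec A n → A → Vec A (suc n)
snoc [] b = b ∷ []
snoc (x ∷ v) b = x ∷ snoc v b

lookup-snoc-inject₁ : ∀ {A : Set} {n} (v : Vec A n) b i → lookup (snoc v b) (inject₁ i) ≡ lookup v i
lookup-snoc-inject₁ (x ∷ v) b zero = refl
lookup-snoc-inject₁ (x ∷ v) b (suc i) = lookup-snoc-inject₁ v b i

lookup-snoc-fromℕ : ∀ {A : Set} {n} (v : Vec A n) b → lookup (snoc v b) (fromℕ n) ≡ b
lookup-snoc-fromℕ [] b = refl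
lookup-snoc-fromℕ (x ∷ v) b = lookup-snoc-fromℕ v b

vec-ext : ∀ {A : Set} {n} {u v : Vec A n} → (∀ i → lookup u i ≡ lookup v i) → u ≡ v
vec-ext {u = u} {v} e = trans (sym (tabulate∘lookup u)) (trans (tabulate-cong e) (tabulate∘lookup v))

next-inject₁ : ∀ {m} (k : Fin m) → next (inject₁ k) ≡ suc k
next-inject₁ {m} k = toℕ-injective (trans (toℕ-fromℕ< _)
  (trans (m<n⇒m%n≡m (s≤s (subst (_< m) (sym (toℕ-inject₁ k)) (toℕ<n k)))) (cong suc (toℕ-inject₁ k))))

next-fromℕ : ∀ m → next (fromℕ m) ≡ zero
next-fromℕ m = toℕ-injective (trans (toℕ-fromℕ< _)
  (trans (cong (λ z → suc z % suc m) (toℕ-fromℕ m)) (n%n≡0 (suc m))))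

pairs : ∀ {A : Set} {m} → (A → A → Bool) → Vec A (suc m) → Vec Bool m
pairs f x = tabulate (λ k → f (lookup x (inject₁ k)) (lookup x (suc k)))

lookup-pairs : ∀ {A : Set} {m} (f : A → A → Bool) (x : Vec A (suc m)) k →
               lookup (pairs f x) k ≡ f (lookup x (inject₁ k)) (lookup x (suc k))
lookup-pairs f x k = lookup∘tabulate (λ k → f (lookup x (inject₁ k)) (lookup x (suc k))) k

module _ {A : Set} {m} (f : A → A → Bool) (x : Vec A (suc m)) where

  private
    at : Fin (suc m) → Bool
    at i = f (lookup x i) (lookup x (next i))

    at-inject₁ : ∀ b k → at (inject₁ k) ≡ lookup (snoc (pairs f x) b) (inject₁ k)
    at-inject₁ b k = trans (cong (λ z → f (lookup x (inject₁ k)) (lookup x z)) (next-inject₁ k))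
                       (sym (trans (lookup-snoc-inject₁ (pairs f x) b k) (lookup-pairs f x k)))

    bound : Fin (suc m) → Bool
    bound i = ⌊ suc (toℕ i) <? suc m ⌋

  cyclic-tabulate : tabulate at ≡ snoc (pairs f x) (f (lookup x (fromℕ m)) (lookup x zero))
  cyclic-tabulate = vec-ext (λ i → trans (lookup∘tabulate at i) (go i))
    where
    b = f (lookup x (fromℕ m)) (lookup x zero)
    go : ∀ i → at i ≡ lookup (snoc (pairs f x) b) i
    go i with view i
    ... | ‵fromℕ = trans (cong (λ z → f (lookup x (fromℕ m)) (lookup x z)) (next-fromℕ m))
                         (sym (lookup-snoc-fromℕ (pairs f x) b))
    ... | ‵inject₁ k = at-inject₁ b k

  linear-tabulate : tabulate (λ i → bound i ∧ at i) ≡ snoc (pairs f x) false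
  linear-tabulate = vec-ext (λ i → trans (lookup∘tabulate (λ i → bound i ∧ at i) i) (go i))
    where
    go : ∀ i → bound i ∧ at i ≡ lookup (snoc (pairs f x) false) i
    go i with view i
    ... | ‵fromℕ = trans (cong (_∧ at (fromℕ m)) (trans (isYes≗does (suc (toℕ (fromℕ m)) <? suc m))
                          (dec-false (suc (toℕ (fromℕ m)) <? suc m) (λ p → <-irrefl (toℕ-fromℕ m) (≤-pred p)))))
                        (sym (lookup-snoc-fromℕ (pairs f x) false))
    ... | ‵inject₁ k = trans (cong (_∧ at (inject₁ k)) (trans (isYes≗does (suc (toℕ (inject₁ k)) <? suc m))
                          (dec-true (suc (toℕ (inject₁ k)) <? suc m) (s≤s (subst (_< m) (sym (toℕ-inject₁ k)) (toℕ<n k))))))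
                        (at-inject₁ false k)

rowLess : ℕ × ℕ → ℕ × ℕ → Bool
rowLess a b = ⌊ proj₁ a <? proj₁ b ⌋

rowWord : ∀ {n} → Vec (ℕ × ℕ) n → List ℕ
rowWord T = toList (Vec.map proj₁ T)

pairs-des : ∀ {m} (T : Vec (ℕ × ℕ) (suc m)) → toList (pairs rowLess T) ≡ des (rowWord T)
pairs-des (x ∷ []) = refl
pairs-des (x ∷ y ∷ T) = cong₂ _∷_ (isYes≗does (proj₁ x <? proj₁ y)) (pairs-des (y ∷ T))

cells : ∀ {n} → List ℕ → Vec ℕ n → Vec (ℕ × ℕ) n
cells γ [] = []
cells γ (r ∷ w) = (r , part γ r) ∷ cells (bump γ r) w

rows-cells : ∀ {n} γ (w : Vec ℕ n) → Vec.map proj₁ (cells γ w) ≡ w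
rows-cells γ [] = refl
rows-cells γ (r ∷ w) = cong (r ∷_) (rows-cells (bump γ r) w)

part≤part-ends : ∀ γ w r → part γ r ≤ part (ends γ w) r
part≤part-ends γ [] r = ≤-refl
part≤part-ends γ (a ∷ w) r = ≤-trans (part≤part-bump γ a r) (part≤part-ends (bump γ a) w r)

-- The smallest entry lies at an addable cell of `mu`: a skew cell to its left or above it would
-- hold a smaller entry. Moving this cell into `mu` leaves a tableau with one entry less.
syt⇒path : ∀ {n} la mu (T : Vec (ℕ × ℕ) n) → IsShape la → IsShape mu → (∀ r → part mu r ≤ part la r) →
           IsSYT n la mu T → Path mu (rowWord T) × ends mu (rowWord T) ≡ la × T ≡ cells mu (Vec.map proj₁ T)
syt⇒path la mu [] sl sm le (_ , _ , surj , _) =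
  [] , shape-ext sm sl (λ r → ≤-antisym (le r) (≮⇒≥ (λ p → no-cell r p))) , refl
  where
  no-cell : ∀ r → ¬ (part mu r < part la r)
  no-cell r p with surj (r , part mu r) (≤-refl , p)
  ... | () , _
syt⇒path {suc n} la mu ((r , c) ∷ T) sl sm le (inn , inj , surj , rowi , coli) =
  let (p , e , q) = syt⇒path la (bump mu r) T sl (bump-shape sm add) le' (inn' , inj' , surj' , rowi' , coli')
  in add ∷ p , e , cong₂ _∷_ (cong (r ,_) c≡) q
  where
  c≡ : c ≡ part mu r
  c≡ with m≤n⇒m<n∨m≡n (proj₁ (inn zero))
  ... | inj₂ e = sym e
  c≡ | inj₁ lt = ⊥-elim (left c refl lt)
    where
    left : ∀ z → z ≡ c → ¬ (part mu r < z)
    left (suc z) refl (s≤s p) with surj (r , z) (p , <⇒≤ (proj₂ (inn zero)))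
    ... | i , e with rowi i zero (cong proj₁ e) (subst (_< suc z) (sym (cong proj₂ e)) ≤-refl)
    ... | ()
  add : Addable mu r
  add = up r refl
    where
    up : ∀ z → z ≡ r → Addable mu z
    up zero e = zero
    up (suc z) refl with part mu (suc z) <? part mu z
    ... | yes p = suc p
    ... | no ¬p with surj (z , c) (≤-trans (≮⇒≥ ¬p) (≤-reflexive (sym c≡)) ,
                                   ≤-trans (proj₂ (inn zero)) (descent (shape-decreasing sl) z))
    ... | i , e with coli i zero (cong proj₂ e) (subst (_< suc z) (sym (cong proj₁ e)) ≤-refl)
    ... | ()
  le' : ∀ r' → part (bump mu r) r' ≤ part la r'
  le' r' with r ≟ r'
  ... | yes refl = subst (_≤ part la r) (sym (trans (part-bump-≡ mu r) (cong suc (sym c≡)))) (proj₂ (inn zero))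
  ... | no n = subst (_≤ part la r') (sym (part-bump-≢ mu n)) (le r')
  inn' : ∀ i → InSkew la (bump mu r) (lookup T i)
  inn' i = lower , proj₂ (inn (suc i))
    where
    lower : part (bump mu r) (proj₁ (lookup T i)) ≤ proj₂ (lookup T i)
    lower with r ≟ proj₁ (lookup T i)
    ... | no n = subst (_≤ proj₂ (lookup T i)) (sym (part-bump-≢ mu n)) (proj₁ (inn (suc i)))
    ... | yes e = subst (_≤ proj₂ (lookup T i)) (sym (trans (cong (part (bump mu r)) (sym e)) (part-bump-≡ mu r)))
          (≤∧≢⇒< (subst (λ z → part mu z ≤ proj₂ (lookup T i)) (sym e) (proj₁ (inn (suc i))))
            (λ e' → contradiction (inj zero (suc i) (cong₂ _,_ e (trans c≡ e'))) λ ()))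
  inj' : ∀ i j → lookup T i ≡ lookup T j → i ≡ j
  inj' i j e = F.suc-injective (inj (suc i) (suc j) e)
  surj' : ∀ a → InSkew la (bump mu r) a → ∃ λ i → lookup T i ≡ a
  surj' (r' , c') (p , q) with surj (r' , c') (≤-trans (part≤part-bump mu r r') p , q)
  ... | suc i , e = i , e
  ... | zero , refl = contradiction (subst (_≤ c) (trans (part-bump-≡ mu r) (cong suc (sym c≡))) p) 1+n≰n
  rowi' : ∀ i j → proj₁ (lookup T i) ≡ proj₁ (lookup T j) → proj₂ (lookup T i) < proj₂ (lookup T j) → i F.< j
  rowi' i j e l = ≤-pred (rowi (suc i) (suc j) e l)
  coli' : ∀ i j → proj₂ (lookup T i) ≡ proj₂ (lookup T j) → proj₁ (lookup T i) < proj₁ (lookup T j) → i F.< j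
  coli' i j e l = ≤-pred (coli (suc i) (suc j) e l)

path⇒syt : ∀ {n} γ (w : Vec ℕ n) → Decreasing γ → Path γ (toList w) → IsSYT n (ends γ (toList w)) γ (cells γ w)
path⇒syt γ [] dγ p = (λ ()) , (λ ()) , (λ { (r , c) (a , b) → contradiction b (≤⇒≯ a) }) , (λ ()) , (λ ())
path⇒syt {suc n} γ (r ∷ w) dγ (a ∷ p) = inn' , inj' , surj' , rowi' , coli'
  where
  la = ends (bump γ r) (toList w)
  T = cells (bump γ r) w
  ih = path⇒syt (bump γ r) w (bump-decreasing dγ a) p
  inn = proj₁ ih
  inj = proj₁ (proj₂ ih)
  surj = proj₁ (proj₂ (proj₂ ih))
  rowi = proj₁ (proj₂ (proj₂ (proj₂ ih)))
  coli = proj₂ (proj₂ (proj₂ (proj₂ ih)))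
  beyond : ∀ {r' c'} → r' ≡ r → part (bump γ r) r' ≤ c' → suc (part γ r) ≤ c'
  beyond {c' = c'} refl q = subst (_≤ c') (part-bump-≡ γ r) q
  inn' : ∀ i → InSkew la γ (lookup ((r , part γ r) ∷ T) i)
  inn' zero = ≤-refl , ≤-trans (≤-reflexive (sym (part-bump-≡ γ r))) (part≤part-ends (bump γ r) (toList w) r)
  inn' (suc i) = ≤-trans (part≤part-bump γ r _) (proj₁ (inn i)) , proj₂ (inn i)
  inj' : ∀ i j → lookup ((r , part γ r) ∷ T) i ≡ lookup ((r , part γ r) ∷ T) j → i ≡ j
  inj' zero zero e = refl
  inj' zero (suc j) e = contradiction (beyond (cong proj₁ (sym e)) (proj₁ (inn j))) (<⇒≱ (≤-reflexive (cong suc (sym (cong proj₂ e)))))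
  inj' (suc i) zero e = contradiction (beyond (cong proj₁ e) (proj₁ (inn i))) (<⇒≱ (≤-reflexive (cong suc (cong proj₂ e))))
  inj' (suc i) (suc j) e = cong suc (inj i j e)
  surj' : ∀ x → InSkew la γ x → ∃ λ i → lookup ((r , part γ r) ∷ T) i ≡ x
  surj' (r' , c') (q , q') with r ≟ r'
  ... | no n = let (i , e) = surj (r' , c') (subst (_≤ c') (sym (part-bump-≢ γ n)) q , q') in suc i , e
  ... | yes refl with part γ r ≟ c'
  ... | yes refl = zero , refl
  ... | no n = let (i , e) = surj (r , c') (subst (_≤ c') (sym (part-bump-≡ γ r)) (≤∧≢⇒< q n) , q') in suc i , e
  rowi' : ∀ i j → proj₁ (lookup ((r , part γ r) ∷ T) i) ≡ proj₁ (lookup ((r , part γ r) ∷ T) j) →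
          proj₂ (lookup ((r , part γ r) ∷ T) i) < proj₂ (lookup ((r , part γ r) ∷ T) j) → i F.< j
  rowi' zero zero e l = contradiction l (<-irrefl refl)
  rowi' zero (suc j) e l = s≤s z≤n
  rowi' (suc i) zero e l = contradiction (beyond e (proj₁ (inn i))) (<⇒≱ (m<n⇒m<1+n l))
  rowi' (suc i) (suc j) e l = s≤s (rowi i j e l)
  coli' : ∀ i j → proj₂ (lookup ((r , part γ r) ∷ T) i) ≡ proj₂ (lookup ((r , part γ r) ∷ T) j) →
          proj₁ (lookup ((r , part γ r) ∷ T) i) < proj₁ (lookup ((r , part γ r) ∷ T) j) → i F.< j
  coli' zero zero e l = contradiction l (<-irrefl refl)
  coli' zero (suc j) e l = s≤s z≤n
  coli' (suc i) zero e l = ⊥-elim (above a l)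
    where
    above : Addable γ r → ¬ (proj₁ (lookup T i) < r)
    above (suc {r = r₀} q) (s≤s l') =
      <⇒≱ q (≤-trans (part-mono dγ l') (≤-trans (part≤part-bump γ r _) (≤-trans (proj₁ (inn i)) (≤-reflexive e))))
  coli' (suc i) (suc j) e l = s≤s (coli i j e l)

-- Standardisation of semistandard tableaux

nth : List ℕ → ℕ → Maybe ℕ
nth [] k = nothing
nth (x ∷ xs) zero = just x
nth (x ∷ xs) (suc k) = nth xs k

-- The auxiliary function local to entry cannot be named; it is recovered by unification.
mutual
  entryNth : List ℕ → List (List ℕ) → ℕ → List ℕ → ℕ → Maybe ℕ
  entryNth = _

  entry-suc : ∀ x xs rows c → entry ((x ∷ xs) ∷ rows) zero (suc c) ≡ entryNth (x ∷ xs) rows (suc c) xs c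
  entry-suc x xs rows c with x ∷ xs | suc c
  ... | p | q = refl

entryNth-nth : ∀ p rows q xs c → entryNth p rows q xs c ≡ nth xs c
entryNth-nth p rows q [] c = refl
entryNth-nth p rows q (x ∷ xs) zero = refl
entryNth-nth p rows q (x ∷ xs) (suc c) = entryNth-nth p rows q xs c

rowAt : List (List ℕ) → ℕ → List ℕ
rowAt [] k = []
rowAt (row ∷ T) zero = row
rowAt (row ∷ T) (suc k) = rowAt T k

entry-nth : ∀ T r c → entry T r c ≡ nth (rowAt T r) c
entry-nth [] r c = refl
entry-nth ([] ∷ T) zero c = refl
entry-nth ((x ∷ xs) ∷ T) zero zero = refl
entry-nth ((x ∷ xs) ∷ T) zero (suc c) = trans (entry-suc x xs T c) (entryNth-nth (x ∷ xs) T (suc c) xs c)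
entry-nth (row ∷ T) (suc r) c = entry-nth T r c

nth-∈ : ∀ xs i {a} → nth xs i ≡ just a → a ∈ xs
nth-∈ (x ∷ xs) zero refl = here refl
nth-∈ (x ∷ xs) (suc i) e = there (nth-∈ xs i e)

rowAt-∈ : ∀ T k {a} → a ∈ rowAt T k → a ∈ concat T
rowAt-∈ (row ∷ T) zero m = ∈-++⁺ˡ m
rowAt-∈ (row ∷ T) (suc k) m = ∈-++⁺ʳ row (rowAt-∈ T k m)

∈-rowAt : ∀ T {a} → a ∈ concat T → ∃ λ k → a ∈ rowAt T k
∈-rowAt (row ∷ T) m with ∈-++⁻ row m
... | inj₁ m' = zero , m'
... | inj₂ m' = let (k , m'') = ∈-rowAt T m' in suc k , m''

rowAt-nonempty : ∀ T k → 0 < length (rowAt T k) → k < length T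
rowAt-nonempty (row ∷ T) zero p = s≤s z≤n
rowAt-nonempty (row ∷ T) (suc k) p = s≤s (rowAt-nonempty T k p)

consAt : ℕ → ℕ → List (List ℕ) → List (List ℕ)
consAt k x [] = []
consAt zero x (row ∷ T) = (x ∷ row) ∷ T
consAt (suc k) x (row ∷ T) = row ∷ consAt k x T

consAt-length : ∀ k x T → length (consAt k x T) ≡ length T
consAt-length k x [] = refl
consAt-length zero x (row ∷ T) = refl
consAt-length (suc k) x (row ∷ T) = cong suc (consAt-length k x T)

rowAt-consAt-≡ : ∀ {k x} T → k < length T → rowAt (consAt k x T) k ≡ x ∷ rowAt T k
rowAt-consAt-≡ {zero} (row ∷ T) p = refl
rowAt-consAt-≡ {suc k} (row ∷ T) (s≤s p) = rowAt-consAt-≡ T p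

rowAt-consAt-≢ : ∀ {k x} T {j} → k ≢ j → rowAt (consAt k x T) j ≡ rowAt T j
rowAt-consAt-≢ [] n = refl
rowAt-consAt-≢ {zero} (row ∷ T) {zero} n = contradiction refl n
rowAt-consAt-≢ {zero} (row ∷ T) {suc j} n = refl
rowAt-consAt-≢ {suc k} (row ∷ T) {zero} n = refl
rowAt-consAt-≢ {suc k} (row ∷ T) {suc j} n = rowAt-consAt-≢ T (λ e → n (cong suc e))

concat-consAt : ∀ {k x} T → k < length T → concat (consAt k x T) ↭ x ∷ concat T
concat-consAt {zero} (row ∷ T) p = ↭-refl
concat-consAt {suc k} {x} (row ∷ T) (s≤s p) =
  ↭-trans (Perm.++⁺ˡ row (concat-consAt T p)) (Perm.shift x row (concat T))

consAt-injective : ∀ {k x} T T' → consAt k x T ≡ consAt k x T' → T ≡ T'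
consAt-injective [] [] e = refl
consAt-injective {zero} [] (row ∷ T') ()
consAt-injective {suc k} [] (row ∷ T') ()
consAt-injective {zero} (row ∷ T) (row' ∷ T') refl = refl
consAt-injective {suc k} (row ∷ T) (row' ∷ T') e =
  cong₂ _∷_ (∷-injectiveˡ e) (consAt-injective T T' (∷-injectiveʳ e))
consAt-injective {zero} (row ∷ T) [] ()
consAt-injective {suc k} (row ∷ T) [] ()

uncons-row : ∀ T k {x} → nth (rowAt T k) 0 ≡ just x → ∃ λ T' → T ≡ consAt k x T' × k < length T'
uncons-row ((y ∷ row) ∷ T) zero refl = row ∷ T , refl , s≤s z≤n
uncons-row (row ∷ T) (suc k) e =
  let (T' , p , q) = uncons-row T k e in row ∷ T' , cong (row ∷_) p , s≤s q

-- Equal entries are numbered from left to right, hence from bottom to top. The first of the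
-- smallest entries is thus in the lowest row that begins with it, and this makes the choice of `k`
-- forced.
HeadMax : List (List ℕ) → ℕ → ℕ → Set
HeadMax T x k = ∀ j → nth (rowAt T j) 0 ≡ just x → j ≤ k

findMax : ∀ T x → (∃ λ k → nth (rowAt T k) 0 ≡ just x × HeadMax T x k) ⊎ (∀ j → nth (rowAt T j) 0 ≢ just x)
findMax [] x = inj₂ (λ j ())
findMax (row ∷ T) x with findMax T x
... | inj₁ (k , e , m) = inj₁ (suc k , e , λ { zero _ → z≤n ; (suc j) p → s≤s (m j p) })
... | inj₂ n with nth row 0 in eq
... | nothing = inj₂ λ { zero p → contradiction (trans (sym eq) p) (λ ()) ; (suc j) p → n j p }
... | just y with y ≟ x
... | yes refl = inj₁ (zero , eq , λ { zero _ → z≤n ; (suc j) p → contradiction p (n j) })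
... | no y≢ = inj₂ λ { zero p → y≢ (just-injective (trans (sym eq) p)) ; (suc j) p → n j p }

-- Rows of `T` list only the skew cells, so row `k` begins in column `part mu k`, and `columns`
-- compares positions after this offset. The skew form is needed because peeling off the smallest
-- entry enlarges `mu`.
record SkewFill (mu la w : List ℕ) (T : List (List ℕ)) : Set where
  constructor skewFill
  field
    row-count : length T ≡ length la
    row-lengths : ∀ k → part mu k + length (rowAt T k) ≡ part la k
    sorted : ∀ k → AllPairs _≤_ (rowAt T k)
    columns : ∀ k i j a b → part mu k + i ≡ part mu (suc k) + j →
              nth (rowAt T k) i ≡ just a → nth (rowAt T (suc k)) j ≡ just b → a < b
    content : concat T ↭ w

open SkewFill

-- The content may stay constant only where the row word has no descent.
data Compatible : List ℕ → List ℕ → Set where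
  [] : Compatible [] []
  [-] : ∀ {k x} → Compatible (k ∷ []) (x ∷ [])
  _∷_ : ∀ {k k' r x x' w} → x < x' ⊎ k' ≤ k → Compatible (k' ∷ r) (x' ∷ w) → Compatible (k ∷ k' ∷ r) (x ∷ x' ∷ w)

fill : ℕ → List ℕ → List ℕ → List (List ℕ)
fill ℓ (k ∷ r) (x ∷ w) = consAt k x (fill ℓ r w)
fill ℓ _ _ = replicate ℓ []

shift : ℕ → ℕ → ℕ → ℕ
shift k r i with k ≟ r
... | yes _ = suc i
... | no _ = i

nth-shift : ∀ k x T → k < length T → ∀ r i → nth (rowAt (consAt k x T) r) (shift k r i) ≡ nth (rowAt T r) i
nth-shift k x T k< r i with k ≟ r
... | yes refl = cong (λ z → nth z (suc i)) (rowAt-consAt-≡ T k<)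
... | no n = cong (λ z → nth z i) (rowAt-consAt-≢ T n)

part-shift : ∀ k mu r i → part mu r + shift k r i ≡ part (bump mu k) r + i
part-shift k mu r i with k ≟ r
... | yes refl = trans (+-suc (part mu k) i) (cong (_+ i) (sym (part-bump-≡ mu k)))
... | no n = cong (_+ i) (sym (part-bump-≢ mu n))

head-exists : ∀ (xs : List ℕ) → 0 < length xs → ∃ λ a → nth xs 0 ≡ just a
head-exists (x ∷ xs) p = x , refl

unfill-step : ∀ {mu la w k x T} → IsShape mu → IsShape la → All (x ≤_) w → k < length T →
              SkewFill mu la (x ∷ w) (consAt k x T) → Addable mu k × SkewFill (bump mu k) la w T
unfill-step {mu} {la} {w} {k} {x} {T} sm sl x≤ k< sf = add k refl , skewFill
  (trans (sym (consAt-length k x T)) (row-count sf)) lens sort cols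
  (Perm.drop-∷ (↭-trans (↭-sym (concat-consAt T k<)) (content sf)))
  where
  T⁺ = consAt k x T
  rowk : rowAt T⁺ k ≡ x ∷ rowAt T k
  rowk = rowAt-consAt-≡ T k<
  x≤∈ : ∀ {a} → a ∈ concat T⁺ → x ≤ a
  x≤∈ m with Perm.∈-resp-↭ (content sf) m
  ... | here refl = ≤-refl
  ... | there m' = All.lookup x≤ m'
  add : ∀ z → z ≡ k → Addable mu z
  add zero e = zero
  add (suc z) refl with part mu (suc z) <? part mu z
  ... | yes p = suc p
  -- If `mu` had no room for a cell in this row, `x` would have an entry above it in its column,
  -- smaller than the minimum of the content.
  ... | no ¬p =
    let le = ≮⇒≥ ¬p
        eq : part mu z ≡ part mu (suc z)
        eq = ≤-antisym le (descent (shape-decreasing sm) z)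
        len : part mu (suc z) < part la (suc z)
        len = subst (part mu (suc z) <_) (trans (cong (λ u → part mu (suc z) + length u) (sym rowk)) (row-lengths sf (suc z)))
                (m<m+n (part mu (suc z)) (s≤s z≤n))
        pos : 0 < length (rowAt T⁺ z)
        pos = +-cancelˡ-< (part mu z) 0 _ (subst₂ _<_ (sym (+-identityʳ _)) (sym (row-lengths sf z))
                (≤-trans (s≤s le) (≤-trans len (descent (shape-decreasing sl) z))))
        (a , ea) = head-exists (rowAt T⁺ z) pos
        a<x = columns sf z 0 0 a x (cong (_+ 0) eq) ea (cong (λ u → nth u 0) rowk)
    in contradiction a<x (≤⇒≯ (x≤∈ (rowAt-∈ T⁺ z (nth-∈ (rowAt T⁺ z) 0 ea))))
  lens : ∀ j → part (bump mu k) j + length (rowAt T j) ≡ part la j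
  lens j with k ≟ j
  ... | yes refl = trans (cong (_+ length (rowAt T k)) (part-bump-≡ mu k))
                     (trans (sym (+-suc (part mu k) _)) (trans (cong (λ u → part mu k + length u) (sym rowk)) (row-lengths sf k)))
  ... | no n = trans (cong (_+ length (rowAt T j)) (part-bump-≢ mu n))
                 (trans (cong (λ u → part mu j + length u) (sym (rowAt-consAt-≢ T n))) (row-lengths sf j))
  sort : ∀ j → AllPairs _≤_ (rowAt T j)
  sort j with k ≟ j
  ... | no n = subst (AllPairs _≤_) (rowAt-consAt-≢ T n) (sorted sf j)
  ... | yes refl with subst (AllPairs _≤_) rowk (sorted sf k)
  ... | _ ∷ s = s
  cols : ∀ r i j a b → part (bump mu k) r + i ≡ part (bump mu k) (suc r) + j →
         nth (rowAt T r) i ≡ just a → nth (rowAt T (suc r)) j ≡ just b → a < b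
  cols r i j a b e ea eb = columns sf r (shift k r i) (shift k (suc r) j) a b
    (trans (part-shift k mu r i) (trans e (sym (part-shift k mu (suc r) j))))
    (trans (nth-shift k x T k< r i) ea) (trans (nth-shift k x T k< (suc r) j) eb)

fill-step : ∀ {mu la w k x T} → Addable mu k → All (x ≤_) w → HeadMax T x k →
            SkewFill (bump mu k) la w T → SkewFill mu la (x ∷ w) (consAt k x T) × HeadMax (consAt k x T) x k × k < length T
fill-step {mu} {la} {w} {k} {x} {T} ak x≤ hm sf = skewFill
  (trans (consAt-length k x T) (row-count sf)) lens sort cols
  (↭-trans (concat-consAt T k<) (prep x (content sf))) , hm' , k<
  where
  k< : k < length T
  k< = subst (k <_) (sym (row-count sf)) (part-positive⇒< la (≤-trans (s≤s z≤n)
         (≤-trans (≤-reflexive (sym (part-bump-≡ mu k))) (≤-trans (m≤m+n _ _) (≤-reflexive (row-lengths sf k))))))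
  T⁺ = consAt k x T
  rowk : rowAt T⁺ k ≡ x ∷ rowAt T k
  rowk = rowAt-consAt-≡ T k<
  x≤∈ : ∀ r {a} → a ∈ rowAt T r → x ≤ a
  x≤∈ r m = All.lookup x≤ (Perm.∈-resp-↭ (content sf) (rowAt-∈ T r m))
  lens : ∀ j → part mu j + length (rowAt T⁺ j) ≡ part la j
  lens j with k ≟ j
  ... | yes refl = trans (cong (λ u → part mu k + length u) rowk)
                     (trans (+-suc (part mu k) _) (trans (cong (_+ length (rowAt T k)) (sym (part-bump-≡ mu k))) (row-lengths sf k)))
  ... | no n = trans (cong (λ u → part mu j + length u) (rowAt-consAt-≢ T n))
                 (trans (cong (_+ length (rowAt T j)) (sym (part-bump-≢ mu n))) (row-lengths sf j))
  sort : ∀ j → AllPairs _≤_ (rowAt T⁺ j)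
  sort j with k ≟ j
  ... | no n = subst (AllPairs _≤_) (sym (rowAt-consAt-≢ T n)) (sorted sf j)
  ... | yes refl = subst (AllPairs _≤_) (sym rowk) (All.tabulate (x≤∈ k) ∷ sorted sf k)
  origin : ∀ r i {a} → nth (rowAt T⁺ r) i ≡ just a →
          (r ≡ k × i ≡ 0 × a ≡ x) ⊎ ∃ λ i' → i ≡ shift k r i' × nth (rowAt T r) i' ≡ just a
  origin r i e with k ≟ r
  ... | no n = inj₂ (i , refl , trans (cong (λ u → nth u i) (sym (rowAt-consAt-≢ T n))) e)
  origin r zero e | yes refl = inj₁ (refl , refl , just-injective (trans (sym e) (cong (λ u → nth u 0) rowk)))
  origin r (suc i) e | yes refl = inj₂ (i , refl , trans (cong (λ u → nth u (suc i)) (sym rowk)) e)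
  head-x : ∀ r {b} → b ≡ x → b ∈ rowAt T r → nth (rowAt T r) 0 ≡ just x
  head-x r refl m with rowAt T r | sorted sf r | (λ {a} → x≤∈ r {a})
  head-x r refl (here refl) | y ∷ ys | _ | _ = refl
  head-x r refl (there m) | y ∷ ys | le ∷ _ | g = cong just (≤-antisym (All.lookup le m) (g (here refl)))
  cols : ∀ r i j a b → part mu r + i ≡ part mu (suc r) + j →
         nth (rowAt T⁺ r) i ≡ just a → nth (rowAt T⁺ (suc r)) j ≡ just b → a < b
  cols r i j a b e ea eb with origin r i ea | origin (suc r) j eb
  ... | inj₁ (refl , _ , _) | inj₁ (() , _ , _)
  ... | inj₂ (i' , refl , ea') | inj₂ (j' , refl , eb') =
    columns sf r i' j' a b (trans (sym (part-shift k mu r i')) (trans e (part-shift k mu (suc r) j'))) ea' eb'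
  -- An entry equal to `x` below the new cell would put `x` at the head of the next row, against
  -- `hm`.
  ... | inj₁ (refl , refl , refl) | inj₂ (j' , refl , eb') =
    ≤∧≢⇒< (x≤∈ (suc r) (nth-∈ (rowAt T (suc r)) j' eb'))
      (λ e' → 1+n≰n (hm (suc r) (head-x (suc r) (sym e') (nth-∈ (rowAt T (suc r)) j' eb'))))
  ... | inj₂ (i' , refl , ea') | inj₁ (refl , refl , refl) =
    contradiction (≤-trans (m≤m+n (part mu r) _) (≤-reflexive (trans e (+-identityʳ _)))) (<⇒≱ (addable-suc ak))
  hm' : HeadMax T⁺ x k
  hm' j e with k ≟ j
  ... | yes refl = ≤-refl
  ... | no n = hm j (trans (cong (λ u → nth u 0) (sym (rowAt-consAt-≢ T n))) e)

rowAt-replicate : ∀ ℓ k → rowAt (replicate ℓ []) k ≡ []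
rowAt-replicate zero k = refl
rowAt-replicate (suc ℓ) zero = refl
rowAt-replicate (suc ℓ) (suc k) = rowAt-replicate ℓ k

concat-replicate : ∀ ℓ → concat (replicate ℓ ([] {A = ℕ})) ≡ []
concat-replicate zero = refl
concat-replicate (suc ℓ) = concat-replicate ℓ

fill-sound : ∀ {mu la r w} → Path mu r → ends mu r ≡ la → Compatible r w → AllPairs _≤_ w →
             SkewFill mu la w (fill (length la) r w) ×
             (∀ {k r' x w'} → r ≡ k ∷ r' → w ≡ x ∷ w' → HeadMax (fill (length la) r w) x k × k < length (fill (length la) r' w'))
fill-sound {mu} [] refl [] s = skewFill (length-replicate (length mu))
  (λ k → trans (cong (λ u → part mu k + length u) (rowAt-replicate (length mu) k)) (+-identityʳ _))
  (λ k → subst (AllPairs _≤_) (sym (rowAt-replicate (length mu) k)) [])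
  (λ k i j a b e ea eb → contradiction (trans (sym (cong (λ u → nth u i) (rowAt-replicate (length mu) k))) ea) (λ ()))
  (subst (_↭ []) (sym (concat-replicate (length mu))) ↭-refl) , λ ()
fill-sound {mu} {la} (a ∷ []) e ([-] {k} {x}) (x≤ ∷ s) =
  let (sf , _) = fill-sound [] e [] s
      (sf' , hm , k<) = fill-step a x≤ (λ j p → contradiction (trans (sym (cong (λ u → nth u 0) (rowAt-replicate (length la) j))) p) (λ ())) sf
  in sf' , λ { refl refl → hm , k< }
fill-sound {mu} {la} (a ∷ p) e (_∷_ {k} {k'} {r} {x} {x'} {w} c cs) (x≤ ∷ s) =
  let (sf , f) = fill-sound p e cs s
      (hm₀ , _) = f refl refl
      (sf' , hm , k<) = fill-step a x≤ (max c s sf hm₀) sf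
  in sf' , λ { refl refl → hm , k< }
  where
  T = fill (length la) (k' ∷ r) (x' ∷ w)
  max : x < x' ⊎ k' ≤ k → AllPairs _≤_ (x' ∷ w) → SkewFill (bump mu k) la (x' ∷ w) T → HeadMax T x' k' → HeadMax T x k
  max c (x'≤ ∷ _) sf hm j e with Perm.∈-resp-↭ (content sf) (rowAt-∈ T j (nth-∈ (rowAt T j) 0 e))
  max (inj₁ x<x') (x'≤ ∷ _) sf hm j e | here refl = contradiction x<x' (<-irrefl refl)
  max (inj₁ x<x') (x'≤ ∷ _) sf hm j e | there m = contradiction x<x' (≤⇒≯ (All.lookup x'≤ m))
  max (inj₂ k'≤k) (x'≤ ∷ _) sf hm j e | here q = ≤-trans (hm j (trans e (cong just q))) k'≤k
  max (inj₂ k'≤k) (x'≤ ∷ _) sf hm j e | there m =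
    ≤-trans (hm j (trans e (cong just (≤-antisym (All.head x≤) (All.lookup x'≤ m))))) k'≤k

fill-injective : ∀ {mu mu' la r r' w} → Path mu r → ends mu r ≡ la → Compatible r w →
                 Path mu' r' → ends mu' r' ≡ la → Compatible r' w → AllPairs _≤_ w →
                 fill (length la) r w ≡ fill (length la) r' w → r ≡ r'
fill-injective [] e [] [] e' [] s q = refl
fill-injective {la = la} {r = k ∷ r} {k' ∷ r'} {x ∷ w} P@(_ ∷ p) e c P'@(_ ∷ p') e' c' S@(_ ∷ s) q =
  finish (≤-antisym (hm' k head-k) (hm k' head-k')) q
  where
  hm = proj₁ (proj₂ (fill-sound P e c S) refl refl)
  k< = proj₂ (proj₂ (fill-sound P e c S) refl refl)
  hm' = proj₁ (proj₂ (fill-sound P' e' c' S) refl refl)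
  k'< = proj₂ (proj₂ (fill-sound P' e' c' S) refl refl)
  head-k : nth (rowAt (fill (length la) (k' ∷ r') (x ∷ w)) k) 0 ≡ just x
  head-k = subst (λ z → nth (rowAt z k) 0 ≡ just x) q (cong (λ u → nth u 0) (rowAt-consAt-≡ (fill (length la) r w) k<))
  head-k' : nth (rowAt (fill (length la) (k ∷ r) (x ∷ w)) k') 0 ≡ just x
  head-k' = subst (λ z → nth (rowAt z k') 0 ≡ just x) (sym q) (cong (λ u → nth u 0) (rowAt-consAt-≡ (fill (length la) r' w) k'<))
  tail-c : ∀ {k r x w} → Compatible (k ∷ r) (x ∷ w) → Compatible r w
  tail-c [-] = []
  tail-c (_ ∷ c) = c
  finish : k ≡ k' → fill (length la) (k ∷ r) (x ∷ w) ≡ fill (length la) (k' ∷ r') (x ∷ w) → k ∷ r ≡ k' ∷ r'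
  finish refl q = cong (k ∷_) (fill-injective p e (tail-c c) p' e' (tail-c c') s
                    (consAt-injective (fill (length la) r w) (fill (length la) r' w) q))

fill-complete : ∀ {mu la} w T → IsShape mu → IsShape la → AllPairs _≤_ w → SkewFill mu la w T →
                ∃ λ r → Path mu r × ends mu r ≡ la × Compatible r w × fill (length la) r w ≡ T ×
                        (∀ {k r' x w'} → r ≡ k ∷ r' → w ≡ x ∷ w' → nth (rowAt T k) 0 ≡ just x)
fill-complete {mu} {la} [] T sm sl s sf =
  [] , [] , shape-ext sm sl (λ k → trans (sym (+-identityʳ _)) (trans (cong (λ u → part mu k + length u) (sym (rows-empty k))) (row-lengths sf k)))
     , [] , trans (cong (λ n → replicate n []) (sym (row-count sf))) (sym (all-empty T rows-empty)) , λ ()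
  where
  rows-empty : ∀ k → rowAt T k ≡ []
  rows-empty k with rowAt T k | (λ {a} → rowAt-∈ T k {a})
  ... | [] | _ = refl
  ... | a ∷ _ | f with Perm.∈-resp-↭ (content sf) (f (here refl))
  ... | ()
  all-empty : ∀ T → (∀ k → rowAt T k ≡ []) → T ≡ replicate (length T) []
  all-empty [] f = refl
  all-empty (row ∷ T) f = cong₂ _∷_ (f 0) (all-empty T (λ k → f (suc k)))
fill-complete {mu} {la} (x ∷ w) T sm sl (x≤ ∷ s) sf with findMax T x
... | inj₂ none = ⊥-elim (let (j , m) = ∈-rowAt T (Perm.∈-resp-↭ (↭-sym (content sf)) (here refl)) in none j (head-x j m))
  where
  head-x : ∀ j → x ∈ rowAt T j → nth (rowAt T j) 0 ≡ just x
  head-x j m with rowAt T j | sorted sf j | (λ {a} m → rowAt-∈ T j {a} m)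
  head-x j (here refl) | y ∷ ys | _ | _ = refl
  head-x j (there m) | y ∷ ys | le ∷ _ | f with Perm.∈-resp-↭ (content sf) (f (here refl))
  ... | here refl = refl
  ... | there m' = cong just (≤-antisym (All.lookup le m) (All.lookup x≤ m'))
... | inj₁ (k , ek , hm) with uncons-row T k ek
... | T' , refl , k< with unfill-step sm sl x≤ k< sf
... | ak , sf' with fill-complete w T' (bump-shape sm ak) sl s sf'
... | r , p , e , c , q , hd = k ∷ r , ak ∷ p , e , compat r w c hd , cong (consAt k x) q , λ { refl refl → ek }
  where
  compat : ∀ r w → Compatible r w → (∀ {k' r' x' w'} → r ≡ k' ∷ r' → w ≡ x' ∷ w' → nth (rowAt T' k') 0 ≡ just x') →
           Compatible (k ∷ r) (x ∷ w)
  compat [] [] [] hd = [-]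
  compat (k' ∷ r) (x' ∷ w) c hd = lt ∷ c
    where
    lt : x < x' ⊎ k' ≤ k
    lt with k ≟ k'
    ... | yes refl = inj₂ ≤-refl
    ... | no n with x ≟ x'
    ... | yes refl = inj₂ (hm k' (trans (cong (λ u → nth u 0) (rowAt-consAt-≢ T' n)) (hd refl refl)))
    ... | no n' = inj₁ (≤∧≢⇒< (x≤∈ (rowAt-∈ T' k' (nth-∈ (rowAt T' k') 0 (hd refl refl)))) n')
      where
      x≤∈ : ∀ {a} → a ∈ concat T' → x ≤ a
      x≤∈ m = All.lookup x≤ (Perm.∈-resp-↭ (content sf') m)

adjacent⇒AllPairs : ∀ xs → (∀ c a b → nth xs c ≡ just a → nth xs (suc c) ≡ just b → a ≤ b) → AllPairs _≤_ xs
adjacent⇒AllPairs [] f = []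
adjacent⇒AllPairs (x ∷ []) f = [] ∷ []
adjacent⇒AllPairs (x ∷ y ∷ xs) f with adjacent⇒AllPairs (y ∷ xs) (λ c → f (suc c))
... | y≤ ∷ s = (f 0 x y refl refl ∷ All.map (≤-trans (f 0 x y refl refl)) y≤) ∷ (y≤ ∷ s)

AllPairs⇒adjacent : ∀ {xs} → AllPairs _≤_ xs → ∀ c a b → nth xs c ≡ just a → nth xs (suc c) ≡ just b → a ≤ b
AllPairs⇒adjacent (le ∷ s) zero a b refl eb = All.lookup le (nth-∈ _ 0 eb)
AllPairs⇒adjacent (le ∷ s) (suc c) a b ea eb = AllPairs⇒adjacent s c a b ea eb

ssyt⇒skewFill : ∀ {la n} {w : Vec ℕ n} {T} → IsSSYT la w T → SkewFill [] la (toList w) T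
ssyt⇒skewFill {T = T} (refl , rows , cols , perm) = skewFill (sym (length-map′ T)) (lens T)
  (λ k → adjacent⇒AllPairs (rowAt T k) (λ c a b ea eb → rows k c a b (trans (entry-nth T k c) ea) (trans (entry-nth T k (suc c)) eb)))
  (λ { k i .i a b refl ea eb → cols k i a b (trans (entry-nth T k i) ea) (trans (entry-nth T (suc k) i) eb) })
  perm
  where
  length-map′ : ∀ (T : List (List ℕ)) → length (map length T) ≡ length T
  length-map′ [] = refl
  length-map′ (row ∷ T) = cong suc (length-map′ T)
  lens : ∀ T k → length (rowAt T k) ≡ part (map length T) k
  lens [] k = refl
  lens (row ∷ T) zero = refl
  lens (row ∷ T) (suc k) = lens T k

skewFill⇒ssyt : ∀ {la n} {w : Vec ℕ n} {T} → SkewFill [] la (toList w) T → IsSSYT la w T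
skewFill⇒ssyt {la} {T = T} sf = lens T la (row-count sf) (row-lengths sf) ,
  (λ r c a b ea eb → AllPairs⇒adjacent (sorted sf r) c a b (trans (sym (entry-nth T r c)) ea) (trans (sym (entry-nth T r (suc c))) eb)) ,
  (λ r c a b ea eb → columns sf r c c a b refl (trans (sym (entry-nth T r c)) ea) (trans (sym (entry-nth T (suc r) c)) eb)) ,
  content sf
  where
  lens : ∀ T la → length T ≡ length la → (∀ k → length (rowAt T k) ≡ part la k) → map length T ≡ la
  lens [] [] e f = refl
  lens (row ∷ T) (x ∷ la) e f = cong₂ _∷_ (f 0) (lens T la (suc-injective e) (λ k → f (suc k)))

increasing⇒AllPairs : ∀ {n} (w : Vec ℕ n) → WeaklyIncreasing w → AllPairs _≤_ (toList w)
increasing⇒AllPairs [] f = []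
increasing⇒AllPairs (x ∷ w) f = heads w (λ i → f zero (suc i) z≤n) ∷ increasing⇒AllPairs w (λ i j i≤j → f (suc i) (suc j) (s≤s i≤j))
  where
  heads : ∀ {n} (w : Vec ℕ n) → (∀ i → x ≤ lookup w i) → All (x ≤_) (toList w)
  heads [] g = []
  heads (y ∷ w) g = g zero ∷ heads w (λ i → g (suc i))

-- Finite types and additive counters

infixr 5 _⨾_
_⨾_ : ∀ {X Y Z : Set} → X ↔ Y → Y ↔ Z → X ↔ Z
f ⨾ g = g ↔-∘ f

lookup-injective : ∀ {A : Set} {xs : List A} → Unique xs → ∀ i j → List.lookup xs i ≡ List.lookup xs j → i ≡ j
lookup-injective (x∉ ∷ u) zero zero e = refl
lookup-injective {xs = x ∷ xs} (x∉ ∷ u) zero (suc j) e = contradiction e (All.lookup x∉ (∈-lookup {xs = xs} j))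
lookup-injective {xs = x ∷ xs} (x∉ ∷ u) (suc i) zero e = contradiction (sym e) (All.lookup x∉ (∈-lookup {xs = xs} i))
lookup-injective (x∉ ∷ u) (suc i) (suc j) e = cong suc (lookup-injective u i j e)

-- The evidence inside a `Refinement` is irrelevant, so the index cannot be computed from it. It is
-- found by searching the list of elements, and `recompute` restores the success of this decidable
-- search.
refine-↔ : ∀ {A V : Set} {Q : A → Set} {P : V → Set} (q : FinPred Q) → (∀ (u v : V) → Dec (u ≡ v)) →
           (g : A → V) → (∀ a → Q a → P (g a)) → (∀ {a a'} → Q a → Q a' → g a ≡ g a' → a ≡ a') →
           (∀ v → P v → ∃ λ a → Q a × g a ≡ v) → Refinement V P ↔ Fin (card q)
refine-↔ {A} {V} {Q} {P} q _≟V_ g sound inj surj = mk↔ₛ′ to from to-from from-to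
  where
  es = elements q
  found : ∀ v → P v → Any (λ a → g a ≡ v) es
  found v p = let (a , Qa , e) = surj v p in lose (∈-elements⁺ q Qa) e
  search : ∀ v → .(P v) → Any (λ a → g a ≡ v) es
  search v p = recompute (any? (λ a → g a ≟V v) es) (found v p)
  to : Refinement V P → Fin (card q)
  to (v , [ p ]) = index (search v p)
  from : Fin (card q) → Refinement V P
  from i = g (List.lookup es i) , [ sound _ (∈-elements⁻ q (∈-lookup i)) ]
  to-from : ∀ i → to (from i) ≡ i
  to-from i = lookup-injective (elements-unique q) _ _
    (inj (∈-elements⁻ q (∈-lookup _)) (∈-elements⁻ q (∈-lookup i)) (lookup-index (search (g (List.lookup es i)) (sound _ (∈-elements⁻ q (∈-lookup i))))))
  eq : ∀ {v v' : V} .{p : P v} .{p' : P v'} → v ≡ v' → _≡_ {A = Refinement V P} (v , [ p ]) (v' , [ p' ])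
  eq refl = refl
  from-to : ∀ z → from (to z) ≡ z
  from-to (v , [ p ]) = eq (lookup-index (search v p))

sumBy : ∀ {A : Set} → (A → ℕ) → List A → ℕ
sumBy f [] = 0
sumBy f (x ∷ xs) = f x + sumBy f xs

Σ-list-↔ : ∀ {I A : Set} {Z : A → Set} (c : I → ℕ) {items : List I} {L : List A} →
           Pointwise (λ i a → Z a ↔ Fin (c i)) items L →
           Σ (Fin (length L)) (λ k → Z (List.lookup L k)) ↔ Fin (sumBy c items)
Σ-list-↔ c [] = mk↔ₛ′ (λ ()) (λ ()) (λ ()) (λ ())
Σ-list-↔ {Z = Z} c {i ∷ items} {a ∷ L} (e ∷ es) = split ⨾ add ⨾ ↔-sym (+↔⊎ {m = c i} {n = sumBy c items})
  where
  rec = Σ-list-↔ {Z = Z} c es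
  S = Σ (Fin (length L)) (λ k → Z (List.lookup L k))
  split : Σ (Fin (suc (length L))) (λ k → Z (List.lookup (a ∷ L) k)) ↔ (Z a ⊎ S)
  split = mk↔ₛ′ (λ { (zero , z) → inj₁ z ; (suc k , z) → inj₂ (k , z) })
                (λ { (inj₁ z) → zero , z ; (inj₂ (k , z)) → suc k , z })
                (λ { (inj₁ z) → refl ; (inj₂ (k , z)) → refl })
                (λ { (zero , z) → refl ; (suc k , z) → refl })
  add : (Z a ⊎ S) ↔ (Fin (c i) ⊎ Fin (sumBy c items))
  add = mk↔ₛ′ (λ { (inj₁ z) → inj₁ (Inverse.to e z) ; (inj₂ s) → inj₂ (Inverse.to rec s) })
              (λ { (inj₁ z) → inj₁ (Inverse.from e z) ; (inj₂ s) → inj₂ (Inverse.from rec s) })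
              (λ { (inj₁ z) → cong inj₁ (Inverse.strictlyInverseˡ e z) ; (inj₂ s) → cong inj₂ (Inverse.strictlyInverseˡ rec s) })
              (λ { (inj₁ z) → cong inj₁ (Inverse.strictlyInverseʳ e z) ; (inj₂ s) → cong inj₂ (Inverse.strictlyInverseʳ rec s) })

↔-card : ∀ {X Y : Set} {m n} → X ↔ Y → X ↔ Fin m → Y ↔ Fin n → m ≡ n
↔-card f g h = ↔⇒≡ (↔-sym g ⨾ f ⨾ h)

-- Möbius inversion on Boolean strings, for additive set functions.
data Pat : Set where
  exact : Bool → Pat
  any : Pat

data Match : List Pat → List Bool → Set where
  [] : Match [] []
  exact : ∀ {b ps u} → Match ps u → Match (exact b ∷ ps) (b ∷ u)
  any : ∀ {b ps u} → Match ps u → Match (any ∷ ps) (b ∷ u)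

match? : ∀ ps u → Dec (Match ps u)
match? [] [] = yes []
match? [] (b ∷ u) = no λ ()
match? (p ∷ ps) [] = no λ ()
match? (any ∷ ps) (b ∷ u) = map′ any (λ { (any m) → m }) (match? ps u)
match? (exact b' ∷ ps) (b ∷ u) with b' Bool.≟ b
... | yes refl = map′ exact (λ { (exact m) → m }) (match? ps u)
... | no n = no λ { (exact m) → n refl }

match-any : ∀ a {b u} → Match (a ++ any ∷ b) u → Match (a ++ exact false ∷ b) u ⊎ Match (a ++ exact true ∷ b) u
match-any [] (any {false} m) = inj₁ (exact m)
match-any [] (any {true} m) = inj₂ (exact m)
match-any (exact x ∷ a) (exact m) with match-any a m
... | inj₁ m' = inj₁ (exact m')
... | inj₂ m' = inj₂ (exact m')
match-any (any ∷ a) (any m) with match-any a m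
... | inj₁ m' = inj₁ (any m')
... | inj₂ m' = inj₂ (any m')

match-weaken : ∀ a {b c u} → Match (a ++ exact c ∷ b) u → Match (a ++ any ∷ b) u
match-weaken [] (exact m) = any m
match-weaken (exact x ∷ a) (exact m) = exact (match-weaken a m)
match-weaken (any ∷ a) (any m) = any (match-weaken a m)

match-disjoint : ∀ a {b u} → Match (a ++ exact false ∷ b) u → Match (a ++ exact true ∷ b) u → ⊥
match-disjoint [] (exact m) ()
match-disjoint (exact x ∷ a) (exact m) (exact m') = match-disjoint a m m'
match-disjoint (any ∷ a) (any m) (any m') = match-disjoint a m m'

+-interchange : ∀ a b c d → (a + b) + (c + d) ≡ (a + c) + (b + d)
+-interchange a b c d = begin
  (a + b) + (c + d) ≡⟨ +-assoc a b (c + d) ⟩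
  a + (b + (c + d)) ≡⟨ cong (a +_) (sym (+-assoc b c d)) ⟩
  a + ((b + c) + d) ≡⟨ cong (λ z → a + (z + d)) (+-comm b c) ⟩
  a + ((c + b) + d) ≡⟨ cong (a +_) (+-assoc c b d) ⟩
  a + (c + (b + d)) ≡⟨ sym (+-assoc a c (b + d)) ⟩
  (a + c) + (b + d) ∎
  where open ≡-Reasoning

-- A count takes a decision procedure, as cardinalities are lengths of filtered lists. Additivity
-- alone already implies that equivalent predicates, however decided, have the same count.
record Counter : Set₁ where
  field
    cnt : {Φ : List Bool → Set} → (∀ s → Dec (Φ s)) → ℕ
    cnt-⊎ : ∀ {Φ Ψ Ω : List Bool → Set} (u : ∀ s → Dec (Φ s)) (p : ∀ s → Dec (Ψ s)) (q : ∀ s → Dec (Ω s)) →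
            (∀ s → Φ s → Ψ s ⊎ Ω s) → (∀ s → Ψ s → Φ s) → (∀ s → Ω s → Φ s) → (∀ s → Ψ s → Ω s → ⊥) →
            cnt u ≡ cnt p + cnt q

  cnt-empty : ∀ {Φ : List Bool → Set} (u : ∀ s → Dec (Φ s)) → (∀ s → ¬ Φ s) → cnt u ≡ 0
  cnt-empty u n = m+n≡m⇒n≡0 (sym (cnt-⊎ u u u (λ s p → inj₁ p) (λ s p → p) (λ s p → p) (λ s p _ → n s p)))
    where
    m+n≡m⇒n≡0 : ∀ {m} → m + m ≡ m → m ≡ 0
    m+n≡m⇒n≡0 {m} e = +-cancelˡ-≡ m m 0 (trans e (sym (+-identityʳ m)))

  cnt-cong : ∀ {Φ Ψ : List Bool → Set} (u : ∀ s → Dec (Φ s)) (p : ∀ s → Dec (Ψ s)) →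
             (∀ s → Φ s → Ψ s) → (∀ s → Ψ s → Φ s) → cnt u ≡ cnt p
  cnt-cong u p f g = trans (cnt-⊎ u p ⊥? (λ s q → inj₁ (f s q)) g (λ s ()) (λ s _ ())) 
                       (trans (cong (cnt p +_) (cnt-empty ⊥? (λ s ()))) (+-identityʳ _))
    where
    ⊥? : List Bool → Dec ⊥
    ⊥? _ = no λ ()

open Counter public

sumCounter : ∀ {A : Set} → (A → Counter) → List A → Counter
sumCounter f [] = record { cnt = λ _ → 0 ; cnt-⊎ = λ _ _ _ _ _ _ _ → refl }
sumCounter f (a ∷ L) = record
  { cnt = λ u → cnt (f a) u + cnt (sumCounter f L) u
  ; cnt-⊎ = λ u p q h₁ h₂ h₃ h₄ → trans (cong₂ _+_ (cnt-⊎ (f a) u p q h₁ h₂ h₃ h₄) (cnt-⊎ (sumCounter f L) u p q h₁ h₂ h₃ h₄))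
                                    (+-interchange (cnt (f a) p) (cnt (f a) q) (cnt (sumCounter f L) p) (cnt (sumCounter f L) q)) }

sumCounter-sumBy : ∀ {A : Set} (f : A → Counter) L {Φ : List Bool → Set} (u : ∀ s → Dec (Φ s)) →
                   cnt (sumCounter f L) u ≡ sumBy (λ a → cnt (f a) u) L
sumCounter-sumBy f [] u = refl
sumCounter-sumBy f (a ∷ L) u = cong (cnt (f a) u +_) (sumCounter-sumBy f L u)

upTo-pat : Bool → Pat
upTo-pat false = exact false
upTo-pat true = any

module _ (C D : Counter) (m : ℕ)
         (agree : ∀ s → length s ≡ m → cnt C (match? (map upTo-pat s)) ≡ cnt D (match? (map upTo-pat s))) where

  private
    Agree : List Pat → Set
    Agree ps = cnt C (match? ps) ≡ cnt D (match? ps)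

    agree-true : ∀ a b → Agree (a ++ any ∷ b) → Agree (a ++ exact false ∷ b) → Agree (a ++ exact true ∷ b)
    agree-true a b p q = +-cancelˡ-≡ (cnt C (match? (a ++ exact false ∷ b))) _ _
      (trans (sym (split C)) (trans p (trans (split D) (cong (_+ cnt D (match? (a ++ exact true ∷ b))) (sym q)))))
      where
      split : ∀ E → cnt E (match? (a ++ any ∷ b)) ≡ cnt E (match? (a ++ exact false ∷ b)) + cnt E (match? (a ++ exact true ∷ b))
      split E = cnt-⊎ E _ _ _ (λ _ → match-any a) (λ _ → match-weaken a) (λ _ → match-weaken a) (λ _ → match-disjoint a)

    -- The bits are made exact from left to right, with the exact prefix collected in `a`: a false
    -- bit is exact from the outset, and a true one is `any` minus `exact false`.
    go : ∀ s a k → (∀ t → length t ≡ length s + k → Agree (a ++ map upTo-pat t)) →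
         ∀ t → length t ≡ k → Agree (a ++ (map exact s ++ map upTo-pat t))
    go [] a k h t e = h t e
    go (b ∷ s) a k h t e = subst Agree (++-assoc a (exact b ∷ []) _) (go s (a ∷ʳ exact b) k (step b) t e)
      where
      step : ∀ b t → length t ≡ length s + k → Agree ((a ∷ʳ exact b) ++ map upTo-pat t)
      step false t e = subst Agree (sym (++-assoc a (exact false ∷ []) _)) (h (false ∷ t) (cong suc e))
      step true t e = subst Agree (sym (++-assoc a (exact true ∷ []) _))
                        (agree-true a (map upTo-pat t) (h (true ∷ t) (cong suc e)) (h (false ∷ t) (cong suc e)))

    match-exact : ∀ s {u} → Match (map exact s ++ []) u → u ≡ s
    match-exact [] [] = refl
    match-exact (b ∷ s) (exact m) = cong (b ∷_) (match-exact s m)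

    exact-match : ∀ s → Match (map exact s ++ []) s
    exact-match [] = []
    exact-match (b ∷ s) = exact (exact-match s)

  möbius : ∀ s → length s ≡ m → cnt C (_≟ᴮ s) ≡ cnt D (_≟ᴮ s)
  möbius s e = trans (conv C) (trans (go s [] 0 (λ t e' → agree t (trans e' (trans (+-identityʳ _) e))) [] refl) (sym (conv D)))
    where
    conv : ∀ E → cnt E (_≟ᴮ s) ≡ cnt E (match? (map exact s ++ []))
    conv E = cnt-cong E _ _ (λ { u refl → exact-match s }) (λ u → match-exact s)

tabCounter : List ℕ → Counter
tabCounter la = record
  { cnt = λ u → card (keyR la u)
  ; cnt-⊎ = λ u p q h₁ h₂ h₃ h₄ → card-⊎ (keyR la u) (keyR la p) (keyR la q)
      (λ { T (t , φ) → Sum.map (t ,_) (t ,_) (h₁ _ φ) }) (λ { T (t , φ) → t , h₂ _ φ }) (λ { T (t , φ) → t , h₃ _ φ })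
      (λ { T (_ , φ) (_ , φ') → h₄ _ φ φ' }) }

-- The monomial whose index jumps exactly at the positions of s.
stair : ∀ {m} → ℕ → Vec Bool m → Vec ℕ (suc m)
stair x [] = x ∷ []
stair x (b ∷ s) = x ∷ stair (if b then suc x else x) s

stair-head : ∀ {m} x (s : Vec Bool m) → lookup (stair x s) zero ≡ x
stair-head x [] = refl
stair-head x (b ∷ s) = refl

stair-≥ : ∀ {m} x (s : Vec Bool m) i → x ≤ lookup (stair x s) i
stair-≥ x [] zero = ≤-refl
stair-≥ x (b ∷ s) zero = ≤-refl
stair-≥ x (false ∷ s) (suc i) = stair-≥ x s i
stair-≥ x (true ∷ s) (suc i) = ≤-trans (n≤1+n x) (stair-≥ (suc x) s i)

stair-increasing : ∀ {m} x (s : Vec Bool m) → WeaklyIncreasing (stair x s)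
stair-increasing x [] zero zero p = ≤-refl
stair-increasing x (b ∷ s) zero j p = stair-≥ x (b ∷ s) j
stair-increasing x (b ∷ s) (suc i) (suc j) (s≤s p) = stair-increasing (if b then suc x else x) s i j p

stair-jump : ∀ {m} x (s : Vec Bool m) k → lookup s k ≡ true → lookup (stair x s) (inject₁ k) < lookup (stair x s) (suc k)
stair-jump x (true ∷ s) zero refl = subst (x <_) (sym (stair-head (suc x) s)) ≤-refl
stair-jump x (b ∷ s) (suc k) e = stair-jump (if b then suc x else x) s k e

jump-stair : ∀ {m} x (s : Vec Bool m) k → lookup (stair x s) (inject₁ k) < lookup (stair x s) (suc k) → lookup s k ≡ true
jump-stair x (true ∷ s) zero p = refl
jump-stair x (false ∷ s) zero p = contradiction (subst (x <_) (stair-head x s) p) (<-irrefl refl)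
jump-stair x (b ∷ s) (suc k) p = jump-stair (if b then suc x else x) s k p

match-upTo⁺ : ∀ {m} (s t : Vec Bool m) → (∀ k → lookup t k ≡ true → lookup s k ≡ true) → Match (map upTo-pat (toList s)) (toList t)
match-upTo⁺ [] [] h = []
match-upTo⁺ (true ∷ s) (b ∷ t) h = any (match-upTo⁺ s t (λ k → h (suc k)))
match-upTo⁺ (false ∷ s) (false ∷ t) h = exact (match-upTo⁺ s t (λ k → h (suc k)))
match-upTo⁺ (false ∷ s) (true ∷ t) h = contradiction (h zero refl) λ ()

match-upTo⁻ : ∀ {m} (s t : Vec Bool m) → Match (map upTo-pat (toList s)) (toList t) → ∀ k → lookup t k ≡ true → lookup s k ≡ true
match-upTo⁻ (true ∷ s) (b ∷ t) (any h) zero e = refl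
match-upTo⁻ (false ∷ s) (.false ∷ t) (exact h) zero ()
match-upTo⁻ (true ∷ s) (b ∷ t) (any h) (suc k) e = match-upTo⁻ s t h k e
match-upTo⁻ (false ∷ s) (.false ∷ t) (exact h) (suc k) e = match-upTo⁻ s t h k e

occurs⇒match : ∀ {m} (s t : Vec Bool m) → OccursInF (snoc t false) (stair 0 s) → Match (map upTo-pat (toList s)) (toList t)
occurs⇒match s t o = match-upTo⁺ s t (λ k e → jump-stair 0 s k
  (subst (λ z → lookup (stair 0 s) (inject₁ k) < lookup (stair 0 s) z) (next-inject₁ k)
    (o (inject₁ k) (trans (lookup-snoc-inject₁ t false k) e))))

match⇒occurs : ∀ {m} (s t : Vec Bool m) → Match (map upTo-pat (toList s)) (toList t) → OccursInF (snoc t false) (stair 0 s)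
match⇒occurs {m} s t h i e with view i
... | ‵fromℕ = contradiction (trans (sym (lookup-snoc-fromℕ t false)) e) λ ()
... | ‵inject₁ k = subst (λ z → lookup (stair 0 s) (inject₁ k) < lookup (stair 0 s) z) (sym (next-inject₁ k))
                    (stair-jump 0 s k (match-upTo⁻ s t h k (trans (sym (lookup-snoc-inject₁ t false k)) e)))

compatible⇒match : ∀ {m} x (s : Vec Bool m) r → Compatible r (toList (stair x s)) → Match (map upTo-pat (toList s)) (des r)
compatible⇒match x [] (k ∷ []) [-] = []
compatible⇒match x (b ∷ []) (k ∷ k' ∷ r) (c ∷ cs) = step b c (compatible⇒match (if b then suc x else x) [] (k' ∷ r) cs)
  where
  step : ∀ b → x < (if b then suc x else x) ⊎ k' ≤ k → Match [] (des (k' ∷ r)) → Match (upTo-pat b ∷ []) (des (k ∷ k' ∷ r))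
  step true c h = any h
  step false (inj₁ p) h = contradiction p (<-irrefl refl)
  step false (inj₂ p) h = subst (λ z → Match (exact false ∷ []) (z ∷ des (k' ∷ r))) (sym (≥⇒<ᵇ≡false p)) (exact h)
compatible⇒match x (b ∷ b' ∷ s) (k ∷ k' ∷ r) (c ∷ cs) = step b c (compatible⇒match (if b then suc x else x) (b' ∷ s) (k' ∷ r) cs)
  where
  step : ∀ b → x < (if b then suc x else x) ⊎ k' ≤ k → Match (map upTo-pat (toList (b' ∷ s))) (des (k' ∷ r)) →
         Match (upTo-pat b ∷ map upTo-pat (toList (b' ∷ s))) (des (k ∷ k' ∷ r))
  step true c h = any h
  step false (inj₁ p) h = contradiction p (<-irrefl refl)
  step false (inj₂ p) h = subst (λ z → Match (exact false ∷ map upTo-pat (toList (b' ∷ s))) (z ∷ des (k' ∷ r))) (sym (≥⇒<ᵇ≡false p)) (exact h)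

match⇒compatible : ∀ {m} x (s : Vec Bool m) r → length r ≡ suc m → Match (map upTo-pat (toList s)) (des r) → Compatible r (toList (stair x s))
match⇒compatible x [] (k ∷ []) l h = [-]
match⇒compatible x (true ∷ []) (k ∷ k' ∷ []) l (any h) = inj₁ ≤-refl ∷ [-]
match⇒compatible x (true ∷ b ∷ s) (k ∷ k' ∷ r) l (any h) = inj₁ ≤-refl ∷ match⇒compatible (suc x) (b ∷ s) (k' ∷ r) (suc-injective l) h
match⇒compatible x (false ∷ s) (k ∷ k' ∷ r) l h = cons s (bit h) (match⇒compatible x s (k' ∷ r) (suc-injective l) (rest h))
  where
  bit : ∀ {c u ps} → Match (exact false ∷ ps) (c ∷ u) → c ≡ false
  bit (exact _) = refl
  rest : ∀ {c u ps} → Match (exact false ∷ ps) (c ∷ u) → Match ps u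
  rest (exact h) = h
  cons : ∀ {m} (s : Vec Bool m) → (k <ᵇ k') ≡ false → Compatible (k' ∷ r) (toList (stair x s)) → Compatible (k ∷ k' ∷ r) (x ∷ toList (stair x s))
  cons [] e c = inj₂ (≮⇒≥ (λ p → contradiction (trans (sym (<⇒<ᵇ≡true p)) e) λ ())) ∷ c
  cons (b ∷ s) e c = inj₂ (≮⇒≥ (λ p → contradiction (trans (sym (<⇒<ᵇ≡true p)) e) λ ())) ∷ c

-- Standardisation. Since the monomial jumps at every position of `s`, compatibility only asks that
-- no descent lie outside `s`.
ssyt-count : ∀ {m} la → IsShape la → sum la ≡ suc m → (s : Vec Bool m) →
             SSYT la (stair 0 s) ↔ Fin (cnt (tabCounter la) (match? (map upTo-pat (toList s))))
ssyt-count {m} la sl e s = refine-↔ (keyR la (match? (map upTo-pat (toList s)))) (≡-dec (≡-dec _≟_))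
  (λ r → fill (length la) r (toList (stair 0 s)))
  (λ { r ((p , q) , h) → skewFill⇒ssyt {w = stair 0 s} (proj₁ (fill-sound p q (compat r (p , q) h) sorted-w)) })
  (λ { {r} {r'} ((p , q) , h) ((p' , q') , h') → fill-injective p q (compat r (p , q) h) p' q' (compat r' (p' , q') h') sorted-w })
  (λ T t → let (r , p , q , c , f , _) = fill-complete (toList (stair 0 s)) T []-shape sl sorted-w (ssyt⇒skewFill {w = stair 0 s} t)
           in r , ((p , q) , compatible⇒match 0 s r c) , f)
  where
  sorted-w = increasing⇒AllPairs (stair 0 s) (stair-increasing 0 s)
  compat : ∀ r → Tab la r → Match (map upTo-pat (toList s)) (des r) → Compatible r (toList (stair 0 s))
  compat r t h = match⇒compatible 0 s r (trans (tab-length t) e) h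

-- Rotation of permutations

vecs : ∀ {A : Set} → List A → ∀ k → List (Vec A k)
vecs xs zero = [] ∷ []
vecs xs (suc k) = cartesianProductWith _∷_ xs (vecs xs k)

vecs-unique : ∀ {A : Set} {xs : List A} → Unique xs → ∀ k → Unique (vecs xs k)
vecs-unique u zero = [] ∷ []
vecs-unique u (suc k) = Unique.cartesianProductWith⁺ _∷_ Vec-∷-injective u (vecs-unique u k)

vecs-complete : ∀ {A : Set} {xs : List A} → (∀ x → x ∈ xs) → ∀ {k} (v : Vec A k) → v ∈ vecs xs k
vecs-complete c [] = here refl
vecs-complete c (x ∷ v) = ∈-cartesianProductWith⁺ _∷_ (c x) (vecs-complete c v)

toList-snoc : ∀ {A : Set} {n} (v : Vec A n) b → toList (snoc v b) ≡ toList v ∷ʳ b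
toList-snoc [] b = refl
toList-snoc (x ∷ v) b = cong (x ∷_) (toList-snoc v b)

toList-length : ∀ {A : Set} {n} (v : Vec A n) → length (toList v) ≡ n
toList-length [] = refl
toList-length (x ∷ v) = cong suc (toList-length v)

toList-onto : ∀ {A : Set} {n} (s : List A) → length s ≡ n → ∃ λ (v : Vec A n) → toList v ≡ s
toList-onto [] refl = [] , refl
toList-onto (x ∷ s) refl = let (v , e) = toList-onto s refl in x ∷ v , cong (x ∷_) e

toList-replicate : ∀ {A : Set} {n} (v : Vec A n) {k b} → toList v ≡ replicate k b → ∀ i → lookup v i ≡ b
toList-replicate (x ∷ v) {suc k} e zero = ∷-injectiveˡ e
toList-replicate (x ∷ v) {suc k} e (suc i) = toList-replicate v {k} (∷-injectiveʳ e) i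

rotateV : ∀ {A : Set} {m} → Vec A (suc m) → Vec A (suc m)
rotateV u = tabulate (λ i → lookup u (next i))

rotateV-∷ : ∀ {A : Set} {m} x (v : Vec A m) → rotateV (x ∷ v) ≡ snoc v x
rotateV-∷ {m = m} x v = vec-ext (λ i → trans (lookup∘tabulate (λ i → lookup (x ∷ v) (next i)) i) (go i))
  where
  go : ∀ i → lookup (x ∷ v) (next i) ≡ lookup (snoc v x) i
  go i with view i
  ... | ‵fromℕ = trans (cong (lookup (x ∷ v)) (next-fromℕ m)) (sym (lookup-snoc-fromℕ v x))
  ... | ‵inject₁ k = trans (cong (lookup (x ∷ v)) (next-inject₁ k)) (sym (lookup-snoc-inject₁ v x k))

snoc-onto : ∀ {A : Set} {m} (u : Vec A (suc m)) → ∃ λ v → ∃ λ x → u ≡ snoc v x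
snoc-onto {m = zero} (x ∷ []) = [] , x , refl
snoc-onto {m = suc m} (y ∷ u) = let (v , x , e) = snoc-onto u in y ∷ v , x , cong (y ∷_) e

next-injective : ∀ {m} (i j : Fin (suc m)) → next i ≡ next j → i ≡ j
next-injective {m} i j e with view i | view j
... | ‵fromℕ | ‵fromℕ = refl
... | ‵fromℕ | ‵inject₁ k = contradiction (trans (sym (next-fromℕ m)) (trans e (next-inject₁ k))) λ ()
... | ‵inject₁ k | ‵fromℕ = contradiction (trans (sym (next-inject₁ k)) (trans e (next-fromℕ m))) λ ()
... | ‵inject₁ k | ‵inject₁ l = cong inject₁ (F.suc-injective (trans (sym (next-inject₁ k)) (trans e (next-inject₁ l))))

next-onto : ∀ {m} (j : Fin (suc m)) → ∃ λ i → next i ≡ j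
next-onto {m} zero = fromℕ m , next-fromℕ m
next-onto (suc k) = inject₁ k , next-inject₁ k

descends : ∀ {n} → Fin n → Fin n → Bool
descends a b = ⌊ b F.<? a ⌋

shape-from-irrelevant : ∀ {la} → .(IsPartitionShape la) → IsShape la
shape-from-irrelevant {la} p = isShape
  (decreasing (λ r → recompute (part la (suc r) ≤? part la r) (proj₁ p r)))
  (λ r r< → recompute (0 <? part la r) (proj₂ p r r<))

partition-shape : ∀ {n} (la : Partition n) → IsShape (value la)
partition-shape (la , [ p ]) = shape-from-irrelevant (proj₁ p)

partition-sum : ∀ {n} (la : Partition n) → sum (value la) ≡ n
partition-sum {n} (la , [ p ]) = recompute (sum la ≟ n) (proj₂ p)

module _ {m : ℕ} (A : Vec (Fin (suc m)) (suc m) → Bool) where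

  Perm : Set
  Perm = Vec (Fin (suc m)) (suc m)

  Member : (Perm → Set) → Perm → Set
  Member X π = IsPerm π × A π ≡ true × X π

  isPerm? : (π : Perm) → Dec (IsPerm π)
  isPerm? π = F.all? λ i → F.all? λ j → (lookup π i F.≟ lookup π j) →-dec (i F.≟ j)

  memberP : ∀ {X} → (∀ π → Dec (X π)) → FinPred (Member X)
  memberP X? = finPred (λ π → isPerm? π ×-dec ((A π Bool.≟ true) ×-dec X? π))
    (vecs (allFin (suc m)) (suc m)) (vecs-unique (Unique.allFin⁺ (suc m)) (suc m))
    (λ π _ → vecs-complete ∈-allFin π)

  cDesP : ∀ J → FinPred (Member (λ π → toList (cDes π) ≡ J))
  cDesP J = memberP (λ π → toList (cDes π) ≟ᴮ J)

  cDesCount : List Bool → ℕ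
  cDesCount J = card (cDesP J)

  linearDes : Perm → List Bool
  linearDes π = toList (pairs descends π)

  desP : ∀ {Φ : List Bool → Set} → (∀ s → Dec (Φ s)) → FinPred (Member (λ π → Φ (linearDes π)))
  desP u = memberP (λ π → u (linearDes π))

  desCounter : Counter
  desCounter = record
    { cnt = λ u → card (desP u)
    ; cnt-⊎ = λ u p q h₁ h₂ h₃ h₄ → card-⊎ (desP u) (desP p) (desP q)
        (λ { π (i , a , φ) → Sum.map (λ z → i , a , z) (λ z → i , a , z) (h₁ _ φ) })
        (λ { π (i , a , φ) → i , a , h₂ _ φ }) (λ { π (i , a , φ) → i , a , h₃ _ φ })
        (λ { π (_ , _ , φ) (_ , _ , φ') → h₄ _ φ φ' }) }

  wrap : Perm → Bool
  wrap π = descends (lookup π (fromℕ m)) (lookup π zero)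

  cDes-bits : ∀ π → toList (cDes π) ≡ linearDes π ∷ʳ wrap π
  cDes-bits π = trans (cong toList (cyclic-tabulate descends π)) (toList-snoc (pairs descends π) (wrap π))

  cDesCount-extends : ∀ s → cDesCount (s ∷ʳ false) + cDesCount (s ∷ʳ true) ≡ cnt desCounter (_≟ᴮ s)
  cDesCount-extends s = sym (card-⊎ (desP (_≟ᴮ s)) (cDesP (s ∷ʳ false)) (cDesP (s ∷ʳ true)) split
    (λ { π (i , a , e) → i , a , proj₁ (∷ʳ-injective _ _ (trans (sym (cDes-bits π)) e)) })
    (λ { π (i , a , e) → i , a , proj₁ (∷ʳ-injective _ _ (trans (sym (cDes-bits π)) e)) })
    (λ { π (_ , _ , e) (_ , _ , e') → contradiction (proj₂ (∷ʳ-injective _ _ (trans (sym e) e'))) λ () }))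
    where
    split : ∀ π → Member (λ π → linearDes π ≡ s) π →
            Member (λ π → toList (cDes π) ≡ s ∷ʳ false) π ⊎ Member (λ π → toList (cDes π) ≡ s ∷ʳ true) π
    split π (i , a , refl) with wrap π | cDes-bits π
    ... | false | e = inj₁ (i , a , e)
    ... | true | e = inj₂ (i , a , e)

  cDes-rot : ∀ (π : Perm) → cDes (rot π) ≡ rotateV (cDes π)
  cDes-rot π = tabulate-cong (λ i → trans
    (cong₂ descends (lookup∘tabulate (λ i → lookup π (next i)) i) (lookup∘tabulate (λ i → lookup π (next i)) (next i)))
    (sym (lookup∘tabulate (λ i → descends (lookup π i) (lookup π (next i))) (next i))))

  rot-perm : ∀ (π : Perm) → IsPerm π → IsPerm (rot π)
  rot-perm π p i j e = next-injective i j (p (next i) (next j)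
    (trans (sym (lookup∘tabulate (λ i → lookup π (next i)) i)) (trans e (lookup∘tabulate (λ i → lookup π (next i)) j))))

  rot-perm⁻ : ∀ (π : Perm) → IsPerm (rot π) → IsPerm π
  rot-perm⁻ π p i j e with next-onto i | next-onto j
  ... | i' , refl | j' , refl = cong next (p i' j'
    (trans (lookup∘tabulate (λ i → lookup π (next i)) i') (trans e (sym (lookup∘tabulate (λ i → lookup π (next i)) j')))))

  rot-onto : ∀ (π : Perm) → ∃ λ (σ : Perm) → rot σ ≡ π
  rot-onto π = let (v , x , e) = snoc-onto π in x ∷ v , trans (rotateV-∷ x v) (sym e)

  rot-injective : ∀ {π σ : Perm} → rot π ≡ rot σ → π ≡ σ
  rot-injective {π} {σ} e = vec-ext go
    where
    go : ∀ i → lookup π i ≡ lookup σ i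
    go i with next-onto i
    ... | i' , refl = trans (sym (lookup∘tabulate (λ i → lookup π (next i)) i'))
                        (trans (cong (λ z → lookup z i') e) (lookup∘tabulate (λ i → lookup σ (next i)) i'))

  cDesCount-rotate : RotationInvariant (suc m) A → ∀ s b → cDesCount (s ∷ʳ b) ≡ cDesCount (b ∷ s)
  cDesCount-rotate inv s b = sym (card-rel (cDesP (b ∷ s)) (cDesP (s ∷ʳ b)) (λ π σ → rot π ≡ σ) to from
    (λ { _ _ refl e → sym (rot-injective e) }) (λ { _ _ refl refl → refl }))
    where
    bits : ∀ (π : Perm) → ∃ λ x → ∃ λ v → cDes π ≡ x ∷ v × cDes (rot π) ≡ snoc v x
    bits π with cDes π | cDes-rot π
    ... | x ∷ v | e = x , v , refl , trans e (rotateV-∷ x v)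
    to : ∀ π → Member (λ π → toList (cDes π) ≡ b ∷ s) π → ∃ λ σ → Member (λ π → toList (cDes π) ≡ s ∷ʳ b) σ × rot π ≡ σ
    to π (i , a , e) with bits π
    ... | x , v , e₁ , e₂ with ∷-injective (trans (sym (cong toList e₁)) e)
    ... | refl , refl = rot π , (rot-perm π i , trans (sym (inv π i)) a , trans (cong toList e₂) (toList-snoc v x)) , refl
    from : ∀ σ → Member (λ π → toList (cDes π) ≡ s ∷ʳ b) σ → ∃ λ π → Member (λ π → toList (cDes π) ≡ b ∷ s) π × rot π ≡ σ
    from σ (i , a , e) with rot-onto σ
    ... | π , refl with bits π
    ... | x , v , e₁ , e₂ with ∷ʳ-injective _ _ (trans (sym (toList-snoc v x)) (trans (sym (cong toList e₂)) e))
    ... | refl , refl = π , (rot-perm⁻ π i , trans (inv π (rot-perm⁻ π i)) a , cong toList e₁) , refl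

  -- A word without cyclic descents is constant, which contradicts injectivity once there are two
  -- positions.
  cDesCount-false : 0 < m → cDesCount (replicate (suc m) false) ≡ 0
  cDesCount-false 0<m = card-empty (cDesP (replicate (suc m) false)) λ { π (i , _ , e) → impossible π i (toList-replicate (cDes π) {suc m} e) }
    where
    impossible : ∀ π → IsPerm π → (∀ i → lookup (cDes π) i ≡ false) → ⊥
    impossible π p h = contradiction (p (fromℕ m) zero (F.≤-antisym last≤ (mono (fromℕ m)))) (λ e → <-irrefl (trans (sym (cong toℕ e)) (F.toℕ-fromℕ m)) 0<m)
      where
      step : ∀ i → lookup π i F.≤ lookup π (next i)
      step i = ≮⇒≥ (λ lt → contradiction (trans (sym (trans (sym (lookup∘tabulate (λ i → descends (lookup π i) (lookup π (next i))) i)) (h i)))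
                 (trans (isYes≗does (lookup π (next i) F.<? lookup π i)) (dec-true (lookup π (next i) F.<? lookup π i) lt))) λ ())
      mono : ∀ i → lookup π zero F.≤ lookup π i
      mono = <-weakInduction (λ i → lookup π zero F.≤ lookup π i) ≤-refl
        (λ k le → ≤-trans le (subst (λ z → lookup π (inject₁ k) F.≤ lookup π z) (next-inject₁ k) (step (inject₁ k))))
      last≤ : lookup π (fromℕ m) F.≤ lookup π zero
      last≤ = subst (λ z → lookup π (fromℕ m) F.≤ lookup π z) (next-fromℕ m) (step (fromℕ m))

  cDesCount-true : cDesCount (replicate (suc m) true) ≡ 0
  cDesCount-true = card-empty (cDesP (replicate (suc m) true)) λ { π (i , _ , e) → impossible π (toList-replicate (cDes π) {suc m} e) }
    where
    impossible : ∀ π → (∀ i → lookup (cDes π) i ≡ true) → ⊥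
    impossible π h = contradiction (subst (λ z → lookup π z F.< lookup π (fromℕ m)) (next-fromℕ m) (step (fromℕ m))) (≤⇒≯ (mono (fromℕ m)))
      where
      step : ∀ i → lookup π (next i) F.< lookup π i
      step i with lookup π (next i) F.<? lookup π i | trans (sym (lookup∘tabulate (λ i → descends (lookup π i) (lookup π (next i))) i)) (h i)
      ... | yes p | _ = p
      ... | no _ | ()
      mono : ∀ i → lookup π i F.≤ lookup π zero
      mono = <-weakInduction (λ i → lookup π i F.≤ lookup π zero) ≤-refl
        (λ k le → ≤-trans (<⇒≤ (subst (λ z → lookup π z F.< lookup π (inject₁ k)) (next-inject₁ k) (step (inject₁ k)))) le)

  module _ (L : List (Partition (suc m)))
           (bij : ∀ (w : Vec ℕ (suc m)) → WeaklyIncreasing w →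
                  Elems (suc m) A (λ π → OccursInF (Des π) w) ↔
                  Σ (Fin (length L)) (λ k → SSYT (value (List.lookup L k)) w)) where

    shapeCounter : Counter
    shapeCounter = sumCounter (λ la → tabCounter (value la)) L

    private
      Des-bits : ∀ (π : Perm) → Des π ≡ snoc (pairs descends π) false
      Des-bits π = linear-tabulate descends π

      agree : ∀ (s : Vec Bool m) → cnt desCounter (match? (map upTo-pat (toList s))) ≡ cnt shapeCounter (match? (map upTo-pat (toList s)))
      agree s = trans (↔-card (bij (stair 0 s) (stair-increasing 0 s))
          (refine-↔ (desP u) (Vec-≡-dec F._≟_) (λ π → π)
            (λ { π (i , a , h) → i , a , subst (λ D → OccursInF {suc m} D (stair 0 s)) (sym (Des-bits π)) (match⇒occurs s (pairs descends π) h) })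
            (λ _ _ e → e)
            (λ { π (i , a , o) → π , (i , a , occurs⇒match s (pairs descends π) (subst (λ D → OccursInF {suc m} D (stair 0 s)) (Des-bits π) o)) , refl }))
          (Σ-list-↔ {Z = λ la → SSYT (value la) (stair 0 s)} (λ la → cnt (tabCounter (value la)) u) {L} {L}
            (Pointwise.refl {R = λ la la' → SSYT (value la') (stair 0 s) ↔ Fin (cnt (tabCounter (value la)) u)} (λ {la} → ssyt-count (value la) (partition-shape la) (partition-sum la) s))))
        (sym (sumCounter-sumBy (λ la → tabCounter (value la)) L u))
        where u = match? (map upTo-pat (toList s))

    -- The monomials `stair 0 s` suffice: their coefficients count permutations and tableaux with
    -- descents inside `s`, and Möbius inversion recovers the exact descent sets.
    descent-count : ∀ s → length s ≡ m → cnt desCounter (_≟ᴮ s) ≡ cnt shapeCounter (_≟ᴮ s)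
    descent-count = möbius desCounter shapeCounter m
      (λ s e → let (v , e') = toList-onto s e in
        subst (λ z → cnt desCounter (match? (map upTo-pat z)) ≡ cnt shapeCounter (match? (map upTo-pat z))) e' (agree v))

-- Hooks and the remaining cyclic descents

ones : List Bool → ℕ
ones [] = 0
ones (true ∷ s) = suc (ones s)
ones (false ∷ s) = ones s

ones-++ : ∀ s t → ones (s ++ t) ≡ ones s + ones t
ones-++ [] t = refl
ones-++ (true ∷ s) t = cong suc (ones-++ s t)
ones-++ (false ∷ s) t = ones-++ s t

ones-false : ∀ k → ones (replicate k false) ≡ 0
ones-false zero = refl
ones-false (suc k) = ones-false k

ones-true : ∀ k → ones (replicate k true) ≡ k
ones-true zero = refl
ones-true (suc k) = cong suc (ones-true k)

block : ℕ → ℕ → List Bool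
block a k = replicate a false ++ replicate k true

block-∷ʳ-true : ∀ a k → block a k ∷ʳ true ≡ block a (suc k)
block-∷ʳ-true a k = trans (++-assoc (replicate a false) (replicate k true) _) (cong (replicate a false ++_) (snoc-replicate k))
  where
  snoc-replicate : ∀ k → replicate k true ∷ʳ true ≡ replicate (suc k) true
  snoc-replicate zero = refl
  snoc-replicate (suc k) = cong (true ∷_) (snoc-replicate k)

block-length : ∀ a k → length (block a k) ≡ a + k
block-length a k = trans (length-++ (replicate a false)) (cong₂ _+_ (length-replicate a) (length-replicate k))

ones-block : ∀ a k → ones (block a k) ≡ k
ones-block a k = trans (ones-++ (replicate a false) (replicate k true)) (trans (cong (_+ ones (replicate k true)) (ones-false a)) (ones-true k))

rotate-++ : (f : List Bool → ℕ) → (∀ s b → f (s ∷ʳ b) ≡ f (b ∷ s)) → ∀ u v → f (u ++ v) ≡ f (v ++ u)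
rotate-++ f rot [] v = cong f (sym (++-identityʳ v))
rotate-++ f rot (b ∷ u) v = begin
  f (b ∷ (u ++ v)) ≡⟨ sym (rot (u ++ v) b) ⟩
  f ((u ++ v) ∷ʳ b) ≡⟨ cong f (++-assoc u v _) ⟩
  f (u ++ (v ∷ʳ b)) ≡⟨ rotate-++ f rot u (v ∷ʳ b) ⟩
  f ((v ∷ʳ b) ++ u) ≡⟨ cong f (++-assoc v _ u) ⟩
  f (v ++ b ∷ u) ∎
  where open ≡-Reasoning

no-ones : ∀ s → ones s ≡ 0 → s ≡ replicate (length s) false
no-ones [] e = refl
no-ones (false ∷ s) e = cong (false ∷_) (no-ones s e)

split-true : ∀ s {k} → ones s ≡ suc k → ∃ λ u → ∃ λ v → s ≡ u ++ true ∷ v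
split-true (true ∷ s) e = [] , s , refl
split-true (false ∷ s) e = let (u , v , e') = split-true s e in false ∷ u , v , cong (false ∷_) e'

-- A cyclic descent is rotated to the last position and then removed by means of linear.
module _ (m : ℕ) (M N : List Bool → ℕ) (H : ℕ → ℕ)
         (M-rot : ∀ s b → M (s ∷ʳ b) ≡ M (b ∷ s)) (N-rot : ∀ s b → N (s ∷ʳ b) ≡ N (b ∷ s))
         (linear : ∀ s → length s ≡ m → M (s ∷ʳ false) + M (s ∷ʳ true) ≡ (N (s ∷ʳ false) + N (s ∷ʳ true)) + H (ones s))
         (N-block : ∀ a k → a + k ≡ suc m → N (block a k) ≡ 0) where

  private
    cancel : ∀ a b c d e h → a + b ≡ (c + d) + h → a ≡ c + e → e + b ≡ d + h
    cancel a b c d e h p refl = +-cancelˡ-≡ c _ _ (trans (sym (+-assoc c e b)) (trans p (+-assoc c d h)))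

  cyclic-difference : ∀ k J → length J ≡ suc m → ones J ≡ k → ∀ a → a + k ≡ suc m → M J ≡ N J + M (block a k)
  cyclic-difference zero J l o a e = begin
    M J ≡⟨ cong M J≡ ⟩
    M (block a 0) ≡⟨ cong (_+ M (block a 0)) (sym (trans (cong N J≡) (N-block a 0 e))) ⟩
    N J + M (block a 0) ∎
    where
    open ≡-Reasoning
    J≡ : J ≡ block a 0
    J≡ = trans (no-ones J o) (trans (cong (λ z → replicate z false) (trans l (sym (trans (sym (+-identityʳ a)) e)))) (sym (++-identityʳ _)))
  cyclic-difference (suc k) J l o a e with split-true J o
  ... | u , v , refl = begin
    M (u ++ true ∷ v) ≡⟨ to-end M M-rot ⟩
    M (s ∷ʳ true) ≡⟨ +-cancelˡ-≡ (M (block (suc a) k)) _ _ total ⟩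
    N (s ∷ʳ true) + M (block a (suc k)) ≡⟨ cong (_+ M (block a (suc k))) (sym (to-end N N-rot)) ⟩
    N (u ++ true ∷ v) + M (block a (suc k)) ∎
    where
    open ≡-Reasoning
    s = v ++ u
    to-end : (f : List Bool → ℕ) → (∀ s b → f (s ∷ʳ b) ≡ f (b ∷ s)) → f (u ++ true ∷ v) ≡ f (s ∷ʳ true)
    to-end f rot = trans (rotate-++ f rot u (true ∷ v)) (sym (rot (v ++ u) true))
    l-s : length s ≡ m
    l-s = suc-injective (trans (cong suc (trans (length-++ v) (+-comm (length v) (length u))))
            (trans (sym (+-suc (length u) (length v))) (trans (sym (length-++ u)) l)))
    o-s : ones s ≡ k
    o-s = suc-injective (trans (cong suc (trans (ones-++ v u) (+-comm (ones v) (ones u))))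
            (trans (sym (+-suc (ones u) (ones v))) (trans (sym (ones-++ u (true ∷ v))) o)))
    e' : suc a + k ≡ suc m
    e' = trans (sym (+-suc a k)) e
    reduced : ∀ t → length t ≡ m → ones t ≡ k → M (block (suc a) k) + M (t ∷ʳ true) ≡ N (t ∷ʳ true) + H k
    reduced t lt ot = cancel (M (t ∷ʳ false)) (M (t ∷ʳ true)) (N (t ∷ʳ false)) (N (t ∷ʳ true)) (M (block (suc a) k)) (H k)
      (subst (λ z → M (t ∷ʳ false) + M (t ∷ʳ true) ≡ (N (t ∷ʳ false) + N (t ∷ʳ true)) + H z) ot (linear t lt))
      (cyclic-difference k (t ∷ʳ false) (trans (length-++ t) (trans (+-comm (length t) 1) (cong suc lt)))
        (trans (ones-++ t _) (trans (+-identityʳ _) ot)) (suc a) e')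
    -- The same recursion at the block itself, where `N` vanishes, expresses `H k` by `M` alone;
    -- substituting it removes `H` from the recursion for `s`.
    blocks : M (block (suc a) k) + M (block a (suc k)) ≡ H k
    blocks = subst₂ (λ x y → M (block (suc a) k) + M x ≡ y + H k) (block-∷ʳ-true a k)
      (trans (cong N (block-∷ʳ-true a k)) (N-block a (suc k) e))
      (reduced (block a k) (trans (block-length a k) (suc-injective e')) (ones-block a k))
    total : M (block (suc a) k) + M (s ∷ʳ true) ≡ M (block (suc a) k) + (N (s ∷ʳ true) + M (block a (suc k)))
    total = trans (reduced s l-s o-s) (trans (cong (N (s ∷ʳ true) +_) (sym blocks))
      (trans (sym (+-assoc (N (s ∷ʳ true)) (M (block (suc a) k)) (M (block a (suc k)))))
        (trans (cong (_+ M (block a (suc k))) (+-comm (N (s ∷ʳ true)) (M (block (suc a) k))))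
          (+-assoc (M (block (suc a) k)) (N (s ∷ʳ true)) (M (block a (suc k)))))))

-- Tableaux with descent string `block i j` are hooks

occ : ℕ → List ℕ → ℕ
occ r [] = 0
occ r (c ∷ w) with c ≟ r
... | yes _ = suc (occ r w)
... | no _ = occ r w

part-ends : ∀ γ w r → part (ends γ w) r ≡ part γ r + occ r w
part-ends γ [] r = sym (+-identityʳ _)
part-ends γ (c ∷ w) r with c ≟ r
... | yes refl = trans (part-ends (bump γ c) w c) (trans (cong (_+ occ c w) (part-bump-≡ γ c)) (sym (+-suc (part γ c) _)))
... | no n = trans (part-ends (bump γ c) w r) (cong (_+ occ r w) (part-bump-≢ γ n))

<ᵇ≡true⇒< : ∀ {m n} → (m <ᵇ n) ≡ true → m < n
<ᵇ≡true⇒< {m} {n} e = ≰⇒> (λ p → contradiction (trans (sym e) (≥⇒<ᵇ≡false p)) λ ())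

<ᵇ≡false⇒≥ : ∀ {m n} → (m <ᵇ n) ≡ false → n ≤ m
<ᵇ≡false⇒≥ {m} {n} e = ≮⇒≥ (λ p → contradiction (trans (sym e) (<⇒<ᵇ≡true p)) λ ())

occ-increasing : ∀ x w j → 1 ≤ x → des (x ∷ w) ≡ replicate j true → occ 1 w ≡ 0
occ-increasing x [] j p e = refl
occ-increasing x (y ∷ w) (suc j) p e with y ≟ 1 | <ᵇ≡true⇒< {x} {y} (∷-injectiveˡ e)
... | yes refl | q = contradiction (≤-trans (s≤s p) q) (<-irrefl refl)
... | no _ | q = occ-increasing y w j (≤-trans p (<⇒≤ q)) (∷-injectiveʳ e)

-- Without descents the word stays in row 0; from then on it goes strictly down and meets row 1 at
-- most once.
occ-block : ∀ i j w → des (0 ∷ w) ≡ block i j → occ 1 w ≤ 1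
occ-block i j [] e = z≤n
occ-block zero (suc j) (y ∷ w) e with y ≟ 1 | <ᵇ≡true⇒< {0} {y} (∷-injectiveˡ e)
... | yes refl | q = s≤s (≤-reflexive (occ-increasing 1 w j ≤-refl (∷-injectiveʳ e)))
... | no _ | q = subst (_≤ 1) (sym (occ-increasing y w j q (∷-injectiveʳ e))) z≤n
occ-block (suc i) j (y ∷ w) e with <ᵇ≡false⇒≥ {0} {y} (∷-injectiveˡ e)
... | z≤n = occ-block i j w (∷-injectiveʳ e)

first-letter : ∀ {c w} → Path [] (c ∷ w) → c ≡ 0
first-letter (zero ∷ p) = refl
first-letter (suc () ∷ p)

block-tableau : ∀ {la} i j T → Tab la T → des T ≡ block i j → part la 1 ≤ 1
block-tableau i j [] (p , refl) e = z≤n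
block-tableau i j (c ∷ w) (p , refl) e with first-letter p
... | refl = subst (_≤ 1) (sym (part-ends (1 ∷ []) w 1)) (occ-block i j w e)

∉-replicate-false : ∀ k → ¬ (true ∈ replicate k false)
∉-replicate-false (suc k) (there p) = ∉-replicate-false k p

-- Deleting a final true would leave a tableau with linear descents `block a k` in a shape whose
-- second row has at least two cells; without a true bit no cut qualifies. This vanishing is what
-- turns the remaining multiplicities into counts of permutations.
cyclicCount-block : ∀ {ν r} → IsShape ν → Addable ν (suc r) → 0 < part ν (suc r) →
                    ∀ a k → cyclicCount ν (suc r) (block a k) ≡ 0
cyclicCount-block {ν} {r} sh ar 0<r a zero = card-empty (nP ν (suc r) (block a 0))
  (λ AB p → ∉-replicate-false a (subst (true ∈_) (++-identityʳ _) (NP-true AB (λ ()) p)))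
cyclicCount-block {ν} {r} sh ar 0<r a (suc k) =
  trans (cong (cyclicCount ν (suc r)) (sym (block-∷ʳ-true a k)))
    (m+n≡0⇒n≡0 (cyclicCount ν (suc r) (block a k ∷ʳ false)) (trans (cyclicCount-extends sh ar (block a k))
      (card-empty (keyR (bump ν (suc r)) (_≟ᴮ block a k)) (λ { T (t , e) → <⇒≱ two (block-tableau a k T t e) }))))
  where
  two : 2 ≤ part (bump ν (suc r)) 1
  two = ≤-trans (≤-trans (s≤s 0<r) (≤-reflexive (sym (part-bump-≡ ν (suc r)))))
          (part-mono (bump-decreasing (shape-decreasing sh) ar) (s≤s z≤n))

-- Tableaux of hook shape

hook : ℕ → ℕ → List ℕ
hook x k = suc x ∷ replicate k 1

-- In a hook, an entry is in the leg exactly when its predecessor is a descent, so the tableau can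
-- be read off from its descent string; `c` is the current height of the leg.
hookWord : ℕ → List Bool → List ℕ
hookWord c [] = []
hookWord c (true ∷ s) = suc c ∷ hookWord (suc c) s
hookWord c (false ∷ s) = 0 ∷ hookWord c s

bump-replicate : ∀ c → bump (replicate c 1) c ≡ replicate (suc c) 1
bump-replicate zero = refl
bump-replicate (suc c) = cong (1 ∷_) (bump-replicate c)

part-replicate : ∀ c → part (replicate c 1) c ≡ 0
part-replicate zero = refl
part-replicate (suc c) = part-replicate c

part-replicate-≤ : ∀ c i → part (replicate c 1) i ≤ 1
part-replicate-≤ zero i = z≤n
part-replicate-≤ (suc c) zero = ≤-refl
part-replicate-≤ (suc c) (suc i) = part-replicate-≤ c i

part-replicate-< : ∀ {c i} → i < c → part (replicate c 1) i ≡ 1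
part-replicate-< {suc c} {zero} p = refl
part-replicate-< {suc c} {suc i} (s≤s p) = part-replicate-< p

part-replicate-≥ : ∀ {c i} → c ≤ i → part (replicate c 1) i ≡ 0
part-replicate-≥ {c} p = part-beyond (replicate c 1) (subst (_≤ _) (sym (length-replicate c)) p)

hook-addable : ∀ x c → Addable (hook x c) (suc c)
hook-addable x zero = suc (s≤s z≤n)
hook-addable x (suc c) = suc (subst₂ _<_ (sym (part-replicate-≥ {suc c} {suc c} ≤-refl)) (sym (part-replicate-< {suc c} {c} ≤-refl)) (s≤s z≤n))

hookWord-path : ∀ x c s → Path (hook x c) (hookWord c s)
hookWord-path x c [] = []
hookWord-path x c (true ∷ s) =
  hook-addable x c ∷ subst (λ z → Path (suc x ∷ z) (hookWord (suc c) s)) (sym (bump-replicate c)) (hookWord-path x (suc c) s)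
hookWord-path x c (false ∷ s) = zero ∷ hookWord-path (suc x) c s

zeros : List Bool → ℕ
zeros [] = 0
zeros (true ∷ s) = zeros s
zeros (false ∷ s) = suc (zeros s)

zeros+ones : ∀ s → zeros s + ones s ≡ length s
zeros+ones [] = refl
zeros+ones (true ∷ s) = trans (+-suc (zeros s) (ones s)) (cong suc (zeros+ones s))
zeros+ones (false ∷ s) = cong suc (zeros+ones s)

hookWord-ends : ∀ x c s → ends (hook x c) (hookWord c s) ≡ hook (x + zeros s) (c + ones s)
hookWord-ends x c [] = cong₂ hook (sym (+-identityʳ x)) (sym (+-identityʳ c))
hookWord-ends x c (true ∷ s) = trans (cong (λ z → ends (suc x ∷ z) (hookWord (suc c) s)) (bump-replicate c))
  (trans (hookWord-ends x (suc c) s) (cong (hook (x + zeros s)) (sym (+-suc c (ones s)))))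
hookWord-ends x c (false ∷ s) = trans (hookWord-ends (suc x) c s) (cong (λ z → hook z (c + ones s)) (sym (+-suc x (zeros s))))

hookWord-des : ∀ p c s → p ≤ c → des (p ∷ hookWord c s) ≡ s
hookWord-des p c [] q = refl
hookWord-des p c (true ∷ s) q = cong₂ _∷_ (<⇒<ᵇ≡true (s≤s q)) (hookWord-des (suc c) (suc c) s ≤-refl)
hookWord-des p c (false ∷ s) q = cong₂ _∷_ (≥⇒<ᵇ≡false {p} z≤n) (hookWord-des 0 c s z≤n)

-- The preceding letter `p` serves only for the first comparison. Used from `hook 0 0` with `p = 0`,
-- the statement covers both the hook tableaux, where `p` is the first entry, and the skew tableaux
-- of a hook with its corner cell removed, where `p` stands for that cell.
hook-word : ∀ {x c X K p} w → Path (hook x c) w → ends (hook x c) w ≡ hook X K → p ≤ c →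
            w ≡ hookWord c (des (p ∷ w)) × c + ones (des (p ∷ w)) ≡ K
hook-word {c = c} [] q e p≤c = refl , trans (+-identityʳ c)
  (trans (sym (length-replicate c)) (trans (cong length (∷-injectiveʳ e)) (length-replicate _)))
hook-word {x} {c} {X} {K} {p} (zero ∷ w) (_ ∷ q) e p≤c with hook-word {suc x} {c} {X} {K} {0} w q e z≤n
... | e₁ , e₂ = subst (λ b → (0 ∷ w ≡ hookWord c (b ∷ des (0 ∷ w))) × (c + ones (b ∷ des (0 ∷ w)) ≡ K))
                  (sym (≥⇒<ᵇ≡false {p} z≤n)) (cong (0 ∷_) e₁ , e₂)
hook-word {x} {c} {X} {K} {p} (suc i ∷ w) (suc a ∷ q) e p≤c with <-cmp i c
... | tri< i<c _ _ = contradiction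
        (≤-trans (≤-reflexive (trans (cong suc (sym (part-replicate-< i<c))) (sym (part-bump-≡ (replicate c 1) i))))
          (≤-trans (part≤part-ends (bump (hook x c) (suc i)) w (suc i))
            (≤-trans (≤-reflexive (cong (λ z → part z (suc i)) e)) (part-replicate-≤ K i)))) (<-irrefl refl)
... | tri> _ _ c<i with i
... | suc i' = contradiction (subst₂ _<_ (part-replicate-≥ {c} (<⇒≤ c<i)) (part-replicate-≥ {c} (≤-pred c<i)) a) λ ()
hook-word {x} {c} {X} {K} {p} (suc i ∷ w) (suc a ∷ q) e p≤c | tri≈ _ refl _
  with hook-word {x} {suc c} {X} {K} {suc c} w
         (subst (λ z → Path (suc x ∷ z) w) (bump-replicate c) q)
         (trans (cong (λ z → ends (suc x ∷ z) w) (sym (bump-replicate c))) e) ≤-refl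
... | e₁ , e₂ = subst (λ b → (suc c ∷ w ≡ hookWord c (b ∷ des (suc c ∷ w))) × (c + ones (b ∷ des (suc c ∷ w)) ≡ K))
                  (sym (<⇒<ᵇ≡true {p} (s≤s p≤c))) (cong (suc c ∷_) e₁ , trans (+-suc c _) e₂)

hook-tableau : ∀ {X K} T → Tab (hook X K) T → T ≡ 0 ∷ hookWord 0 (des T) × ones (des T) ≡ K
hook-tableau [] (_ , ())
hook-tableau (c ∷ w) (p , e) with first-letter p
hook-tableau (.0 ∷ w) (_ ∷ p , e) | refl with hook-word {0} {0} {p = 0} w p e z≤n
... | e₁ , e₂ = cong (0 ∷_) e₁ , e₂

indicator : ℕ → ℕ → ℕ
indicator k j with k ≟ j
... | yes _ = 1
... | no _ = 0

unitPred : FinPred (λ (_ : ⊤) → ⊤)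
unitPred = finPred (λ _ → yes tt) (tt ∷ []) ([] ∷ []) (λ _ _ → here refl)

hook-count : ∀ {X K} s → X + K ≡ length s → card (keyR (hook X K) (_≟ᴮ s)) ≡ indicator K (ones s)
hook-count {X} {K} s e with K ≟ ones s
... | no n = card-empty (keyR (hook X K) (_≟ᴮ s)) (λ { T (t , refl) → n (sym (proj₂ (hook-tableau T t))) })
... | yes refl = card-rel (keyR (hook X K) (_≟ᴮ s)) unitPred (λ _ _ → ⊤) (λ _ _ → tt , tt , tt)
  (λ _ _ → 0 ∷ hookWord 0 s , ((zero ∷ hookWord-path 0 0 s ,
      trans (hookWord-ends 0 0 s) (cong (λ z → hook z K) (+-cancelʳ-≡ K _ _ (trans (zeros+ones s) (sym e))))) , hookWord-des 0 0 s z≤n) , tt)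
  (λ { {T} {T'} (t , d) (t' , d') _ _ → trans (proj₁ (hook-tableau T t)) (trans (cong (λ z → 0 ∷ hookWord 0 z) (trans d (sym d'))) (sym (proj₁ (hook-tableau T' t')))) })
  (λ _ _ _ _ → refl)

record NonHook (la : List ℕ) : Set where
  constructor nonHook
  field
    base : List ℕ
    row : ℕ
    base-shape : IsShape base
    base-addable : Addable base (suc row)
    base-positive : 0 < part base (suc row)
    base-bump : bump base (suc row) ≡ la

data Classified (m : ℕ) (la : List ℕ) : Set where
  isHook : ∀ x k → x + k ≡ m → la ≡ hook x k → Classified m la
  isNonHook : NonHook la → Classified m la

classify : ∀ {m} la → IsShape la → sum la ≡ suc m → Classified m la
classify [] sh ()
classify (zero ∷ la) sh e = contradiction (shape-positive sh 0 (s≤s z≤n)) λ ()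
classify {m} (suc x ∷ la) sh e with part la 0 ≤? 1
... | yes p = isHook x (length la) (trans (cong (x +_) (sym (sum-la la≡))) (suc-injective e)) (cong (suc x ∷_) la≡)
  where
  all-one : ∀ la → (∀ r → r < length la → part la r ≡ 1) → la ≡ replicate (length la) 1
  all-one [] f = refl
  all-one (y ∷ la) f = cong₂ _∷_ (f 0 (s≤s z≤n)) (all-one la (λ r r< → f (suc r) (s≤s r<)))
  la≡ : la ≡ replicate (length la) 1
  la≡ = all-one la (λ r r< → ≤-antisym (≤-trans (part-mono (shape-decreasing sh) (s≤s (z≤n {r}))) p) (shape-positive sh (suc r) (s≤s r<)))
  sum-ones : ∀ k → sum (replicate k 1) ≡ k
  sum-ones zero = refl
  sum-ones (suc k) = cong suc (sum-ones k)
  sum-la : la ≡ replicate (length la) 1 → sum la ≡ length la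
  sum-la q = trans (cong sum q) (sum-ones (length la))
-- The corner chosen closes the block of rows as long as the second row; that length is at least 2,
-- which keeps the corner out of the first column.
... | no p with bottom {suc x ∷ la} 1 (shape-decreasing sh) (≤-trans (s≤s z≤n) (≰⇒> p))
... | suc r , _ , eq , cor = isNonHook (nonHook (unbump la⁺ (suc r)) r (unbump-shape sh cor) (unbump-addable sh cor)
      (≤-pred (≤-trans (≰⇒> p) (≤-reflexive (trans (sym eq) (sym (part-unbump-≡ sh cor)))))) (bump-unbump′ sh cor))
  where la⁺ = suc x ∷ la

nonHookCount : ∀ {la} → NonHook la → List Bool → ℕ
nonHookCount nh = cyclicCount (NonHook.base nh) (suc (NonHook.row nh))

cyclicPart : ∀ {m la} → Classified m la → List Bool → ℕ
cyclicPart (isHook _ _ _ _) s = 0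
cyclicPart (isNonHook nh) s = nonHookCount nh s

hookPart : ∀ {m la} → Classified m la → ℕ → ℕ
hookPart (isHook x k _ _) j = indicator k j
hookPart (isNonHook _) j = 0

classified-extends : ∀ {m la} (c : Classified m la) s → length s ≡ m →
  (cyclicPart c (s ∷ʳ false) + cyclicPart c (s ∷ʳ true)) + hookPart c (ones s) ≡ cnt (tabCounter la) (_≟ᴮ s)
classified-extends (isHook x k e refl) s l = sym (hook-count {x} {k} s (trans e (sym l)))
classified-extends (isNonHook (nonHook ν r sh ar 0<r refl)) s l = trans (+-identityʳ _) (cyclicCount-extends sh ar s)

cyclicPart-rotate : ∀ {m la} (c : Classified m la) s b → cyclicPart c (s ∷ʳ b) ≡ cyclicPart c (b ∷ s)
cyclicPart-rotate (isHook _ _ _ _) s b = refl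
cyclicPart-rotate (isNonHook (nonHook ν r sh ar 0<r _)) s b = cyclicCount-rotate sh ar 0<r s b

cyclicPart-block : ∀ {m la} (c : Classified m la) a k → cyclicPart c (block a k) ≡ 0
cyclicPart-block (isHook _ _ _ _) a k = refl
cyclicPart-block (isNonHook (nonHook ν r sh ar 0<r _)) a k = cyclicCount-block sh ar 0<r a k

-- Cyclic descent extensions

uip : ∀ {A : Set} {x y : A} (p q : x ≡ y) → p ≡ q
uip refl refl = refl

Fiber : ∀ {X B : Set} → (X → B) → B → Set
Fiber {X} f b = Σ X λ x → f x ≡ b

fiber-≡ : ∀ {X B : Set} {f : X → B} {b} {u v : Fiber f b} → proj₁ u ≡ proj₁ v → u ≡ v
fiber-≡ {u = x , p} {.x , q} refl = cong (x ,_) (uip p q)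

module _ {X Y B : Set} (f : X → B) (g : Y → B) (F : ∀ b → Fiber f b ↔ Fiber g b) where

  private
    to : X → Y
    to x = proj₁ (Inverse.to (F (f x)) (x , refl))

    over : ∀ x → g (to x) ≡ f x
    over x = proj₂ (Inverse.to (F (f x)) (x , refl))

    from : Y → X
    from y = proj₁ (Inverse.from (F (g y)) (y , refl))

    from-at : ∀ b y (e : g y ≡ b) → from y ≡ proj₁ (Inverse.from (F b) (y , e))
    from-at _ y refl = refl

    to-at : ∀ b x (e : f x ≡ b) → to x ≡ proj₁ (Inverse.to (F b) (x , e))
    to-at _ x refl = refl

  fiberwise : Σ (X ↔ Y) λ φ → ∀ x → g (Inverse.to φ x) ≡ f x
  fiberwise = mk↔ₛ′ to from
    (λ y → trans (to-at (g y) (from y) (proj₂ (Inverse.from (F (g y)) (y , refl))))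
             (cong proj₁ (Inverse.strictlyInverseˡ (F (g y)) (y , refl))))
    (λ x → trans (from-at (f x) (to x) (over x)) (cong proj₁ (Inverse.strictlyInverseʳ (F (f x)) (x , refl)))) , over

fiber-refinement : ∀ {V B : Set} {P : V → Set} (f : V → B) (_≟_ : ∀ (x y : B) → Dec (x ≡ y)) b →
                   Fiber (λ (z : Refinement V P) → f (value z)) b ↔ Refinement V (λ v → P v × f v ≡ b)
fiber-refinement f _≟B_ b = mk↔ₛ′ (λ { ((v , [ p ]) , e) → v , [ p , e ] })
  (λ { (v , [ pq ]) → (v , [ proj₁ pq ]) , recompute (f v ≟B b) (proj₂ pq) })
  (λ { (v , [ pq ]) → refl }) (λ { ((v , [ p ]) , e) → fiber-≡ refl })

refinement-fiber : ∀ {X B : Set} (f : X → B) (_≟_ : ∀ (x y : B) → Dec (x ≡ y)) b →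
                   Refinement X (λ x → f x ≡ b) ↔ Fiber f b
refinement-fiber f _≟B_ b = mk↔ₛ′ (λ { (x , [ e ]) → x , recompute (f x ≟B b) e }) (λ { (x , e) → x , [ e ] })
  (λ { (x , e) → fiber-≡ refl }) (λ { (x , [ e ]) → refl })

fiber-∘ : ∀ {X Y B : Set} (φ : X ↔ Y) (g : Y → B) b → Fiber (λ x → g (Inverse.to φ x)) b ↔ Fiber g b
fiber-∘ φ g b = mk↔ₛ′ (λ { (x , e) → Inverse.to φ x , e })
  (λ { (y , e) → Inverse.from φ y , trans (cong g (Inverse.strictlyInverseˡ φ y)) e })
  (λ { (y , e) → fiber-≡ (Inverse.strictlyInverseˡ φ y) }) (λ { (x , e) → fiber-≡ (Inverse.strictlyInverseʳ φ x) })

fiber-cong : ∀ {X B C : Set} {f : X → B} {g : X → C} {b c} → (∀ x → f x ≡ b → g x ≡ c) → (∀ x → g x ≡ c → f x ≡ b) →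
             Fiber f b ↔ Fiber g c
fiber-cong h k = mk↔ₛ′ (λ { (x , e) → x , h x e }) (λ { (x , e) → x , k x e }) (λ _ → fiber-≡ refl) (λ _ → fiber-≡ refl)

≡-Fin : ∀ {m n} → m ≡ n → Fin m ↔ Fin n
≡-Fin refl = mk↔ₛ′ (λ i → i) (λ i → i) (λ _ → refl) (λ _ → refl)

snoc-injective : ∀ {A : Set} {n} (u v : Vec A n) {a b} → snoc u a ≡ snoc v b → u ≡ v × a ≡ b
snoc-injective [] [] refl = refl , refl
snoc-injective (x ∷ u) (y ∷ v) e with Vec-∷-injective e
... | refl , e' with snoc-injective u v e'
... | refl , refl = refl , refl

rotateV-injective : ∀ {A : Set} {m} (u v : Vec A (suc m)) → rotateV u ≡ rotateV v → u ≡ v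
rotateV-injective (x ∷ u) (y ∷ v) e with snoc-injective u v (trans (sym (rotateV-∷ x u)) (trans e (rotateV-∷ y v)))
... | refl , refl = refl

toList-injective : ∀ {A : Set} {n} (u v : Vec A n) → toList u ≡ toList v → u ≡ v
toList-injective [] [] e = refl
toList-injective (x ∷ u) (y ∷ v) e = cong₂ _∷_ (∷-injectiveˡ e) (toList-injective u v (∷-injectiveʳ e))

_≟ⱽ_ : ∀ {n} (u v : Vec Bool n) → Dec (u ≡ v)
_≟ⱽ_ = Vec-≡-dec Bool._≟_

∈-lookupV : ∀ {A : Set} {n} {x : A} (v : Vec A n) → x ∈ toList v → ∃ λ i → lookup v i ≡ x
∈-lookupV (y ∷ v) (here refl) = zero , refl
∈-lookupV (y ∷ v) (there p) = let (i , e) = ∈-lookupV v p in suc i , e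

-- A cyclic descent extension with `ψ` replaced by a numerical condition: since `N` is invariant
-- under rotation, the fibres of `label` over a string and over its rotation have equal size, and
-- `ψ` matches them.
record Labelling (m : ℕ) (la mu : List ℕ) (N : Vec Bool (suc m) → ℕ) : Set where
  field
    label : SYT (suc m) la mu → Vec Bool (suc m)
    label-extends : ∀ T → ∃ λ b → label T ≡ snoc (pairs rowLess (value T)) b
    label-fiber : ∀ J → Fiber label J ↔ Fin (N J)
    N-rotate : ∀ x v → N (x ∷ v) ≡ N (snoc v x)
    N-true : ∀ J → 0 < N J → ∃ λ i → lookup J i ≡ true
    N-false : ∀ J → 0 < N J → ∃ λ i → lookup J i ≡ false

  label-positive : ∀ T → 0 < N (label T)
  label-positive T with N (label T) | Inverse.to (label-fiber (label T)) (T , refl)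
  ... | suc _ | _ = s≤s z≤n

  extension : CyclicDescentExtension (suc m) la mu
  extension = record
    { cDesT = label
    ; ψ = proj₁ rotation
    ; extends = ext
    ; shifts = λ T i → trans (sym (lookup∘tabulate (λ i → lookup (label (Inverse.to (proj₁ rotation) T)) (next i)) i))
                         (cong (λ z → lookup z i) (proj₂ rotation T))
    ; nonEmpty = λ T → N-true (label T) (label-positive T)
    ; nonFull = λ T → N-false (label T) (label-positive T)
    }
    where
    fibers : ∀ J → Fiber label J ↔ Fiber (λ T → rotateV (label T)) J
    fibers J with snoc-onto J
    ... | v , x , refl = label-fiber (snoc v x) ⨾ ≡-Fin (sym (N-rotate x v)) ⨾ ↔-sym (label-fiber (x ∷ v)) ⨾
          fiber-cong (λ T e → trans (cong rotateV e) (rotateV-∷ x v))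
                     (λ T e → rotateV-injective _ _ (trans e (sym (rotateV-∷ x v))))
    rotation : Σ (SYT (suc m) la mu ↔ SYT (suc m) la mu) λ φ → ∀ T → rotateV (label (Inverse.to φ T)) ≡ label T
    rotation = fiberwise label (λ T → rotateV (label T)) fibers
    ext : ∀ T (i : Fin (suc m)) → suc (toℕ i) < suc m → lookup (label T) i ≡ lookup (DesT (suc m) la mu T) i
    ext T i lt with view i
    ... | ‵fromℕ = contradiction (≤-pred lt) (<-irrefl (toℕ-fromℕ m))
    ... | ‵inject₁ k = let (b , e) = label-extends T in
        trans (cong (λ z → lookup z (inject₁ k)) e)
        (trans (lookup-snoc-inject₁ (pairs rowLess (value T)) b k)
        (trans (sym (lookup-snoc-inject₁ (pairs rowLess (value T)) false k))
          (cong (λ z → lookup z (inject₁ k)) (sym (linear-tabulate rowLess (value T))))))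

  extension-fiber : ∀ J → Refinement (SYT (suc m) la mu) (λ T → cDesT extension T ≡ J) ↔ Fin (N J)
  extension-fiber J = refinement-fiber label _≟ⱽ_ J ⨾ label-fiber J

open Labelling public

cellsOf : ∀ n → List ℕ → List ℕ → Vec (ℕ × ℕ) n
cellsOf zero γ w = []
cellsOf (suc n) γ [] = (0 , 0) ∷ cellsOf n γ []
cellsOf (suc n) γ (r ∷ w) = (r , part γ r) ∷ cellsOf n (bump γ r) w

cellsOf-toList : ∀ {n} γ (v : Vec ℕ n) → cellsOf n γ (toList v) ≡ cells γ v
cellsOf-toList γ [] = refl
cellsOf-toList γ (r ∷ v) = cong ((r , part γ r) ∷_) (cellsOf-toList (bump γ r) v)

rowWord-cellsOf : ∀ {n} γ w → length w ≡ n → rowWord (cellsOf n γ w) ≡ w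
rowWord-cellsOf γ w l with toList-onto w l
... | v , refl = cong toList (trans (cong (Vec.map proj₁) (cellsOf-toList γ v)) (rows-cells γ v))

cellsOf-syt : ∀ {n} γ w → Decreasing γ → Path γ w → length w ≡ n → IsSYT n (ends γ w) γ (cellsOf n γ w)
cellsOf-syt {n} γ w dγ p l with toList-onto w l
... | v , refl = subst (IsSYT n (ends γ (toList v)) γ) (sym (cellsOf-toList γ v)) (path⇒syt γ v dγ p)

_≟ᶜ_ : ∀ {n} (u v : Vec (ℕ × ℕ) n) → Dec (u ≡ v)
_≟ᶜ_ = Vec-≡-dec (×-≡-dec _≟_ _≟_)

syt-fiber : ∀ {m la} → IsShape la → sum la ≡ suc m → (s : Vec Bool m) →
            Fiber (λ (T : SYT (suc m) la []) → pairs rowLess (value T)) s ↔ Fin (card (keyR la (_≟ᴮ toList s)))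
syt-fiber {m} {la} sl e s = fiber-refinement {P = IsSYT (suc m) la []} (pairs rowLess) _≟ⱽ_ s ⨾
  refine-↔ (keyR la (_≟ᴮ toList s)) _≟ᶜ_ (cellsOf (suc m) [])
    (λ { w (t@(p , q) , d) → subst (λ z → IsSYT (suc m) z [] (cellsOf (suc m) [] w)) q (cellsOf-syt [] w (shape-decreasing []-shape) p (len t)) ,
           toList-injective _ s (trans (pairs-des (cellsOf (suc m) [] w)) (trans (cong des (rowWord-cellsOf [] w (len t))) d)) })
    (λ { {w} {w'} (t , _) (t' , _) q → trans (sym (rowWord-cellsOf [] w (len t))) (trans (cong rowWord q) (rowWord-cellsOf [] w' (len t'))) })
    (λ { T (t , d) → let (p , q , r) = syt⇒path la [] T sl []-shape (λ _ → z≤n) t in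
           rowWord T , ((p , q) , trans (sym (pairs-des T)) (cong toList d)) ,
           trans (cellsOf-toList [] (Vec.map proj₁ T)) (sym r) })
  where
  len : ∀ {w} → Tab la w → length w ≡ suc m
  len t = trans (tab-length t) e

module _ {m la} (sl : IsShape la) (e : sum la ≡ suc m) (nh : NonHook la) where

  private
    open NonHook nh
    N : Vec Bool (suc m) → ℕ
    N J = nonHookCount nh (toList J)

    -- A model consisting of `N J` formal copies of each string `J`. Over a fixed linear part it is
    -- as large as the set of tableaux with these descents, so a bijection over the linear part
    -- hands every tableau its last bit.
    Y : Set
    Y = Σ (Vec Bool m × Bool) λ { (s , b) → Fin (N (snoc s b)) }

    start : Y → Vec Bool m
    start ((s , b) , i) = s

    string : Y → Vec Bool (suc m)
    string ((s , b) , i) = snoc s b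

    start-fiber : ∀ s → Fiber start s ↔ Fin (N (snoc s false) + N (snoc s true))
    start-fiber s = mk↔ₛ′ to from (λ { (inj₁ _) → refl ; (inj₂ _) → refl })
        (λ { (((_ , false) , i) , refl) → refl ; (((_ , true) , i) , refl) → refl })
      ⨾ ↔-sym (+↔⊎ {m = N (snoc s false)} {n = N (snoc s true)})
      where
      to : Fiber start s → Fin (N (snoc s false)) ⊎ Fin (N (snoc s true))
      to (((_ , false) , i) , refl) = inj₁ i
      to (((_ , true) , i) , refl) = inj₂ i
      from : Fin (N (snoc s false)) ⊎ Fin (N (snoc s true)) → Fiber start s
      from (inj₁ i) = ((s , false) , i) , refl
      from (inj₂ i) = ((s , true) , i) , refl

    string-fiber : ∀ J → Fiber string J ↔ Fin (N J)
    string-fiber J = mk↔ₛ′ to (from J (snoc-onto J)) (to-from J (snoc-onto J)) (λ { (((s , b) , i) , refl) → from-to (snoc-onto (snoc s b)) i })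
      where
      to : ∀ {J} → Fiber string J → Fin (N J)
      to (((s , b) , i) , refl) = i
      from : ∀ J → (∃ λ s → ∃ λ b → J ≡ snoc s b) → Fin (N J) → Fiber string J
      from .(snoc s b) (s , b , refl) i = ((s , b) , i) , refl
      to-from : ∀ J o i → to (from J o i) ≡ i
      to-from .(snoc s b) (s , b , refl) i = refl
      from-to : ∀ {s b} (o : ∃ λ s' → ∃ λ b' → snoc s b ≡ snoc s' b') i → from (snoc s b) o i ≡ (((s , b) , i) , refl)
      from-to {s} {b} (s' , b' , q) i with snoc-injective s s' q
      from-to {s} {b} (.s , .b , refl) i | refl , refl = refl

    count-eq : ∀ (s : Vec Bool m) → card (keyR la (_≟ᴮ toList s)) ≡ N (snoc s false) + N (snoc s true)
    count-eq s = trans (subst (λ z → card (keyR z (_≟ᴮ toList s)) ≡ _) base-bump (sym (cyclicCount-extends base-shape base-addable (toList s))))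
      (cong₂ _+_ (cong (nonHookCount nh) (sym (toList-snoc s false))) (cong (nonHookCount nh) (sym (toList-snoc s true))))

    abstract
      φ : Σ (SYT (suc m) la [] ↔ Y) λ φ → ∀ T → start (Inverse.to φ T) ≡ pairs rowLess (value T)
      φ = fiberwise (λ T → pairs rowLess (value T)) start
            (λ s → syt-fiber sl e s ⨾ ≡-Fin (count-eq s) ⨾ ↔-sym (start-fiber s))

    string-start : ∀ y {s} → start y ≡ s → ∃ λ b → string y ≡ snoc s b
    string-start ((s , b) , i) refl = b , refl

    witness : ∀ J → 0 < N J → ∃ λ AB → NP base (suc row) (toList J) AB
    witness J p with elements (nP base (suc row) (toList J)) | ∈-elements⁻ (nP base (suc row) (toList J))
    witness J () | [] | _
    ... | AB ∷ _ | f = AB , f (here refl)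

  nonHook-labelling : Labelling m la [] N
  nonHook-labelling = record
    { label = λ T → string (Inverse.to (proj₁ φ) T)
    ; label-extends = λ T → string-start (Inverse.to (proj₁ φ) T) (proj₂ φ T)
    ; label-fiber = λ J → fiber-∘ (proj₁ φ) string J ⨾ string-fiber J
    ; N-rotate = λ x v → trans (sym (cyclicCount-rotate base-shape base-addable base-positive (toList v) x))
                           (cong (nonHookCount nh) (sym (toList-snoc v x)))
    ; N-true = λ J p → let (AB , np) = witness J p in ∈-lookupV J (NP-true AB (λ ()) np)
    ; N-false = λ J p → let (AB , np) = witness J p in ∈-lookupV J (NP-false AB np)
    }

  nonHook-part : 2 ≤ part la 1
  nonHook-part = subst (λ z → 2 ≤ part z 1) base-bump
    (≤-trans (≤-trans (s≤s base-positive) (≤-reflexive (sym (part-bump-≡ base (suc row)))))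
      (part-mono (bump-decreasing (shape-decreasing base-shape) base-addable) (s≤s z≤n)))

  nonHook-shape : NonRibbonSkewShape (suc m)
  nonHook-shape = (la , []) , [ (((λ r → descent (shape-decreasing sl) r) , shape-positive sl) ,
                                 ((λ r → z≤n) , (λ r ())) , (λ r → z≤n) , e) ,
                               (λ { (_ , ¬sq) → ¬sq (0 , 0 , (z≤n , ≤-trans (s≤s z≤n) two) , (z≤n , two) , (z≤n , tall) , (z≤n , nonHook-part)) }) ]
    where
    two : 2 ≤ part la 0
    two = ≤-trans nonHook-part (descent (shape-decreasing sl) 0)
    tall : 1 ≤ part la 1
    tall = ≤-trans (s≤s z≤n) nonHook-part

-- The disjoint union of a column of k cells and a row of a cells.
module _ {a k m : ℕ} (a+k : suc a + suc k ≡ suc m) where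

  private
    la mu : List ℕ
    -- With the corner cell removed, a row of `suc a` cells and a column of `suc k` cells remain;
    -- both are nonempty, which makes the shape disconnected.
    la = hook (suc a) (suc k)
    mu = 1 ∷ []

    N : Vec Bool (suc m) → ℕ
    N J = indicator (suc k) (ones (toList J))

    V = Vec (ℕ × ℕ) (suc m)

    inColumn : ℕ × ℕ → Bool
    inColumn c = 0 <ᵇ proj₁ c

    column : V → Vec Bool (suc m)
    column = Vec.map inColumn

    mu-shape : IsShape mu
    mu-shape = bump-shape {[]} {0} []-shape zero

    la-shape : IsShape la
    la-shape = isShape (decreasing dec) pos
      where
      dec : ∀ r → part la (suc r) ≤ part la r
      dec zero = s≤s z≤n
      dec (suc r) with r <? suc k
      ... | yes p = subst (part (replicate (suc k) 1) (suc r) ≤_) (sym (part-replicate-< p)) (part-replicate-≤ (suc k) (suc r))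
      ... | no ¬p = subst (_≤ part (replicate (suc k) 1) r) (sym (part-replicate-≥ {suc k} (m≤n⇒m≤1+n (≮⇒≥ ¬p)))) z≤n
      pos : ∀ r → r < length la → 0 < part la r
      pos zero p = s≤s z≤n
      pos (suc r) (s≤s p) = subst (0 <_) (sym (part-replicate-< (subst (r <_) (cong suc (length-replicate k)) p))) (s≤s z≤n)

    mu≤la : ∀ r → part mu r ≤ part la r
    mu≤la zero = s≤s z≤n
    mu≤la (suc r) = z≤n

    hookBits : ∀ c s → map (0 <ᵇ_) (hookWord c s) ≡ s
    hookBits c [] = refl
    hookBits c (true ∷ s) = cong (true ∷_) (hookBits (suc c) s)
    hookBits c (false ∷ s) = cong (false ∷_) (hookBits c s)

    hookWord-length : ∀ c s → length (hookWord c s) ≡ length s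
    hookWord-length c [] = refl
    hookWord-length c (true ∷ s) = cong suc (hookWord-length (suc c) s)
    hookWord-length c (false ∷ s) = cong suc (hookWord-length c s)

    column-bits : ∀ {n} (T : Vec (ℕ × ℕ) n) → toList (Vec.map inColumn T) ≡ map (0 <ᵇ_) (rowWord T)
    column-bits [] = refl
    column-bits (c ∷ T) = cong ((0 <ᵇ proj₁ c) ∷_) (column-bits T)

    decode : ∀ T → IsSYT (suc m) la mu T →
             rowWord T ≡ hookWord 0 (toList (column T)) × ones (toList (column T)) ≡ suc k × T ≡ cellsOf (suc m) mu (rowWord T)
    decode T t =
      let (p , e , r) = syt⇒path la mu T la-shape mu-shape mu≤la t
          (w≡ , o) = hook-word {0} {0} {p = 0} (rowWord T) p e z≤n
          bits : toList (column T) ≡ des (0 ∷ rowWord T)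
          bits = trans (column-bits T) (trans (cong (map (0 <ᵇ_)) w≡) (hookBits 0 _))
      in trans w≡ (cong (hookWord 0) (sym bits)) , trans (cong ones bits) o ,
         trans r (sym (cellsOf-toList mu (Vec.map proj₁ T)))

    encode : (s : Vec Bool (suc m)) → V
    encode s = cellsOf (suc m) mu (hookWord 0 (toList s))

    word-length : ∀ (s : Vec Bool (suc m)) → length (hookWord 0 (toList s)) ≡ suc m
    word-length s = trans (hookWord-length 0 (toList s)) (toList-length s)

    encode-syt : ∀ s → ones (toList s) ≡ suc k → IsSYT (suc m) la mu (encode s)
    encode-syt s o = subst (λ z → IsSYT (suc m) z mu (encode s))
      (trans (hookWord-ends 0 0 (toList s)) (cong₂ hook
        (+-cancelʳ-≡ (suc k) (zeros (toList s)) (suc a) (trans (cong (zeros (toList s) +_) (sym o)) (trans (zeros+ones (toList s)) (trans (toList-length s) (sym a+k))))) o))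
      (cellsOf-syt mu (hookWord 0 (toList s)) (shape-decreasing mu-shape) (hookWord-path 0 0 (toList s)) (word-length s))

    column-encode : ∀ s → column (encode s) ≡ s
    column-encode s = toList-injective _ s (trans (column-bits (encode s))
      (trans (cong (map (0 <ᵇ_)) (rowWord-cellsOf mu (hookWord 0 (toList s)) (word-length s))) (hookBits 0 (toList s))))

    encode-column : ∀ T → IsSYT (suc m) la mu T → T ≡ encode (column T)
    encode-column T t = let (w , _ , r) = decode T t in trans r (cong (cellsOf (suc m) mu) w)

    -- An entry lies lower than its predecessor exactly when it is in the column. Shifting the
    -- indicator of the column by one thus extends the descent set, and every set of `suc k`
    -- positions arises from one tableau.
    label₀ : V → Vec Bool (suc m)
    label₀ T = rotateV (column T)

    pairs-column : ∀ T → IsSYT (suc m) la mu T → ∃ λ x → column T ≡ x ∷ pairs rowLess T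
    pairs-column T t with decode T t
    ... | w , _ , _ with column T
    ... | x ∷ s = x , cong (x ∷_) (toList-injective s _ (trans (sym (des-tail x (toList s))) (trans (cong des (sym w)) (sym (pairs-des T)))))
      where
      des-tail : ∀ x s → des (hookWord 0 (x ∷ s)) ≡ s
      des-tail true s = hookWord-des 1 1 s ≤-refl
      des-tail false s = hookWord-des 0 0 s z≤n

    column-fiber : ∀ s → Fiber (λ (T : SYT (suc m) la mu) → column (value T)) s ↔ Fin (indicator (suc k) (ones (toList s)))
    column-fiber s with suc k ≟ ones (toList s)
    ... | yes o = mk↔ₛ′ (λ _ → zero) (λ _ → (encode s , [ encode-syt s (sym o) ]) , column-encode s) (λ { zero → refl })
          (λ { ((T , [ t ]) , refl) → fiber-≡ (refinement-≡ (sym (recompute (T ≟ᶜ encode (column T)) (encode-column T t)))) })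
      where
      refinement-≡ : ∀ {P : V → Set} {u v} .{p : P u} .{q : P v} → u ≡ v → _≡_ {A = Refinement V P} (u , [ p ]) (v , [ q ])
      refinement-≡ refl = refl
    ... | no n = mk↔ₛ′ (λ z → ⊥-elim (none z)) (λ ()) (λ ()) (λ z → ⊥-elim (none z))
      where
      none : ¬ Fiber (λ (T : SYT (suc m) la mu) → column (value T)) s
      none ((T , [ t ]) , refl) = n (sym (recompute (ones (toList (column T)) ≟ suc k) (proj₁ (proj₂ (decode T t)))))

    ones-rotate : ∀ x (v : Vec Bool m) → ones (toList (x ∷ v)) ≡ ones (toList (snoc v x))
    ones-rotate x v = trans (move x (toList v)) (cong ones (sym (toList-snoc v x)))
      where
      move : ∀ x s → ones (x ∷ s) ≡ ones (s ∷ʳ x)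
      move true s = trans (+-comm 1 (ones s)) (sym (ones-++ s (true ∷ [])))
      move false s = trans (sym (+-identityʳ _)) (sym (ones-++ s (false ∷ [])))

    find-true : ∀ {n} (v : Vec Bool n) → 0 < ones (toList v) → ∃ λ i → lookup v i ≡ true
    find-true (true ∷ v) p = zero , refl
    find-true (false ∷ v) p = let (i , e) = find-true v p in suc i , e

    find-false : ∀ {n} (v : Vec Bool n) → 0 < zeros (toList v) → ∃ λ i → lookup v i ≡ false
    find-false (false ∷ v) p = zero , refl
    find-false (true ∷ v) p = let (i , e) = find-false v p in suc i , e

    N-ones : ∀ J → 0 < N J → suc k ≡ ones (toList J)
    N-ones J p with suc k ≟ ones (toList J)
    ... | yes e = e
    N-ones J () | no _

  columnRow-labelling : Labelling m (hook (suc a) (suc k)) (1 ∷ []) N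
  columnRow-labelling = record
    { label = λ T → label₀ (value T)
    ; label-extends = ext
    ; label-fiber = fib
    ; N-rotate = λ x v → cong (indicator (suc k)) (ones-rotate x v)
    ; N-true = λ J p → find-true J (subst (0 <_) (N-ones J p) (s≤s z≤n))
    ; N-false = λ J p → find-false J (subst (0 <_) (sym (zeros≡ J (N-ones J p))) (s≤s z≤n))
    }
    where
    zeros≡ : ∀ J → suc k ≡ ones (toList J) → zeros (toList J) ≡ suc a
    zeros≡ J o = +-cancelʳ-≡ (suc k) (zeros (toList J)) (suc a)
      (trans (cong (zeros (toList J) +_) o) (trans (zeros+ones (toList J)) (trans (toList-length J) (sym a+k))))
    ext : ∀ (T : SYT (suc m) la mu) → ∃ λ b → label₀ (value T) ≡ snoc (pairs rowLess (value T)) b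
    ext (T , [ t ]) with column T in eq
    ... | x ∷ s = x , trans (rotateV-∷ x s) (cong (λ z → snoc z x) s≡)
      where
      tail≡ : ∀ {u v : Vec Bool m} {y z} → y ∷ u ≡ z ∷ v → u ≡ v
      tail≡ refl = refl
      s≡ : s ≡ pairs rowLess T
      s≡ = recompute (s ≟ⱽ pairs rowLess T) (tail≡ (trans (sym eq) (proj₂ (pairs-column T t))))
    fib : ∀ J → Fiber (λ (T : SYT (suc m) la mu) → label₀ (value T)) J ↔ Fin (N J)
    fib J with snoc-onto J
    ... | v , x , refl =
      fiber-cong (λ T e → rotateV-injective _ _ (trans e (sym (rotateV-∷ x v))))
                 (λ T e → trans (cong rotateV e) (rotateV-∷ x v))
      ⨾ column-fiber (x ∷ v) ⨾ ≡-Fin (cong (indicator (suc k)) (ones-rotate x v))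

  columnRow-shape : NonRibbonSkewShape (suc m)
  columnRow-shape = (hook (suc a) (suc k) , 1 ∷ []) ,
    [ (((λ r → descent (shape-decreasing la-shape) r) , shape-positive la-shape) ,
       ((λ r → descent (shape-decreasing mu-shape) r) , shape-positive mu-shape) , mu≤la , size) ,
      (λ { (conn , _) → disconnected (conn (1 , 0) (0 , 1) (z≤n , s≤s z≤n) (s≤s z≤n , s≤s (s≤s z≤n))) }) ]
    where
    size : sum la ≡ 1 + suc m
    size = cong suc (trans (cong (suc a +_) (sum-ones (suc k))) a+k)
      where
      sum-ones : ∀ k → sum (replicate k 1) ≡ k
      sum-ones zero = refl
      sum-ones (suc k) = cong suc (sum-ones k)
    -- The only way from the column up to row 0 is through the removed corner cell.
    stays : ∀ {x y} → Adjacent la mu x y → 1 ≤ proj₁ x → 1 ≤ proj₁ y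
    stays {suc r , c} {zero , c'} ((p , q) , (p' , q') , inj₂ (refl , inj₂ refl)) _ =
      contradiction (≤-trans p' (≤-pred (≤-trans q (part-replicate-≤ (suc k) r)))) λ ()
    stays {suc r , c} {suc r' , c'} _ _ = s≤s z≤n
    stays {zero , c} _ ()
    disconnected : ¬ Star (Adjacent la mu) (1 , 0) (0 , 1)
    disconnected s = contradiction (walk s (s≤s z≤n)) λ ()
      where
      walk : ∀ {x y} → Star (Adjacent la mu) x y → 1 ≤ proj₁ x → 1 ≤ proj₁ y
      walk ε h = h
      walk (_◅_ {i = x} {j = y} adj st) h = walk st (stays {x} {y} adj h)

-- The theorem

sumBy-++ : ∀ {A : Set} (f : A → ℕ) xs ys → sumBy f (xs ++ ys) ≡ sumBy f xs + sumBy f ys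
sumBy-++ f [] ys = refl
sumBy-++ f (x ∷ xs) ys = trans (cong (f x +_) (sumBy-++ f xs ys)) (sym (+-assoc (f x) _ _))

sumBy-replicate : ∀ {A : Set} (f : A → ℕ) k x → sumBy f (replicate k x) ≡ k * f x
sumBy-replicate f zero x = refl
sumBy-replicate f (suc k) x = cong (f x +_) (sumBy-replicate f k x)

sumBy-cong : ∀ {A : Set} {f g : A → ℕ} (L : List A) → (∀ a → f a ≡ g a) → sumBy f L ≡ sumBy g L
sumBy-cong [] e = refl
sumBy-cong (a ∷ L) e = cong₂ _+_ (e a) (sumBy-cong L e)

sumBy-zero : ∀ {A : Set} {f : A → ℕ} (L : List A) → (∀ a → f a ≡ 0) → sumBy f L ≡ 0
sumBy-zero [] e = refl
sumBy-zero (a ∷ L) e = cong₂ _+_ (e a) (sumBy-zero L e)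

sumBy-+ : ∀ {A : Set} (f g : A → ℕ) (L : List A) → sumBy (λ a → f a + g a) L ≡ sumBy f L + sumBy g L
sumBy-+ f g [] = refl
sumBy-+ f g (a ∷ L) = trans (cong (f a + g a +_) (sumBy-+ f g L)) (+-interchange (f a) (g a) (sumBy f L) (sumBy g L))

module _ {m : ℕ} where

  record Item : Set where
    field
      shape : NonRibbonSkewShape (suc m)
      count : Vec Bool (suc m) → ℕ
      labelling : Labelling m (proj₁ (value shape)) (proj₂ (value shape)) count

  open Item

  extended : Item → ShapeWithExtension (suc m)
  extended i = shape i , extension (labelling i)

  StringFiber : Vec Bool (suc m) → ShapeWithExtension (suc m) → Set
  StringFiber J s = Refinement (SYT (suc m) (proj₁ (value (proj₁ s))) (proj₂ (value (proj₁ s)))) (λ T → cDesT (proj₂ s) T ≡ J)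

  items-↔ : ∀ J (items : List Item) →
            Σ (Fin (length (map extended items))) (λ k → StringFiber J (List.lookup (map extended items) k)) ↔
            Fin (sumBy (λ i → count i J) items)
  items-↔ J items = Σ-list-↔ {Z = StringFiber J} (λ i → count i J) (fibers items)
    where
    fibers : ∀ items → Pointwise (λ i a → StringFiber J a ↔ Fin (count i J)) items (map extended items)
    fibers [] = []
    fibers (i ∷ items) = extension-fiber (labelling i) J ∷ fibers items

  classes : (la : Partition (suc m)) → Classified m (value la)
  classes la = classify (value la) (partition-shape la) (partition-sum la)

  nonHookItem : (la : Partition (suc m)) → Classified m (value la) → List Item
  nonHookItem la (isHook _ _ _ _) = []
  nonHookItem la (isNonHook nh) = record
    { shape = nonHook-shape (partition-shape la) (partition-sum la) nh
    ; count = λ J → nonHookCount nh (toList J)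
    ; labelling = nonHook-labelling (partition-shape la) (partition-sum la) nh } ∷ []

  nonHookItems : List (Partition (suc m)) → List Item
  nonHookItems [] = []
  nonHookItems (la ∷ L) = nonHookItem la (classes la) ++ nonHookItems L

  nonHookItems-count : ∀ J L → sumBy (λ i → count i J) (nonHookItems L) ≡ sumBy (λ la → cyclicPart (classes la) (toList J)) L
  nonHookItems-count J [] = refl
  nonHookItems-count J (la ∷ L) = trans (sumBy-++ _ (nonHookItem la (classes la)) (nonHookItems L))
    (cong₂ _+_ (single (classes la)) (nonHookItems-count J L))
    where
    single : ∀ c → sumBy (λ i → count i J) (nonHookItem la c) ≡ cyclicPart c (toList J)
    single (isHook _ _ _ _) = refl
    single (isNonHook nh) = +-identityʳ _

  columnRowItem : ∀ k → suc k ≤ m → Item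
  columnRowItem k p = record
    { shape = columnRow-shape {m ∸ suc k} {k} e
    ; count = λ J → indicator (suc k) (ones (toList J))
    ; labelling = columnRow-labelling {m ∸ suc k} {k} e }
    where
    e : suc (m ∸ suc k) + suc k ≡ suc m
    e = cong suc (m∸n+n≡m p)

  -- Column lengths run from 1 to at most `m`, so that both components keep at least one of the
  -- `suc m` cells.
  columnRowItems : (ℕ → ℕ) → ∀ k → k ≤ m → List Item
  columnRowItems μ zero p = []
  columnRowItems μ (suc k) p = replicate (μ (suc k)) (columnRowItem k p) ++ columnRowItems μ k (≤-trans (n≤1+n k) p)

  indicator-≡ : ∀ k → indicator k k ≡ 1
  indicator-≡ k with k ≟ k
  ... | yes _ = refl
  ... | no n = contradiction refl n

  indicator-≢ : ∀ {k j} → k ≢ j → indicator k j ≡ 0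
  indicator-≢ {k} {j} n with k ≟ j
  ... | yes e = contradiction e n
  ... | no _ = refl

  module _ (μ : ℕ → ℕ) (J : Vec Bool (suc m)) where

    private
      total : ∀ k → k ≤ m → ℕ
      total k p = sumBy (λ i → count i J) (columnRowItems μ k p)

      o = ones (toList J)

    columnRowItems-step : ∀ k p → total (suc k) p ≡ μ (suc k) * indicator (suc k) o + total k (≤-trans (n≤1+n k) p)
    columnRowItems-step k p = trans (sumBy-++ _ (replicate (μ (suc k)) (columnRowItem k p)) _)
      (cong (_+ total k (≤-trans (n≤1+n k) p)) (sumBy-replicate _ (μ (suc k)) (columnRowItem k p)))

    columnRowItems-none : ∀ k p → k < o ⊎ o ≡ 0 → total k p ≡ 0
    columnRowItems-none zero p h = refl
    columnRowItems-none (suc k) p h = trans (columnRowItems-step k p)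
      (cong₂ _+_ (trans (cong (μ (suc k) *_) (indicator-≢ (distinct h))) (*-zeroʳ (μ (suc k)))) (columnRowItems-none k _ (weaken h)))
      where
      distinct : suc k < o ⊎ o ≡ 0 → suc k ≢ o
      distinct (inj₁ q) = <⇒≢ q
      distinct (inj₂ q) e = contradiction (trans e q) λ ()
      weaken : suc k < o ⊎ o ≡ 0 → k < o ⊎ o ≡ 0
      weaken (inj₁ q) = inj₁ (<⇒≤ q)
      weaken (inj₂ q) = inj₂ q

    columnRowItems-count : ∀ k p → 0 < o → o ≤ k → total k p ≡ μ o
    columnRowItems-count zero p 0<o o≤k = contradiction (≤-trans 0<o o≤k) λ ()
    columnRowItems-count (suc k) p 0<o o≤k with suc k ≟ o
    ... | yes e = trans (columnRowItems-step k p) (trans (cong₂ _+_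
                    (trans (cong₂ (λ x y → μ x * indicator (suc k) y) e (sym e)) (trans (cong (μ o *_) (indicator-≡ (suc k))) (*-identityʳ (μ o))))
                    (columnRowItems-none k _ (inj₁ (≤-reflexive e)))) (+-identityʳ _))
    ... | no n = trans (columnRowItems-step k p) (trans (cong (_+ total k (≤-trans (n≤1+n k) p))
                    (trans (cong (μ (suc k) *_) (indicator-≢ n)) (*-zeroʳ (μ (suc k)))))
                    (columnRowItems-count k _ 0<o (≤-pred (≤∧≢⇒< o≤k (λ e → n (sym e))))))

ones-≤ : ∀ s → ones s ≤ length s
ones-≤ s = subst (ones s ≤_) (zeros+ones s) (m≤n+m (ones s) (zeros s))

module _ {m} (0<m : 0 < m) (A : Vec (Fin (suc m)) (suc m) → Bool) (L : List (Partition (suc m)))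
         (bij : ∀ (w : Vec ℕ (suc m)) → WeaklyIncreasing w →
                Elems (suc m) A (λ π → OccursInF (Des π) w) ↔
                Σ (Fin (length L)) (λ k → SSYT (value (List.lookup L k)) w))
         (inv : RotationInvariant (suc m) A) where

  private
    N : List Bool → ℕ
    N s = sumBy (λ la → cyclicPart (classes la) s) L

    H : ℕ → ℕ
    H j = sumBy (λ la → hookPart (classes la) j) L

    -- The multiplicity of the shape with a column of `k` cells, a natural number because it counts
    -- permutations in `A`.
    μ : ℕ → ℕ
    μ k = cDesCount A (block (suc m ∸ k) k)

    linear : ∀ s → length s ≡ m → cDesCount A (s ∷ʳ false) + cDesCount A (s ∷ʳ true) ≡ (N (s ∷ʳ false) + N (s ∷ʳ true)) + H (ones s)
    linear s l = begin
      cDesCount A (s ∷ʳ false) + cDesCount A (s ∷ʳ true) ≡⟨ cDesCount-extends A s ⟩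
      cnt (desCounter A) (_≟ᴮ s) ≡⟨ descent-count A L bij s l ⟩
      cnt (shapeCounter A L bij) (_≟ᴮ s) ≡⟨ sumCounter-sumBy (λ la → tabCounter (value la)) L (_≟ᴮ s) ⟩
      sumBy (λ la → cnt (tabCounter (value la)) (_≟ᴮ s)) L ≡⟨ sumBy-cong L (λ la → sym (classified-extends (classes la) s l)) ⟩
      sumBy (λ la → (f la + t la) + h la) L ≡⟨ sumBy-+ (λ la → f la + t la) h L ⟩
      sumBy (λ la → f la + t la) L + H (ones s) ≡⟨ cong (_+ H (ones s)) (sumBy-+ f t L) ⟩
      (N (s ∷ʳ false) + N (s ∷ʳ true)) + H (ones s) ∎
      where
      open ≡-Reasoning
      f t h : Partition (suc m) → ℕ
      f la = cyclicPart (classes la) (s ∷ʳ false)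
      t la = cyclicPart (classes la) (s ∷ʳ true)
      h la = hookPart (classes la) (ones s)

    -- No item accounts for the empty or the full string, but there `μ` is 0: a permutation of at
    -- least two letters has both a cyclic descent and a cyclic ascent.
    μ-total : ∀ (J : Vec Bool (suc m)) → μ (ones (toList J)) ≡ sumBy (λ i → Item.count i J) (columnRowItems μ m ≤-refl)
    μ-total J with ones (toList J) ≟ 0 | ones (toList J) ≤? m
    ... | yes e | _ = trans (cong μ e) (trans (cong (cDesCount A) (++-identityʳ _)) (trans (cDesCount-false A 0<m) (sym (columnRowItems-none μ J m ≤-refl (inj₂ e)))))
    ... | no n | yes le = sym (columnRowItems-count μ J m ≤-refl (n≢0⇒n>0 n) le)
    ... | no n | no nle = trans (cong μ full) (trans (cong (λ z → cDesCount A (block z (suc m))) (n∸n≡0 (suc m)))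
                            (trans (cDesCount-true A) (sym (columnRowItems-none μ J m ≤-refl (inj₁ (≰⇒> nle))))))
      where
      full : ones (toList J) ≡ suc m
      full = ≤-antisym (subst (ones (toList J) ≤_) (toList-length J) (ones-≤ (toList J))) (≰⇒> nle)

    items : List Item
    items = nonHookItems L ++ columnRowItems μ m ≤-refl

    cDes-total : ∀ J → cDesCount A (toList J) ≡ sumBy (λ i → Item.count i J) items
    cDes-total J = begin
      cDesCount A (toList J) ≡⟨ cyclic-difference m (cDesCount A) N H (cDesCount-rotate A inv)
          (λ s b → sumBy-cong L (λ la → cyclicPart-rotate (classes la) s b)) linear
          (λ a k _ → sumBy-zero L (λ la → cyclicPart-block (classes la) a k))
          (ones (toList J)) (toList J) (toList-length J) refl (suc m ∸ ones (toList J))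
          (m∸n+n≡m (subst (ones (toList J) ≤_) (toList-length J) (ones-≤ (toList J)))) ⟩
      N (toList J) + μ (ones (toList J)) ≡⟨ cong₂ _+_ (sym (nonHookItems-count J L)) (μ-total J) ⟩
      sumBy (λ i → Item.count i J) (nonHookItems L) + sumBy (λ i → Item.count i J) (columnRowItems μ m ≤-refl)
        ≡⟨ sym (sumBy-++ (λ i → Item.count i J) (nonHookItems L) (columnRowItems μ m ≤-refl)) ⟩
      sumBy (λ i → Item.count i J) items ∎
      where open ≡-Reasoning

  cyclicSchurPositive : CyclicSchurPositive (suc m) A
  cyclicSchurPositive = map extended items , λ J →
    refine-↔ (cDesP A (toList J)) (Vec-≡-dec F._≟_) (λ π → π)
      (λ { π (i , a , e) → i , a , toList-injective _ J e }) (λ _ _ e → e)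
      (λ { π (i , a , e) → π , (i , a , cong toList e) , refl })
    ⨾ ≡-Fin (cDes-total J) ⨾ ↔-sym (items-↔ J items)

theorem3p10 : ∀ (n : ℕ) → 2 ≤ n → (A : Vec (Fin n) n → Bool)
    → SchurPositive n A → RotationInvariant n A
    → CyclicSchurPositive n A
theorem3p10 (suc m) (s≤s 0<m) A (L , bij) inv = cyclicSchurPositive 0<m A L bij inv
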